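{- Let $\lambda\supseteq\mu$ be partitions with $\mathrm{rank}(\lambda/\mu)=r$. Then $$\mathrm{mbsd}(\lambda/\mu)=\mathrm{is}(\lambda/\mu)^2,\qquad \mathrm{mbst}(\lambda/\mu)=r!\,\mathrm{is}(\lambda/\mu),$$ where $\mathrm{mbsd}(\lambda/\mu)$ is the number of minimal border strip decompositions of $\lambda/\mu$ and $\mathrm{mbst}(\lambda/\mu)$ is the number of minimal border strip tableaux of shape $\lambda/\mu$.
   Context: Skew diagram $\lambda/\mu=\{(i,j):\mu_i<j\le\lambda_i\}$; square $(i,j)$ is drawn as $[j-1,j]\times[-i,-i+1]$. $\mathrm{rank}(\lambda/\mu)$: an outside top corner is $(i,j)\in\lambda/\mu$ with $(i-1,j),(i,j-1)\notin\lambda/\mu$; an inside top corner is $(i,j)\in\lambda/\mu$ with $(i-1,j),(i,j-1)\in\lambda/\mu$, $(i-1,j-1)\notin\lambda/\mu$; the diagonal of a corner $(i,j)$ is $\{(i+p,j+p)\in\lambda/\mu: p\ge0\}$; rank is the number of squares on outside diagonals minus the number on inside diagonals. A border strip is a nonempty edge-connected skew diagram with no $2\times2$ block. A border strip decomposition of $\lambda/\mu$ is a partition of its squares into border strips; minimal if it has the fewest strips. A border strip tableau of shape $\lambda/\mu$ is a chain of partitions $\mu=\lambda^0\subset\lambda^1\subset\cdots\subset\lambda^m=\lambda$ with each $\lambda^i/\lambda^{i-1}$ a border strip; its border strips form a border strip decomposition, and the tableau is minimal if this decomposition is minimal. Snakes and interval sets: for a partition $\alpha$, its boundary path goes up $x=0$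 from $y=-\infty$ to $(0,-\ell(\alpha))$, follows the lower-right boundary of the diagram of $\alpha$ to $(\alpha_1,0)$, then right along $y=0$; the step starting at $(x,y)$ has index $x+y$. For $k\in\mathbb{Z}$ let $e_k$ be step $k$ of the boundary path of $\lambda$. If $e_k$ is also a step of the path of $\mu$, $S_k=\emptyset$. Otherwise, if $e_k$ is horizontal it is the lower edge of $(i,j)\in\lambda/\mu$ and $S_k=(\lambda/\mu)\cap\{(i,j),(i,j-1),(i-1,j-1),(i-1,j-2),\dots\}$; if vertical it is the right edge of $(i,j)\in\lambda/\mu$ and $S_k=(\lambda/\mu)\cap\{(i,j),(i-1,j),(i-1,j-1),(i-2,j-1),\dots\}$. $\ell(S_k)=|S_k|-1$. $q_k=L$ ($S_k$ a left snake) if $e_k$ is horizontal and $\ell(S_k)\ge0$ is even; $q_k=R$ (right snake) if $e_k$ is vertical and $\ell(S_k)\ge0$ is even; otherwise $q_k=O$. An interval set is a set of $r$ pairs $(u_i,v_i)$ of integers, the $2r$ integers distinct, $u_i<v_i$, $q_{u_i}=L$, $q_{v_i}=R$. $\mathrm{is}(\lambda/\mu)$ is the number of interval sets. -}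

module Defs where

open import Level using (0ℓ)
open import Data.Nat as ℕ using (ℕ; zero; suc; _+_; _*_; _∸_; _≤_; _<_; _≥_; _≟_)
open import Data.Nat.Properties using (_<?_)
open import Data.Nat.Divisibility using (_∣_)
open import Data.Integer as ℤ using (ℤ; +_; _-_)
open import Data.List using (List; []; _∷_; length; map; upTo; concatMap)
open import Data.Nat.ListAction using (sum)
open import Data.List.Relation.Unary.All using (All)
open import Data.List.Relation.Unary.Linked using (Linked)
open import Data.List.Relation.Unary.Unique.Propositional using (Unique)
open import Data.Product using (Σ; ∃; _×_; _,_; proj₁; proj₂)
open import Data.Sum using (_⊎_)
open import Data.Bool using (Bool; true; false; if_then_else_; _∧_; not)
open import Relation.Nullary using (¬_; Dec; does)
open import Relation.Nullary.Decidable using (_×-dec_)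
open import Relation.Binary using (Setoid)
open import Relation.Binary.PropositionalEquality using (_≡_; refl)
open import Function using (id; _∘_)

IsPartition : List ℕ → Set
IsPartition l = Linked _≥_ l × All (0 <_) l

record Partition : Set where
  constructor mkPartition
  field
    parts : List ℕ
    .isPartition : IsPartition parts
open Partition public

-- row l i = l_i (1-based); row l 0 = 0 and l_i = 0 for i > length l
row : List ℕ → ℕ → ℕ
row l        zero          = 0
row []       (suc i)       = 0
row (x ∷ l)  (suc zero)    = x
row (x ∷ l)  (suc (suc i)) = row l (suc i)

_⊆ₚ_ : List ℕ → List ℕ → Set
mu ⊆ₚ la = ∀ i → row mu i ≤ row la i

-- Cells and skew diagrams.  Cell (i , j) = row i, column j (i,j ≥ 1).

Cell : Set
Cell = ℕ × ℕ

InSkew : List ℕ → List ℕ → Cell → Set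
InSkew la mu (i , j) = row mu i < j × j ≤ row la i

inSkew? : ∀ la mu c → Dec (InSkew la mu c)
inSkew? la mu (i , j) = (row mu i <? j) ×-dec (j ℕ.≤? row la i)

ind : ∀ la mu → Cell → ℕ
ind la mu c = if does (inSkew? la mu c) then 1 else 0

inᵇ : ∀ la mu → Cell → Bool
inᵇ la mu c = does (inSkew? la mu c)

oneTo : ℕ → List ℕ
oneTo n = map suc (upTo n)

boxCells : List ℕ → List Cell
boxCells la = concatMap (λ i → map (λ j → (i , j)) (oneTo (row la 1))) (oneTo (length la))

-- number of squares of la/mu on the diagonal {(i+p , j+p) : p ≥ 0}
-- (for p > length la the row is empty, so the bound is harmless)
diagLen : List ℕ → List ℕ → Cell → ℕ
diagLen la mu (i , j) = sum (map (λ p → ind la mu (i + p , j + p)) (upTo (suc (length la))))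

outsideCornerᵇ : List ℕ → List ℕ → Cell → Bool
outsideCornerᵇ la mu (i , j) =
  inᵇ la mu (i , j) ∧ not (inᵇ la mu (i ∸ 1 , j)) ∧ not (inᵇ la mu (i , j ∸ 1))

insideCornerᵇ : List ℕ → List ℕ → Cell → Bool
insideCornerᵇ la mu (i , j) =
  inᵇ la mu (i , j) ∧ inᵇ la mu (i ∸ 1 , j) ∧ inᵇ la mu (i , j ∸ 1)
    ∧ not (inᵇ la mu (i ∸ 1 , j ∸ 1))

cornerDiagSum : (Cell → Bool) → List ℕ → List ℕ → ℕ
cornerDiagSum isCorner la mu =
  sum (map (λ c → if isCorner c then diagLen la mu c else 0) (boxCells la))

rank : List ℕ → List ℕ → ℤ
rank la mu = + cornerDiagSum (outsideCornerᵇ la mu) la mu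
           - + cornerDiagSum (insideCornerᵇ la mu) la mu

Adj : Cell → Cell → Set
Adj (i , j) (i' , j') =
  (i' ≡ suc i × j' ≡ j) ⊎ (suc i' ≡ i × j' ≡ j) ⊎
  (i' ≡ i × j' ≡ suc j) ⊎ (i' ≡ i × suc j' ≡ j)

data Path (P : Cell → Set) : Cell → Cell → Set where
  here : ∀ {c} → Path P c c
  step : ∀ {c c' d} → Adj c c' → P c' → Path P c' d → Path P c d

EdgeConnected : (Cell → Set) → Set
EdgeConnected P = ∀ c d → P c → P d → Path P c d

No2×2 : (Cell → Set) → Set
No2×2 P = ∀ i j → ¬ (P (i , j) × P (suc i , j) × P (i , suc j) × P (suc i , suc j))

_⇔ₛ_ : Set → Set → Set
A ⇔ₛ B = (A → B) × (B → A)

IsSkewDiagram : (Cell → Set) → Set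
IsSkewDiagram P = Σ Partition λ α → Σ Partition λ β →
  (parts β ⊆ₚ parts α) × (∀ c → P c ⇔ₛ InSkew (parts α) (parts β) c)

IsBorderStrip : (Cell → Set) → Set
IsBorderStrip P = (∃ λ c → P c) × EdgeConnected P × No2×2 P × IsSkewDiagram P

record Decomposition (la mu : List ℕ) : Set where
  field
    nStrips     : ℕ
    label       : Cell → ℕ
    label-bound : ∀ c → InSkew la mu c → label c < nStrips
    label-onto  : ∀ k → k < nStrips → ∃ λ c → InSkew la mu c × label c ≡ k
    strip       : ∀ k → k < nStrips → IsBorderStrip (λ c → InSkew la mu c × label c ≡ k)
open Decomposition public

-- two labellings give the same decomposition iff they induce the same
-- "same strip" relation on the cells of la/mu
_≈D_ : ∀ {la mu} → Decomposition la mu → Decomposition la mu → Set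
_≈D_ {la} {mu} D E = ∀ c d → InSkew la mu c → InSkew la mu d →
  (label D c ≡ label D d) ⇔ₛ (label E c ≡ label E d)

IsMinimalDecomposition : ∀ {la mu} → Decomposition la mu → Set
IsMinimalDecomposition {la} {mu} D = ∀ (E : Decomposition la mu) → nStrips D ≤ nStrips E

MinDecomposition : List ℕ → List ℕ → Set
MinDecomposition la mu = Σ (Decomposition la mu) IsMinimalDecomposition

MinDecompositionSetoid : List ℕ → List ℕ → Setoid 0ℓ 0ℓ
MinDecompositionSetoid la mu = record
  { Carrier = MinDecomposition la mu
  ; _≈_ = λ D E → proj₁ D ≈D proj₁ E
  ; isEquivalence = record
    { refl  = λ c d _ _ → id , id
    ; sym   = λ p c d x y → proj₂ (p c d x y) , proj₁ (p c d x y)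
    ; trans = λ p q c d x y → proj₁ (q c d x y) ∘ proj₁ (p c d x y)
                            , proj₂ (p c d x y) ∘ proj₂ (q c d x y)
    }
  }

-- Border strip tableaux: chain mu = λ⁰ ⊂ λ¹ ⊂ ... ⊂ λᵐ = la, stored as
-- the list [λ¹ , ... , λᵐ] of (canonical) partitions.

ChainFrom : List ℕ → List (List ℕ) → List ℕ → Set
ChainFrom prev []       target = prev ≡ target
ChainFrom prev (p ∷ ps) target =
  IsPartition p × (prev ⊆ₚ p) × IsBorderStrip (InSkew p prev) × ChainFrom p ps target

record MinTableau (la mu : List ℕ) : Set where
  constructor mkMinTableau
  field
    chain      : List (List ℕ)
    .isChain   : ChainFrom mu chain la
    .isMinimal : ∀ (E : Decomposition la mu) → length chain ≤ nStrips E

-- horizontal step of the path of l starting at (x , -i); l_0 = ∞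
HStep : List ℕ → ℕ → ℕ → Set
HStep l i x = (i ≡ 0 ⊎ x < row l i) × row l (suc i) ≤ x

-- vertical step of the path of l starting at (l_i , -i), i ≥ 1
VStep : List ℕ → ℕ → Set
VStep l i = 1 ≤ i

-- |S| for the snake of a horizontal step, lower edge of (i , j):
-- (i,j),(i,j-1),(i-1,j-1),(i-1,j-2),...  intersected with la/mu
-- (cells with a zero coordinate are never in la/mu)
hSnakeSize : List ℕ → List ℕ → ℕ → ℕ → ℕ
hSnakeSize la mu i j =
  sum (map (λ a → ind la mu (i ∸ a , j ∸ a) + ind la mu (i ∸ a , j ∸ suc a)) (upTo (suc (i + j))))

-- |S| for the snake of a vertical step, right edge of (i , j):
-- (i,j),(i-1,j),(i-1,j-1),(i-2,j-1),...
vSnakeSize : List ℕ → List ℕ → ℕ → ℕ → ℕ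
vSnakeSize la mu i j =
  sum (map (λ a → ind la mu (i ∸ a , j ∸ a) + ind la mu (i ∸ suc a , j ∸ a)) (upTo (suc (i + j))))

EvenSnake : ℕ → Set
EvenSnake s = ∃ λ ℓ → s ≡ suc ℓ × 2 ∣ ℓ

IsL : List ℕ → List ℕ → ℤ → Set
IsL la mu k = ∃ λ i → ∃ λ x →
  HStep la i x × (+ x - + i ≡ k) × ¬ HStep mu i x × EvenSnake (hSnakeSize la mu i (suc x))

IsR : List ℕ → List ℕ → ℤ → Set
IsR la mu k = ∃ λ i →
  VStep la i × (+ row la i - + i ≡ k) × ¬ (row mu i ≡ row la i)
    × EvenSnake (vSnakeSize la mu i (row la i))

flatten : List (ℤ × ℤ) → List ℤ
flatten = concatMap (λ p → proj₁ p ∷ proj₂ p ∷ [])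

-- a set of pairs, represented canonically as a list sorted by u
ValidIntervalSet : List ℕ → List ℕ → List (ℤ × ℤ) → Set
ValidIntervalSet la mu ps =
  Linked (λ p q → proj₁ p ℤ.< proj₁ q) ps ×
  Unique (flatten ps) ×
  All (λ p → (proj₁ p ℤ.< proj₂ p) × IsL la mu (proj₁ p) × IsR la mu (proj₂ p)) ps ×
  (+ length ps ≡ rank la mu)

record IntervalSet (la mu : List ℕ) : Set where
  constructor mkIntervalSet
  field
    pairs  : List (ℤ × ℤ)
    .valid : ValidIntervalSet la mu pairs

{-# OPTIONS --safe #-}

-- Compare the boundary paths of λ and μ step by step.  With n(c) the number of squares of λ/μ of content c,
-- |S_k| = n(k) + n(k+1), so q_k = L (resp. R) iff step k is horizontal in λ and vertical in μ (resp. vertical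
-- in λ and horizontal in μ), and n goes up by 1 at each L, down by 1 at each R.  Summing n over the corners
-- of μ by parts shows that the rank r is the number of L's.
--
-- Choosing partners for the L's from right to left, L at k has n(k+1) free partners, so is = ∏_{L} n(k+1);
-- by comparing ascents and descents of n this is also ∏_{R} n(k).
--
-- A border strip has at most one square of each content, so a decomposition is a choice, for every k, of a
-- matching of the snake formed by the squares of contents k and k+1.  Every L forces at least one unmatched
-- square of content k+1, where a strip begins; so there are at least r strips, with equality iff all the
-- matchings are maximum.  A maximum matching is unique for O and given by the one square left out for L and R,
-- which gives ∏_{L} n(k+1) · ∏_{R} n(k) = is².
--
-- Adding a border strip exchanges a vertical step u of the path with a horizontal step v > u.  A chain from μ
-- to λ of length r must exchange an L with an R each time, so it is an interval set with an order of its pairs.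

module Submission where

open import Defs
open import Data.Nat using (ℕ; _*_; _!)
open import Data.Integer using (+_)
open import Data.Fin using (Fin)
open import Data.Product using (∃)
open import Data.Product using (_×_)
open import Function.Bundles using (_↔_; Inverse)
open import Relation.Binary.PropositionalEquality using (_≡_; setoid)

open import Level using (0ℓ)
open import Data.Bool using (if_then_else_)
open import Data.Empty using (⊥; ⊥-elim)
open import Data.Fin as Fin using ()
open import Data.Integer as ℤ using (ℤ; _-_; _⊖_)
import Data.Integer.Properties as ℤₚ
open import Data.List using (List; []; _∷_; _++_; _∷ʳ_; concatMap; length; lookup; map; upTo)
open import Data.List.Membership.Propositional using (_∈_; _∉_)
import Data.List.Membership.DecPropositional as DecMembership
open import Data.List.Membership.Propositional.Properties using (∈-∃++; ∈-map⁺; ∈-map⁻; ∈-++⁺ˡ; ∈-++⁺ʳ; ∈-++⁻; ∈-lookup)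
open import Data.List.Properties using (length-map; length-++; map-++; map-∘; map-injective; upTo-∷ʳ; ∷-injective; ≡-dec)
open import Data.List.Relation.Binary.Permutation.Propositional using (_↭_; ↭-refl; ↭-sym; ↭-trans; prep; ↭⇒↭ₛ)
open import Data.List.Relation.Binary.Permutation.Propositional.Properties using (shift; drop-∷; ∈-resp-↭; ↭-length; ↭-empty-inv; All-resp-↭; map⁺)
import Data.List.Relation.Binary.Permutation.Setoid.Properties as Permₛ
open import Data.List.Relation.Unary.All as All using (All; []; _∷_)
import Data.List.Relation.Unary.All.Properties as Allₚ
open import Data.List.Relation.Unary.All.Properties using (¬Any⇒All¬; All¬⇒¬Any)
open import Data.List.Relation.Unary.AllPairs as AllPairs using (AllPairs; []; _∷_)
import Data.List.Relation.Unary.AllPairs.Properties as AllPairsₚ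
open import Data.List.Relation.Unary.Any using (here; there; index)
open import Data.List.Relation.Unary.Any.Properties using (lookup-index)
open import Data.List.Relation.Unary.Linked as Linked using (Linked; []; [-]; _∷_)
open import Data.List.Relation.Unary.Linked.Properties using (Linked⇒AllPairs; AllPairs⇒Linked)
open import Data.List.Relation.Unary.Unique.Propositional using (Unique)
import Data.List.Relation.Unary.Unique.Propositional.Properties as Uniqueₚ
open import Data.Nat using (zero; suc; _+_; _∸_; _≤_; _<_; _≥_; z≤n; s≤s; _≟_; _≤?_)
open import Data.Nat.Divisibility using (divides; ∣m+n∣m⇒∣n; ∣⇒≤)
open import Data.Nat.ListAction using (sum)
open import Data.Nat.ListAction.Properties using (sum-++)
open import Data.Nat.Properties
open import Algebra.Properties.CommutativeSemigroup +-commutativeSemigroup using (interchange)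
open import Data.Product using (_,_; proj₁; proj₂)
open import Data.Product.Properties using () renaming (≡-dec to ×-≡-dec)
open import Data.Sum using (_⊎_; inj₁; inj₂)
open import Function using (_∘_; id; case_of_)
open import Relation.Binary using (Setoid; DecidableEquality; tri<; tri≈; tri>)
open import Relation.Binary.PropositionalEquality using (_≢_; refl; sym; trans; cong; cong₂; subst; subst₂; module ≡-Reasoning)
open import Relation.Nullary using (¬_; Dec; yes; no; does)
open import Relation.Nullary.Decidable using (_×-dec_; ¬?; dec-true; dec-false; decidable-stable; recompute)

-- Finite enumerations

-- Objects are counted through codes that are plain lists, because decompositions are given only up
-- to `_≈D_` and tableaux carry irrelevant proofs. Why every choice of matchings gives a
-- decomposition: a square has at most one partner of the next smaller content, so following
-- partners towards smaller contents ends at an unmatched square. The squares ending at the same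
-- place have at most one member per content, and such a linked set is automatically connected,
-- convex and free of 2×2 blocks. Why a maximum matching has at most one parameter: squares of equal
-- content cannot share a partner, so a square matched with its lower neighbour forbids the square
-- diagonally below it to be matched with its left neighbour. Down the rows the choice can pass from
-- left to lower only once, unless an unmatched square intervenes. Why a shortest chain exchanges an
-- L with an R: exchanging steps u and v alters letters only at these two places. At most the L at u
-- is lost, and if v is not an R, then v turns into an L and makes up for it.

private
  variable
    A B : Set
    P Q : A → Set
    m n : ℕ

Unique-↭ : {xs ys : List A} → xs ↭ ys → Unique xs → Unique ys
Unique-↭ p = Permₛ.Unique-resp-↭ (setoid _) (↭⇒↭ₛ p)

∈⇒↭∷ : {x : A} {xs : List A} → x ∈ xs → ∃ λ ys → xs ↭ x ∷ ys
∈⇒↭∷ {x = x} x∈ with ∈-∃++ x∈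
... | ys , zs , refl = ys ++ zs , shift x ys zs

Unique-⊆⇒length≤ : {xs ys : List A} → Unique xs → (∀ {a} → a ∈ xs → a ∈ ys) → length xs ≤ length ys
Unique-⊆⇒length≤ {xs = []} _ _ = z≤n
Unique-⊆⇒length≤ {xs = x ∷ xs} (x∉ ∷ u) ⊆ with ∈⇒↭∷ (⊆ (here refl))
... | ys′ , p = subst (_ ≤_) (sym (↭-length p)) (s≤s (Unique-⊆⇒length≤ u sub))
  where
  sub : ∀ {a} → a ∈ xs → a ∈ ys′
  sub a∈ with ∈-resp-↭ p (⊆ (there a∈))
  ... | here refl = ⊥-elim (All¬⇒¬Any x∉ a∈)
  ... | there q = q

-- The list holds bare elements without proofs of `P`, so a property with many proofs is still
-- counted once per element.
record Enum {A : Set} (P : A → Set) (n : ℕ) : Set where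
  constructor mkEnum
  field
    list     : List A
    unique   : Unique list
    size     : length list ≡ n
    sound    : ∀ {a} → a ∈ list → P a
    complete : ∀ {a} → P a → a ∈ list
open Enum public

enum-⇔ : (∀ {a} → P a → Q a) → (∀ {a} → Q a → P a) → Enum P n → Enum Q n
enum-⇔ f g e = mkEnum (list e) (unique e) (size e) (f ∘ sound e) (complete e ∘ g)

enum-∈ : (xs : List A) → Unique xs → Enum (_∈ xs) (length xs)
enum-∈ xs u = mkEnum xs u refl id id

enum-∅ : (∀ {a} → ¬ P a) → Enum P 0
enum-∅ ¬p = mkEnum [] [] refl (λ ()) (⊥-elim ∘ ¬p)

enum-single : (x : A) → Enum (_≡ x) 1
enum-single x = mkEnum (x ∷ []) ([] ∷ []) refl (λ { (here p) → p }) here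

enum-insert : {x : A} → ¬ P x → Enum P n → Enum (λ a → a ≡ x ⊎ P a) (suc n)
enum-insert {x = x} ¬px e = mkEnum (x ∷ list e)
  (¬Any⇒All¬ _ (¬px ∘ sound e) ∷ unique e) (cong suc (size e))
  (λ { (here p) → inj₁ p ; (there p) → inj₂ (sound e p) })
  (λ { (inj₁ p) → here p ; (inj₂ p) → there (complete e p) })

enum-remove : {x : A} → P x → Enum P (suc n) → Enum (λ a → P a × a ≢ x) n
enum-remove {P = P} {x = x} px e with ∈⇒↭∷ (complete e px)
... | ys , p with Unique-↭ p (unique e)
... | x∉ ∷ u = mkEnum ys u (suc-injective (trans (sym (↭-length p)) (size e)))
  (λ a∈ → sound e (∈-resp-↭ (↭-sym p) (there a∈)) , λ { refl → All¬⇒¬Any x∉ a∈ })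
  (λ { (pa , ≢) → case ∈-resp-↭ p (complete e pa) of λ { (here q) → ⊥-elim (≢ q) ; (there q) → q } })

enum-mono : (∀ {a} → P a → Q a) → Enum P m → Enum Q n → m ≤ n
enum-mono f e e′ = subst₂ _≤_ (size e) (size e′) (Unique-⊆⇒length≤ (unique e) (complete e′ ∘ f ∘ sound e))

enum-size-unique : (∀ {a} → P a → Q a) → (∀ {a} → Q a → P a) → Enum P m → Enum Q n → m ≡ n
enum-size-unique f g e e′ = ≤-antisym (enum-mono f e e′) (enum-mono g e′ e)

-- An element of `Q` missing from the list of `P` could be added to it, giving more than `n`
-- distinct elements of `Q`. This is how equality in a bound on sizes is exploited.
enum-pigeonhole : DecidableEquality A → {P Q : A → Set} → (∀ {a} → P a → Q a) → Enum P m → Enum Q n → n ≤ m →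
  ∀ {a} → Q a → P a
enum-pigeonhole _≟A_ {P} {Q} f e e′ n≤m {a} qa with a ∈? list e
  where open DecMembership _≟A_ using (_∈?_)
... | yes a∈ = sound e a∈
... | no a∉ = ⊥-elim (<⇒≱ (enum-mono (λ { (inj₁ refl) → qa ; (inj₂ q) → f (sound e q) })
    (enum-insert a∉ (mkEnum (list e) (unique e) (size e) id id)) e′) n≤m)

enum-map : (f : A → B) → (∀ {a a′} → P a → P a′ → f a ≡ f a′ → a ≡ a′) →
  Enum P n → Enum (λ b → ∃ λ a → P a × b ≡ f a) n
enum-map {A = A} {P = P} f inj e = mkEnum (map f (list e)) (uniq (list e) (unique e) (sound e))
  (trans (length-map f (list e)) (size e))
  (λ b∈ → let a , a∈ , eq = ∈-map⁻ f b∈ in a , sound e a∈ , eq)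
  (λ { (a , pa , refl) → ∈-map⁺ f (complete e pa) })
  where
  uniq : (xs : List A) → Unique xs → (∀ {a} → a ∈ xs → P a) → Unique (map f xs)
  uniq [] _ _ = []
  uniq (x ∷ xs) (x∉ ∷ u) s = ¬Any⇒All¬ _ (λ fx∈ → let a , a∈ , eq = ∈-map⁻ f fx∈ in
      All¬⇒¬Any x∉ (subst (_∈ xs) (sym (inj (s (here refl)) (s (there a∈)) eq)) a∈))
    ∷ uniq xs u (s ∘ there)

enum-⊎ : (∀ {a} → P a → ¬ Q a) → Enum P m → Enum Q n → Enum (λ a → P a ⊎ Q a) (m + n)
enum-⊎ {P = P} {Q = Q} dis e e′ = mkEnum (list e ++ list e′)
  (Uniqueₚ.++⁺ (unique e) (unique e′) (λ (p , q) → dis (sound e p) (sound e′ q)))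
  (trans (length-++ (list e)) (cong₂ _+_ (size e) (size e′)))
  (λ a∈ → case ∈-++⁻ (list e) a∈ of λ { (inj₁ p) → inj₁ (sound e p) ; (inj₂ p) → inj₂ (sound e′ p) })
  (λ { (inj₁ p) → ∈-++⁺ˡ (complete e p) ; (inj₂ p) → ∈-++⁺ʳ (list e) (complete e′ p) })

-- All fibres have the same size although the fibres themselves vary: this is what turns successive
-- dependent choices into a product.
enum-Σ : {R : A → B → Set} → Enum P n → (∀ {a} → P a → Enum (R a) m) →
  Enum (λ ((a , b) : A × B) → P a × R a b) (n * m)
enum-Σ {A = A} {B = B} {P = P} {n = n} {m = m} {R = R} e f =
  subst (Enum _) (cong (_* m) (size e))
    (enum-⇔ (λ (p , q) → sound e p , q) (λ (p , q) → complete e p , q) (go (list e) (unique e) (sound e)))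
  where
  go : (xs : List A) → Unique xs → (∀ {a} → a ∈ xs → P a) → Enum (λ (a , b) → a ∈ xs × R a b) (length xs * m)
  go [] _ _ = enum-∅ (λ { (() , _) })
  go (x ∷ xs) (x∉ ∷ u) s = enum-⇔
    (λ { {_ , _} (inj₁ (b , r , refl)) → here refl , r ; {_ , _} (inj₂ (p , r)) → there p , r })
    (λ { {_ , _} (here refl , r) → inj₁ (_ , r , refl) ; {_ , _} (there p , r) → inj₂ (p , r) })
    (enum-⊎ (λ { {_ , _} (b , _ , refl) (p , _) → All¬⇒¬Any x∉ p })
      (enum-map (x ,_) (λ { _ _ refl → refl }) (f (s (here refl))))
      (go xs u (s ∘ there)))

enum-interval : ∀ x y → Enum (λ t → x < t × t ≤ y) (y ∸ x)
enum-interval x zero = subst (Enum _) (sym (0∸n≡0 x)) (enum-∅ (λ { (p , z≤n) → case p of λ () }))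
enum-interval x (suc y) with x <? suc y
... | yes x<y = subst (Enum _) (sym (+-∸-assoc 1 (≤-pred x<y))) (enum-⇔
    (λ { (inj₁ refl) → x<y , ≤-refl ; (inj₂ (p , q)) → p , m≤n⇒m≤1+n q })
    (λ { (p , q) → case m≤n⇒m<n∨m≡n q of λ { (inj₁ (s≤s r)) → inj₂ (p , r) ; (inj₂ r) → inj₁ r } })
    (enum-insert (λ (_ , q) → 1+n≰n q) (enum-interval x y)))
... | no x≮y = subst (Enum _) (sym (m≤n⇒m∸n≡0 (≮⇒≥ x≮y))) (enum-∅ (λ (p , q) → x≮y (<-≤-trans p q)))

enum-< : ∀ n → Enum (_< n) n
enum-< n = enum-⇔ (λ { (suc t , (s≤s z≤n , t≤) , refl) → t≤ }) (λ {t} t< → suc t , (s≤s z≤n , t<) , refl)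
  (enum-map (_∸ 1) (λ { {zero} (() , _) ; {suc _} {zero} _ (() , _) ; {suc _} {suc _} _ _ refl → refl })
      (enum-interval 0 n))

enum-filter : {P : ℕ → Set} → (∀ k → Dec (P k)) → ∀ N → ∃ λ n → Enum (λ k → k < N × P k) n
enum-filter P? zero = 0 , enum-∅ (λ { (() , _) })
enum-filter P? (suc N) with P? N | enum-filter P? N
... | yes p | n , e = suc n , enum-⇔
  (λ { (inj₁ refl) → ≤-refl , p ; (inj₂ (q , r)) → m≤n⇒m≤1+n q , r })
  (λ { (s≤s q , r) → case m≤n⇒m<n∨m≡n q of λ { (inj₁ s) → inj₂ (s , r) ; (inj₂ s) → inj₁ s } })
  (enum-insert (λ (q , _) → 1+n≰n q) e)
... | no ¬p | n , e = n , enum-⇔ (λ (q , r) → m≤n⇒m≤1+n q , r)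
  (λ { (s≤s q , r) → case m≤n⇒m<n∨m≡n q of λ { (inj₁ s) → s , r ; (inj₂ refl) → ⊥-elim (¬p r) } }) e

enum-permutations : ∀ n (s : List A) → length s ≡ n → Unique s → Enum (_↭ s) (n !)
enum-permutations zero [] _ _ = enum-⇔ (λ { refl → ↭-refl }) ↭-empty-inv (enum-single [])
enum-permutations {A} (suc n) s len u = enum-⇔
  (λ { (_ , (_ , q) , refl) → q })
  (λ { {[]} q → case trans (↭-length q) len of λ () ; {x ∷ xs} q → (x , xs) , (∈-resp-↭ q (here refl) , q) , refl })
  (enum-map (λ (x , xs) → x ∷ xs) (λ { _ _ refl → refl })
    (enum-Σ {R = λ x xs → x ∷ xs ↭ s} (subst (Enum _) len (enum-∈ s u)) tails))
  where
  tails : ∀ {x} → x ∈ s → Enum (λ xs → x ∷ xs ↭ s) (n !)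
  tails {x} x∈ with ∈⇒↭∷ x∈
  ... | ys , p with Unique-↭ p u
  ... | _ ∷ uy = enum-⇔ (λ q → ↭-trans (prep x q) (↭-sym p)) (λ q → drop-∷ (↭-trans q p))
    (enum-permutations n ys (suc-injective (trans (sym (↭-length p)) len)) uy)

module _ {A : Set} {P : A → Set} {n : ℕ} (X : Setoid 0ℓ 0ℓ) where
  open Setoid X using (Carrier; _≈_) renaming (sym to ≈-sym; trans to ≈-trans; refl to ≈-refl)

  -- `R x a` reads: `a` is a code of `x`. The code is asked to lie in the list, not to satisfy `P`,
  -- because list membership can be decidable and hence recovered from irrelevant proofs. The last
  -- two hypotheses say that codes separate exactly the classes of `_≈_`.
  enum-inverse : (e : Enum P n) (R : Carrier → A → Set) →
    (∀ x → ∃ λ a → a ∈ list e × R x a) →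
    (∀ a → P a → ∃ λ x → R x a) →
    (∀ {x y a b} → x ≈ y → P a → P b → R x a → R y b → a ≡ b) →
    (∀ {x y a} → P a → R x a → R y a → x ≈ y) →
    Inverse (setoid (Fin n)) X
  enum-inverse (mkEnum xs u refl s c) R code real inj det = record
    { to = to
    ; from = from
    ; to-cong = λ { refl → ≈-refl }
    ; from-cong = λ {x} {y} x≈y → index-unique u _ _ (inj x≈y (s (∈x x)) (s (∈x y)) (Rx x) (Rx y))
    ; inverse = (λ { {x} refl → det (s (∈x x)) (subst (R _) (sym (lookup-index (∈x x))) (Rto (from x))) (Rx x) })
              , λ {i} {x} x≈ → trans (index-unique u (∈x x) (∈-lookup {xs = xs} i)
                  (inj x≈ (s (∈x x)) (Pi i) (Rx x) (Rto i))) (index-∈-lookup xs i)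
    }
    where
    Pi : ∀ i → P (lookup xs i)
    Pi i = s (∈-lookup i)
    to : Fin _ → Carrier
    to i = proj₁ (real (lookup xs i) (Pi i))
    Rto : ∀ i → R (to i) (lookup xs i)
    Rto i = proj₂ (real (lookup xs i) (Pi i))
    ∈x : ∀ x → proj₁ (code x) ∈ xs
    ∈x x = proj₁ (proj₂ (code x))
    Rx : ∀ x → R x (proj₁ (code x))
    Rx x = proj₂ (proj₂ (code x))
    from : Carrier → Fin _
    from x = index (∈x x)
    index-unique : ∀ {ys : List A} {a b} → Unique ys → (p : a ∈ ys) (q : b ∈ ys) → a ≡ b → index p ≡ index q
    index-unique _ (here refl) (here refl) _ = refl
    index-unique (x∉ ∷ _) (here refl) (there q) refl = ⊥-elim (All¬⇒¬Any x∉ q)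
    index-unique (x∉ ∷ _) (there p) (here refl) refl = ⊥-elim (All¬⇒¬Any x∉ p)
    index-unique (_ ∷ u) (there p) (there q) eq = cong Fin.suc (index-unique u p q eq)
    index-∈-lookup : ∀ (ys : List A) i → index (∈-lookup {xs = ys} i) ≡ i
    index-∈-lookup (y ∷ ys) Fin.zero = refl
    index-∈-lookup (y ∷ ys) (Fin.suc i) = cong Fin.suc (index-∈-lookup ys i)

-- Partitions and the depth of their boundary paths

-- Returns 0 if no i with 1 ≤ i ≤ n satisfies Q.
maxUpTo : {Q : ℕ → Set} → (∀ i → Dec (Q i)) → ℕ → ℕ
maxUpTo Q? zero = 0
maxUpTo Q? (suc n) with Q? (suc n)
... | yes _ = suc n
... | no _ = maxUpTo Q? n

module _ {Q : ℕ → Set} (Q? : ∀ i → Dec (Q i)) where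

  maxUpTo-≤ : ∀ n → maxUpTo Q? n ≤ n
  maxUpTo-≤ zero = z≤n
  maxUpTo-≤ (suc n) with Q? (suc n)
  ... | yes _ = ≤-refl
  ... | no _ = m≤n⇒m≤1+n (maxUpTo-≤ n)

  maxUpTo-sat : ∀ n → 1 ≤ maxUpTo Q? n → Q (maxUpTo Q? n)
  maxUpTo-sat (suc n) p with Q? (suc n)
  ... | yes q = q
  ... | no _ = maxUpTo-sat n p

  maxUpTo-upper : ∀ n {i} → 1 ≤ i → i ≤ n → Q i → i ≤ maxUpTo Q? n
  maxUpTo-upper zero 1≤i i≤n _ = i≤n
  maxUpTo-upper (suc n) 1≤i i≤n q with Q? (suc n)
  ... | yes _ = i≤n
  ... | no ¬q with m≤n⇒m<n∨m≡n i≤n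
  ...   | inj₁ i<n = maxUpTo-upper n 1≤i (≤-pred i<n) q
  ...   | inj₂ refl = ⊥-elim (¬q q)

≤-ext : ∀ {a b} → (∀ {i} → 1 ≤ i → i ≤ a → i ≤ b) → (∀ {i} → 1 ≤ i → i ≤ b → i ≤ a) → a ≡ b
≤-ext {a} {b} f g = ≤-antisym (h f) (h g)
  where
  h : ∀ {a b} → (∀ {i} → 1 ≤ i → i ≤ a → i ≤ b) → a ≤ b
  h {zero} f = z≤n
  h {suc a} f = f (s≤s z≤n) ≤-refl

IsPartition? : ∀ l → Dec (IsPartition l)
IsPartition? l = Linked.linked? (λ x y → y ≤? x) l ×-dec All.all? (0 <?_) l

isPart : (α : Partition) → IsPartition (parts α)
isPart (mkPartition l p) = recompute (IsPartition? l) p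

Antitone : (ℕ → ℕ) → Set
Antitone f = ∀ {i} → 1 ≤ i → f (suc i) ≤ f i

antitone-≤ : ∀ {f} → Antitone f → ∀ {i k} → 1 ≤ i → i ≤ k → f k ≤ f i
antitone-≤ {f} anti {i} {k} 1≤i i≤k = go (k ∸ i) (m∸n+n≡m i≤k)
  where
  go : ∀ m {k} → m + i ≡ k → f k ≤ f i
  go zero refl = ≤-refl
  go (suc m) refl = ≤-trans (anti (≤-trans 1≤i (m≤n+m i m))) (go m refl)

row-antitone : ∀ {l} → IsPartition l → Antitone (row l)
row-antitone {[]} _ {suc i} _ = z≤n
row-antitone {x ∷ []} _ {suc zero} _ = z≤n
row-antitone {x ∷ []} _ {suc (suc i)} _ = z≤n
row-antitone {x ∷ y ∷ l} (p ∷ _ , _) {suc zero} _ = p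
row-antitone {x ∷ y ∷ l} (_ ∷ lk , _ ∷ al) {suc (suc i)} _ = row-antitone (lk , al) (s≤s z≤n)

row-beyond : ∀ l {i} → length l < i → row l i ≡ 0
row-beyond [] {suc i} _ = refl
row-beyond (x ∷ l) {suc (suc i)} (s≤s p) = row-beyond l p

row-ext : ∀ {k l} → IsPartition k → IsPartition l → (∀ {i} → 1 ≤ i → row k i ≡ row l i) → k ≡ l
row-ext {[]} {[]} _ _ _ = refl
row-ext {[]} {x ∷ l} _ (_ , p ∷ _) eq = ⊥-elim (<⇒≢ p (eq {1} ≤-refl))
row-ext {x ∷ k} {[]} (_ , p ∷ _) _ eq = ⊥-elim (<⇒≢ p (sym (eq {1} ≤-refl)))
row-ext {x ∷ k} {y ∷ l} (lk , _ ∷ ak) (ll , _ ∷ al) eq =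
  cong₂ _∷_ (eq {1} ≤-refl) (row-ext (Linked.tail lk , ak) (Linked.tail ll , al)
      λ { {suc i} _ → eq {suc (suc i)} (s≤s z≤n) })

fromRows : ℕ → (ℕ → ℕ) → List ℕ
fromRows zero f = []
fromRows (suc n) f with f 1 ≟ 0
... | yes _ = []
... | no _ = f 1 ∷ fromRows n (f ∘ suc)

row-fromRows : ∀ n {f} → Antitone f → (∀ {i} → n < i → f i ≡ 0) → ∀ {i} → 1 ≤ i → row (fromRows n f) i ≡ f i
row-fromRows zero anti z {suc i} p = sym (z p)
row-fromRows (suc n) {f} anti z {suc i} 1≤i with f 1 ≟ 0
... | yes eq = sym (n≤0⇒n≡0 (≤-trans (antitone-≤ anti ≤-refl 1≤i) (≤-reflexive eq)))
row-fromRows (suc n) {f} anti z {suc zero} 1≤i | no _ = refl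
row-fromRows (suc n) {f} anti z {suc (suc i)} 1≤i | no _ = row-fromRows n (λ _ → anti (s≤s z≤n)) (z ∘ s≤s) (s≤s z≤n)

fromRows-isPartition : ∀ n {f} → Antitone f → IsPartition (fromRows n f)
fromRows-isPartition zero anti = [] , []
fromRows-isPartition (suc n) {f} anti with f 1 ≟ 0
... | yes _ = [] , []
... | no f≢0 with fromRows-isPartition n {f ∘ suc} (λ _ → anti (s≤s z≤n))
...   | lk , al = link n lk , n≢0⇒n>0 f≢0 ∷ al
  where
  link : ∀ n → Linked _≥_ (fromRows n (f ∘ suc)) → Linked _≥_ (f 1 ∷ fromRows n (f ∘ suc))
  link zero _ = [-]
  link (suc n) lk with f 2 ≟ 0
  ... | yes _ = [-]
  ... | no _ = anti ≤-refl ∷ lk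

-- Skew diagrams as convex sets of cells

InSkew-convex : ∀ {α β} → IsPartition α → IsPartition β → ∀ {i₁ j₁ i₂ j₂ i j} →
  InSkew α β (i₁ , j₁) → InSkew α β (i₂ , j₂) → i₁ ≤ i → i ≤ i₂ → j₁ ≤ j → j ≤ j₂ → InSkew α β (i , j)
InSkew-convex {α} {β} pα pβ {i₁ = zero} (p , q) _ _ _ _ _ = ⊥-elim (<⇒≱ p q)
InSkew-convex {α} {β} pα pβ {i₁ = suc _} (p , q) (p′ , q′) i₁≤i i≤i₂ j₁≤j j≤j₂ =
  ≤-<-trans (antitone-≤ {row β} (row-antitone pβ) (s≤s z≤n) i₁≤i) (<-≤-trans p j₁≤j) ,
  ≤-trans j≤j₂ (≤-trans q′ (antitone-≤ {row α} (row-antitone pα) (≤-trans (s≤s z≤n) i₁≤i) i≤i₂))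

module _ {P : Cell → Set} (P? : ∀ x → Dec (P x)) (M C : ℕ)
  (P-bound : ∀ {i j} → P (i , j) → (1 ≤ i × i ≤ M) × (1 ≤ j × j ≤ C))
  (P-convex : ∀ {i₁ j₁ i₂ j₂ i j} → P (i₁ , j₁) → P (i₂ , j₂) → i₁ ≤ i → i ≤ i₂ → j₁ ≤ j → j ≤ j₂ → P (i , j))
  where

  private
    Below : ℕ → ℕ → Set
    Below i j = ∃ λ i′ → i′ < suc M × (i ≤ i′ × P (i′ , j))

    below? : ∀ i j → Dec (Below i j)
    below? i j = anyUpTo? (λ i′ → (i ≤? i′) ×-dec P? (i′ , j)) (suc M)

    -- `f i` is the last column met by `P` in row `i` or below, and `g i` the last column up to
    -- `f i` missing from `P` in row `i`. Convexity makes all earlier columns of row `i` missing as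
    -- well.
    f g : ℕ → ℕ
    f i = maxUpTo (below? i) C
    g i = maxUpTo (λ j → ¬? (P? (i , j))) (f i)

    f-upper : ∀ {i i′ j} → i ≤ i′ → P (i′ , j) → j ≤ f i
    f-upper {i} i≤i′ p with P-bound p
    ... | (_ , i′≤M) , 1≤j , j≤C = maxUpTo-upper (below? i) C 1≤j j≤C (_ , s≤s i′≤M , i≤i′ , p)

    f-sat : ∀ {i j} → 1 ≤ j → j ≤ f i → ∃ λ i′ → ∃ λ j′ → i ≤ i′ × j ≤ j′ × P (i′ , j′)
    f-sat {i} 1≤j j≤f with maxUpTo-sat (below? i) C (≤-trans 1≤j j≤f)
    ... | i′ , _ , i≤i′ , p = i′ , f i , i≤i′ , j≤f , p

    f-antitone : Antitone f
    f-antitone {i} 1≤i with f (suc i) | f-sat {suc i} {f (suc i)}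
    ... | zero | _ = z≤n
    ... | suc m | sat with sat (s≤s z≤n) ≤-refl
    ...   | i′ , j′ , i<i′ , j≤j′ , p = ≤-trans j≤j′ (f-upper (<⇒≤ i<i′) p)

    f-beyond : ∀ {i} → M < i → f i ≡ 0
    f-beyond {i} M<i with f i | f-sat {i} {f i}
    ... | zero | _ = refl
    ... | suc m | sat with sat (s≤s z≤n) ≤-refl
    ...   | i′ , j′ , i≤i′ , _ , p = ⊥-elim (<⇒≱ (<-≤-trans M<i i≤i′) (proj₂ (proj₁ (P-bound p))))

    g≤f : ∀ i → g i ≤ f i
    g≤f i = maxUpTo-≤ (λ j → ¬? (P? (i , j))) (f i)

    g-sat : ∀ i → 1 ≤ g i → ¬ P (i , g i)
    g-sat i = maxUpTo-sat (λ j → ¬? (P? (i , j))) (f i)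

    g-upper : ∀ {i j} → 1 ≤ j → j ≤ f i → ¬ P (i , j) → j ≤ g i
    g-upper {i} = maxUpTo-upper (λ j → ¬? (P? (i , j))) (f i)

    g-antitone : Antitone g
    g-antitone {i} 1≤i with g (suc i) | g-sat (suc i) | g≤f (suc i)
    ... | zero | _ | _ = z≤n
    ... | suc m | sat | ≤f = g-upper (s≤s z≤n) (≤-trans ≤f (f-antitone 1≤i)) λ p →
      let i′ , j′ , i<i′ , j≤j′ , p′ = f-sat {suc i} (s≤s z≤n) ≤f
      in sat (s≤s z≤n) (P-convex p p′ (n≤1+n i) i<i′ ≤-refl j≤j′)

    g-beyond : ∀ {i} → M < i → g i ≡ 0
    g-beyond M<i = n≤0⇒n≡0 (≤-trans (g≤f _) (≤-reflexive (f-beyond M<i)))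

    row-f : ∀ {i} → 1 ≤ i → row (fromRows M f) i ≡ f i
    row-f = row-fromRows M f-antitone f-beyond

    row-g : ∀ {i} → 1 ≤ i → row (fromRows M g) i ≡ g i
    row-g = row-fromRows M g-antitone g-beyond

  -- P is α / β for α the order ideal generated by P and β = α ∖ P.
  convex⇒skew : IsSkewDiagram P
  convex⇒skew = mkPartition (fromRows M f) (fromRows-isPartition M f-antitone)
              , mkPartition (fromRows M g) (fromRows-isPartition M g-antitone)
              , sub , λ c → forth c , back c
    where
    sub : fromRows M g ⊆ₚ fromRows M f
    sub zero = ≤-refl
    sub (suc i) rewrite row-f {suc i} (s≤s z≤n) | row-g {suc i} (s≤s z≤n) = g≤f (suc i)
    forth : ∀ c → P c → InSkew (fromRows M f) (fromRows M g) c
    forth (i , j) p with P-bound p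
    ... | (1≤i , _) , 1≤j , _ rewrite row-f 1≤i | row-g 1≤i = ≰⇒> j≰g , f-upper ≤-refl p
      where
      j≰g : ¬ j ≤ g i
      j≰g j≤g = let i′ , j′ , i≤i′ , j≤j′ , p′ = f-sat {i} (≤-trans 1≤j j≤g) (g≤f i)
        in g-sat i (≤-trans 1≤j j≤g) (P-convex p p′ ≤-refl i≤i′ j≤g j≤j′)
    back : ∀ c → InSkew (fromRows M f) (fromRows M g) c → P c
    back (zero , j) (p , q) = ⊥-elim (<⇒≱ p q)
    back (suc i , j) (p , q) rewrite row-f {suc i} (s≤s z≤n) | row-g {suc i} (s≤s z≤n) =
      decidable-stable (P? _) λ ¬p → <⇒≱ p (g-upper (≤-trans (s≤s z≤n) p) q ¬p)

-- The depth profile of a lattice path with `N` steps from depth `M` up to depth 0: a horizontal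
-- step keeps the depth, a vertical one lowers it by one. Indices beyond `N` are allowed and have
-- depth 0.
record Steps (M N : ℕ) (d : ℕ → ℕ) : Set where
  field
    start : d 0 ≡ M
    end   : d N ≡ 0
    fall  : ∀ c → d (suc c) ≤ d c
    slow  : ∀ c → d c ≤ suc (d (suc c))

  mono : ∀ {c c′} → c ≤ c′ → d c′ ≤ d c
  mono {c} {c′} c≤c′ = go (c′ ∸ c) (m∸n+n≡m c≤c′)
    where
    go : ∀ m {c′} → m + c ≡ c′ → d c′ ≤ d c
    go zero refl = ≤-refl
    go (suc m) refl = ≤-trans (fall (m + c)) (go m refl)

  slow-+ : ∀ m c → d c ≤ m + d (m + c)
  slow-+ zero c = ≤-refl
  slow-+ (suc m) c = ≤-trans (slow-+ m c) (subst (m + d (m + c) ≤_) (+-suc m _) (+-monoʳ-≤ m (slow (m + c))))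

  d≤M : ∀ c → d c ≤ M
  d≤M c = subst (d c ≤_) start (mono z≤n)

  M≤c+d : ∀ c → M ≤ c + d c
  M≤c+d c = subst₂ _≤_ start (cong (λ x → c + d x) (+-identityʳ c)) (slow-+ c 0)

  beyond : ∀ {c} → N ≤ c → d c ≡ 0
  beyond N≤c = n≤0⇒n≡0 (≤-trans (mono N≤c) (≤-reflexive end))

  pos⇒<N : ∀ {c} → 1 ≤ d c → c < N
  pos⇒<N p = ≰⇒> λ N≤c → <⇒≢ p (sym (beyond N≤c))

  -- The remaining `N ∸ c` steps must bring the depth down to 0, one unit at most per step.
  c+d≤N : ∀ {c} → 1 ≤ d c → c + d c ≤ N
  c+d≤N {c} p = subst (c + d c ≤_) (m+[n∸m]≡n c≤N) (+-monoʳ-≤ c (subst (d c ≤_) eq (slow-+ (N ∸ c) c)))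
    where
    c≤N = <⇒≤ (pos⇒<N p)
    eq : N ∸ c + d (N ∸ c + c) ≡ N ∸ c
    eq = trans (cong (λ x → N ∸ c + d x) (m∸n+n≡m c≤N)) (trans (cong (λ m → N ∸ c + m) end) (+-identityʳ _))

  flat-or-down : ∀ k → d k ≡ d (suc k) ⊎ d k ≡ suc (d (suc k))
  flat-or-down k with m≤n⇒m<n∨m≡n (slow k)
  ... | inj₁ p = inj₁ (≤-antisym (≤-pred p) (fall k))
  ... | inj₂ p = inj₂ p

-- Partitions in a box as lattice paths

record InBox (M C : ℕ) (α : List ℕ) : Set where
  constructor inBox
  field
    partition : IsPartition α
    height : ∀ {i} → M < i → row α i ≡ 0
    width  : row α 1 ≤ C
  antitone : Antitone (row α)
  antitone = row-antitone partition

module Depth (M C : ℕ) where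
  N : ℕ
  N = M + C

  abstract

    -- The height below the x-axis of the point of the boundary path of α
    -- at which step c - M starts.
    depth : List ℕ → ℕ → ℕ
    depth α c = maxUpTo (λ i → c + i ≤? row α i + M) M

    ≤depth⇒≤M : ∀ {α} → InBox M C α → ∀ {i c} → i ≤ depth α c → i ≤ M
    ≤depth⇒≤M box p = ≤-trans p (maxUpTo-≤ _ M)

    -- The inequality says that the vertical step ending row `i`, of index `row α i - i`, does not
    -- come before step `c - M`. These indices decrease with `i`, so the rows concerned form an
    -- initial segment, and its length is the depth.
    ≤depth⇒ : ∀ {α} → InBox M C α → ∀ {i c} → 1 ≤ i → i ≤ depth α c → c + i ≤ row α i + M
    ≤depth⇒ {α} box {i} {c} 1≤i p = ≤-trans (+-monoʳ-≤ c p)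
      (≤-trans (maxUpTo-sat (λ i → c + i ≤? row α i + M) M (≤-trans 1≤i p))
          (+-monoˡ-≤ M (antitone-≤ {row α} (InBox.antitone box) 1≤i p)))

    ≤depth⇐ : ∀ {α} → InBox M C α → ∀ {i c} → 1 ≤ i → i ≤ M → c + i ≤ row α i + M → i ≤ depth α c
    ≤depth⇐ box = maxUpTo-upper _ M

  module _ {α : List ℕ} (box : InBox M C α) where
    open InBox box

    -- The equation `c + i ≡ M + j` says that square `(i , j)` has content `c - M`; in this form no
    -- subtraction can truncate.
    ≤depth⇒≤row : ∀ {i j c} → 1 ≤ i → c + i ≡ M + j → i ≤ depth α c → j ≤ row α i
    ≤depth⇒≤row {i} {j} 1≤i eq p = +-cancelˡ-≤ M _ _ (subst₂ _≤_ eq (+-comm _ M) (≤depth⇒ box 1≤i p))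

    ≤row⇒≤depth : ∀ {i j c} → 1 ≤ i → i ≤ M → c + i ≡ M + j → j ≤ row α i → i ≤ depth α c
    ≤row⇒≤depth {i} {j} 1≤i i≤M eq p = ≤depth⇐ box 1≤i i≤M
      (subst₂ _≤_ (sym eq) (+-comm M _) (+-monoʳ-≤ M p))

    depth-steps : Steps M N (depth α)
    depth-steps = record
      { start = ≤-ext (λ _ p → ≤depth⇒≤M box p) (λ 1≤i p → ≤depth⇐ box 1≤i p (≤-trans p (m≤n+m M _)))
      ; end = ≤-ext (λ {i} 1≤i p → ⊥-elim (<⇒≱ (wide 1≤i) (≤depth⇒ box 1≤i p))) (λ 1≤i p → ⊥-elim (<⇒≱ 1≤i p))
      ; fall = λ c → ≤-from λ 1≤i p → ≤depth⇐ box 1≤i (≤depth⇒≤M box p) (≤-trans (n≤1+n _) (≤depth⇒ box 1≤i p))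
      ; slow = λ c → ≤-from λ { {suc zero} _ _ → s≤s z≤n
                              ; {suc (suc i)} 1≤i p → s≤s (≤depth⇐ box (s≤s z≤n) (≤-trans (n≤1+n _) (≤depth⇒≤M box p))
                                  (subst (_≤ row α (suc i) + M) (+-suc c (suc i))
                                    (≤-trans (≤depth⇒ box 1≤i p) (+-monoˡ-≤ M (antitone (s≤s z≤n)))))) }
      }
      where
      ≤-from : ∀ {a b} → (∀ {i} → 1 ≤ i → i ≤ a → i ≤ b) → a ≤ b
      ≤-from {zero} f = z≤n
      ≤-from {suc a} f = f (s≤s z≤n) ≤-refl
      wide : ∀ {i} → 1 ≤ i → row α i + M < N + i
      wide {i} 1≤i = subst (row α i + M <_) (cong (_+ i) (+-comm C M))
        (subst (_≤ C + M + i) (+-comm _ 1) (+-mono-≤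
            (+-monoˡ-≤ M (≤-trans (antitone-≤ {row α} antitone ≤-refl 1≤i) width)) 1≤i))

  depth-injective : ∀ {α β} → InBox M C α → InBox M C β → (∀ c → depth α c ≡ depth β c) → α ≡ β
  depth-injective {α} {β} bα bβ eq = row-ext (InBox.partition bα) (InBox.partition bβ) rows
    where
    to : ∀ {α β i j} → InBox M C α → InBox M C β → (∀ c → depth α c ≡ depth β c) → 1 ≤ i → i ≤ M → j ≤ row α i →
        j ≤ row β i
    to {i = i} {j} bα bβ eq 1≤i i≤M p = ≤depth⇒≤row bβ 1≤i c-eq (subst (i ≤_) (eq _) (≤row⇒≤depth bα 1≤i i≤M c-eq p))
      where
      c-eq : (M ∸ i + j) + i ≡ M + j
      c-eq = trans (+-assoc (M ∸ i) j i) (trans (cong (λ m → M ∸ i + m) (+-comm j i))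
               (trans (sym (+-assoc (M ∸ i) i j)) (cong (_+ j) (m∸n+n≡m i≤M))))
    rows : ∀ {i} → 1 ≤ i → row α i ≡ row β i
    rows {i} 1≤i with i ≤? M
    ... | yes i≤M = ≤-antisym (to bα bβ eq 1≤i i≤M ≤-refl) (to bβ bα (sym ∘ eq) 1≤i i≤M ≤-refl)
    ... | no i≰M = trans (InBox.height bα (≰⇒> i≰M)) (sym (InBox.height bβ (≰⇒> i≰M)))

  depth-⊆ : ∀ {α β} → InBox M C α → InBox M C β → α ⊆ₚ β → ∀ c → depth α c ≤ depth β c
  depth-⊆ {α} {β} bα bβ sub c with depth α c | ≤depth⇒≤M bα {depth α c} {c} ≤-refl | ≤depth⇒ bα {depth α c} {c}
  ... | zero | _ | _ = z≤n
  ... | suc i | ≤M | p = ≤depth⇐ bβ (s≤s z≤n) ≤M (≤-trans (p (s≤s z≤n) ≤-refl) (+-monoˡ-≤ M (sub (suc i))))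

  depth-⊆⁻¹ : ∀ {α β} → InBox M C α → InBox M C β → (∀ c → depth α c ≤ depth β c) → α ⊆ₚ β
  depth-⊆⁻¹ bα bβ le zero = ≤-refl
  depth-⊆⁻¹ {α} {β} bα bβ le (suc i) with suc i ≤? M
  ... | no i≰M = ≤-trans (≤-reflexive (InBox.height bα (≰⇒> i≰M))) z≤n
  ... | yes i≤M = ≤depth⇒≤row bβ (s≤s z≤n) c-eq (≤-trans (≤row⇒≤depth bα (s≤s z≤n) i≤M c-eq ≤-refl) (le _))
    where
    c-eq : (M ∸ suc i + row α (suc i)) + suc i ≡ M + row α (suc i)
    c-eq = trans (cong (_+ suc i) (sym (+-∸-comm (row α (suc i)) i≤M))) (m∸n+n≡m (≤-trans i≤M (m≤m+n M _)))

  -- Inverse to `depth`: the square `(i , j)`, whose shifted content is `M ∸ i + j`, is taken when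
  -- the path is at depth at least `i` there.
  shape : (ℕ → ℕ) → List ℕ
  shape d = fromRows M (λ i → maxUpTo (λ j → i ≤? d (M ∸ i + j)) C)

  module _ {d : ℕ → ℕ} (st : Steps M N d) where
    open Steps st

    private
      f : ℕ → ℕ
      f i = maxUpTo (λ j → i ≤? d (M ∸ i + j)) C

      f-beyond : ∀ {i} → M < i → f i ≡ 0
      f-beyond {i} M<i with f i | maxUpTo-sat (λ j → i ≤? d (M ∸ i + j)) C
      ... | zero | _ = refl
      ... | suc _ | sat = ⊥-elim (<⇒≱ (≤-trans M<i (sat (s≤s z≤n))) (d≤M _))

      f-antitone : Antitone f
      f-antitone {i} 1≤i with f (suc i) | maxUpTo-sat (λ j → suc i ≤? d (M ∸ suc i + j)) C | maxUpTo-≤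
          (λ j → suc i ≤? d (M ∸ suc i + j)) C
      ... | zero | _ | _ = z≤n
      ... | suc j | sat | ≤C = maxUpTo-upper (λ j → i ≤? d (M ∸ i + j)) C (s≤s z≤n) ≤C
        (≤-pred (≤-trans (sat (s≤s z≤n)) (subst (λ x → d (M ∸ suc i + suc j) ≤ suc (d x)) eq
            (slow (M ∸ suc i + suc j)))))
        where
        eq : suc (M ∸ suc i + suc j) ≡ M ∸ i + suc j
        eq = cong (_+ suc j) (sym (+-∸-assoc 1 {M} {suc i} (≤-trans (sat (s≤s z≤n)) (d≤M _))))

      row-f : ∀ {i} → 1 ≤ i → row (fromRows M f) i ≡ f i
      row-f = row-fromRows M f-antitone f-beyond

    shape-inBox : InBox M C (shape d)
    shape-inBox = inBox (fromRows-isPartition M f-antitone)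
      (λ M<i → trans (row-f (≤-trans (s≤s z≤n) M<i)) (f-beyond M<i))
      (subst (_≤ C) (sym (row-f ≤-refl)) (maxUpTo-≤ _ C))

    -- If `c + i` exceeds `M`, there is a square of row `i` and shifted content `c`, and both sides
    -- test it. Otherwise there is none, and both sides are at least `i` outright, since a path from
    -- depth `M` falls by at most one per step.
    depth-shape : ∀ c → depth (shape d) c ≡ d c
    depth-shape c = ≤-ext to from
      where
      c-eq : ∀ {i j} → i ≤ M → c + i ≡ M + j → M ∸ i + j ≡ c
      c-eq {i} {j} i≤M eq = trans (sym (+-∸-comm j i≤M)) (trans (cong (_∸ i) (sym eq)) (m+n∸n≡m c i))
      from : ∀ {i} → 1 ≤ i → i ≤ d c → i ≤ depth (shape d) c
      from {i} 1≤i i≤d with ≤-total (c + i) M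
      ... | inj₁ c+i≤M = ≤depth⇐ shape-inBox 1≤i (≤-trans (m≤n+m i c) c+i≤M) (≤-trans c+i≤M (m≤n+m M _))
      ... | inj₂ M≤c+i with c + i ∸ M | m+[n∸m]≡n M≤c+i
      ...   | zero | eq = ≤row⇒≤depth shape-inBox 1≤i (≤-trans i≤d (d≤M c)) (sym eq) z≤n
      ...   | suc j | eq = ≤row⇒≤depth shape-inBox 1≤i i≤M (sym eq) (subst (suc j ≤_) (sym (row-f 1≤i))
                (maxUpTo-upper (λ j → i ≤? d (M ∸ i + j)) C (s≤s z≤n)
                  (+-cancelˡ-≤ M _ _ (subst (_≤ N) (sym eq) (≤-trans (+-monoʳ-≤ c i≤d) (c+d≤N (≤-trans 1≤i i≤d)))))
                  (subst (λ x → i ≤ d x) (sym (c-eq i≤M (sym eq))) i≤d)))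
        where i≤M = ≤-trans i≤d (d≤M c)
      to : ∀ {i} → 1 ≤ i → i ≤ depth (shape d) c → i ≤ d c
      to {i} 1≤i p with ≤-total (c + i) M
      ... | inj₁ c+i≤M = +-cancelˡ-≤ c _ _ (≤-trans c+i≤M (M≤c+d c))
      ... | inj₂ M≤c+i = ≤-trans (maxUpTo-sat′ j≤f)
          (mono (subst (_≤ M ∸ i + f i) (c-eq i≤M (sym eq)) (+-monoʳ-≤ (M ∸ i) j≤f)))
        where
        eq = m+[n∸m]≡n M≤c+i
        i≤M = ≤depth⇒≤M shape-inBox {i} {c} p
        j≤f : c + i ∸ M ≤ f i
        j≤f = subst (_ ≤_) (row-f 1≤i) (≤depth⇒≤row shape-inBox 1≤i (sym eq) p)
        maxUpTo-sat′ : c + i ∸ M ≤ f i → i ≤ d (M ∸ i + f i)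
        maxUpTo-sat′ _ with f i | maxUpTo-sat (λ j → i ≤? d (M ∸ i + j)) C
        ... | zero | _ = subst (λ x → i ≤ d x) (sym (+-identityʳ _))
            (+-cancelˡ-≤ (M ∸ i) _ _ (subst (_≤ M ∸ i + d (M ∸ i)) (sym (m∸n+n≡m i≤M)) (M≤c+d (M ∸ i))))
        ... | suc _ | sat = sat (s≤s z≤n)

-- Interval sets as matchings of step indices

sorted-↭⇒≡ : {A : Set} {_≺_ : A → A → Set} → (∀ {x y} → x ≺ y → ¬ y ≺ x) →
  ∀ {xs ys} → AllPairs _≺_ xs → AllPairs _≺_ ys → xs ↭ ys → xs ≡ ys
sorted-↭⇒≡ asym {[]} _ _ p = sym (↭-empty-inv (↭-sym p))
sorted-↭⇒≡ asym {_ ∷ _} {[]} _ _ p = ↭-empty-inv p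
sorted-↭⇒≡ asym {x ∷ xs} {y ∷ ys} (x≺ ∷ sx) (y≺ ∷ sy) p with ∈-resp-↭ p (here refl) | ∈-resp-↭ (↭-sym p) (here refl)
... | here refl | _ = cong (x ∷_) (sorted-↭⇒≡ asym sx sy (drop-∷ p))
... | there _ | here refl = cong (x ∷_) (sorted-↭⇒≡ asym sx sy (drop-∷ p))
... | there x∈ | there y∈ = ⊥-elim (asym (All.lookup x≺ y∈) (All.lookup y≺ x∈))

module Letters {M N : ℕ} {a b : ℕ → ℕ} (sa : Steps M N a) (sb : Steps M N b) where

  -- For a, b the depth functions of μ and λ: a step is horizontal iff the depth does not change.
  IsLeft IsRight : ℕ → Set
  IsLeft k = b k ≡ b (suc k) × a k ≡ suc (a (suc k))
  IsRight k = b k ≡ suc (b (suc k)) × a k ≡ a (suc k)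

  isLeft? : ∀ k → Dec (IsLeft k)
  isLeft? k = (b k ≟ b (suc k)) ×-dec (a k ≟ suc (a (suc k)))

  isRight? : ∀ k → Dec (IsRight k)
  isRight? k = (b k ≟ suc (b (suc k))) ×-dec (a k ≟ a (suc k))

  left⇒<N : ∀ {k} → IsLeft k → k < N
  left⇒<N (_ , q) = Steps.pos⇒<N sa (subst (1 ≤_) (sym q) (s≤s z≤n))

  right⇒<N : ∀ {k} → IsRight k → k < N
  right⇒<N (q , _) = Steps.pos⇒<N sb (subst (1 ≤_) (sym q) (s≤s z≤n))

  left⇒¬right : ∀ {k} → IsLeft k → ¬ IsRight k
  left⇒¬right (_ , p) (_ , q) = 1+n≢n (trans (sym p) q)

  data Letter (k : ℕ) : Set where
    hh    : b k ≡ b (suc k) → a k ≡ a (suc k) → Letter k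
    vv    : b k ≡ suc (b (suc k)) → a k ≡ suc (a (suc k)) → Letter k
    left  : IsLeft k → Letter k
    right : IsRight k → Letter k

  letter : ∀ k → Letter k
  letter k with Steps.flat-or-down sb k | Steps.flat-or-down sa k
  ... | inj₁ p | inj₁ q = hh p q
  ... | inj₁ p | inj₂ q = left (p , q)
  ... | inj₂ p | inj₁ q = right (p , q)
  ... | inj₂ p | inj₂ q = vv p q

  private
    lefts : ∃ λ n → Enum (λ k → k < N × IsLeft k) n
    lefts = enum-filter isLeft? N

  #left : ℕ
  #left = proj₁ lefts

  enum-left : Enum IsLeft #left
  enum-left = enum-⇔ proj₂ (λ l → left⇒<N l , l) (proj₂ lefts)

  -- An interval set together with an order of its pairs. Left and right ends are kept distinct
  -- separately, because no step is both an L and an R.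
  record Matching (ps : List (ℕ × ℕ)) : Set where
    constructor matching
    field
      good : All (λ p → proj₁ p < proj₂ p × IsLeft (proj₁ p) × IsRight (proj₂ p)) ps
      uniqueˡ : Unique (map proj₁ ps)
      uniqueʳ : Unique (map proj₂ ps)
      full : length ps ≡ #left

  Matching-↭ : ∀ {ps qs} → ps ↭ qs → Matching ps → Matching qs
  Matching-↭ p (matching g ul ur f) = matching (All-resp-↭ p g) (Unique-↭ (map⁺ proj₁ p) ul)
      (Unique-↭ (map⁺ proj₂ p) ur)
    (trans (sym (↭-length p)) f)

  -- The part of a sorted matching that lies at positions ≥ k, built from right to left.
  data Sorted : ℕ → List (ℕ × ℕ) → Set where
    done : ∀ {k} → k ≡ N → Sorted k []
    skip : ∀ {k ps} → ¬ IsLeft k → Sorted (suc k) ps → Sorted k ps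
    take : ∀ {k ps v} → IsLeft k → Sorted (suc k) ps → IsRight v → k < v → v ∉ map proj₂ ps → Sorted k ((k , v) ∷ ps)

  Sorted-lower : ∀ {k ps} → Sorted k ps → All (λ p → k ≤ proj₁ p) ps
  Sorted-lower (done _) = []
  Sorted-lower (skip _ s) = All.map <⇒≤ (Sorted-lower s)
  Sorted-lower (take _ s _ _ _) = ≤-refl ∷ All.map <⇒≤ (Sorted-lower s)

  Sorted-good : ∀ {k ps} → Sorted k ps → All (λ p → proj₁ p < proj₂ p × IsLeft (proj₁ p) × IsRight (proj₂ p)) ps
  Sorted-good (done _) = []
  Sorted-good (skip _ s) = Sorted-good s
  Sorted-good (take l s r k<v _) = (k<v , l , r) ∷ Sorted-good s

  Sorted-sorted : ∀ {k ps} → Sorted k ps → AllPairs (λ p q → proj₁ p < proj₁ q) ps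
  Sorted-sorted (done _) = []
  Sorted-sorted (skip _ s) = Sorted-sorted s
  Sorted-sorted (take _ s _ _ _) = Sorted-lower s ∷ Sorted-sorted s

  Sorted-uniqueˡ : ∀ {k ps} → Sorted k ps → Unique (map proj₁ ps)
  Sorted-uniqueˡ (done _) = []
  Sorted-uniqueˡ (skip _ s) = Sorted-uniqueˡ s
  Sorted-uniqueˡ (take _ s _ _ _) = ¬Any⇒All¬ _ (λ k∈ → let p , p∈ , eq = ∈-map⁻ proj₁ k∈ in
    <⇒≢ (All.lookup (Sorted-lower s) p∈) eq) ∷ Sorted-uniqueˡ s

  Sorted-uniqueʳ : ∀ {k ps} → Sorted k ps → Unique (map proj₂ ps)
  Sorted-uniqueʳ (done _) = []
  Sorted-uniqueʳ (skip _ s) = Sorted-uniqueʳ s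
  Sorted-uniqueʳ (take _ s _ _ v∉) = ¬Any⇒All¬ _ v∉ ∷ Sorted-uniqueʳ s

  Sorted-lefts : ∀ {k ps} → Sorted k ps → Enum (λ u → IsLeft u × k ≤ u) (length ps)
  Sorted-lefts (done refl) = enum-∅ (λ (l , p) → <⇒≱ (left⇒<N l) p)
  Sorted-lefts (skip ¬l s) = enum-⇔ (λ (l , p) → l , <⇒≤ p)
    (λ (l , p) → l , ≤∧≢⇒< p (λ { refl → ¬l l })) (Sorted-lefts s)
  Sorted-lefts (take l s _ _ _) = enum-⇔ (λ { (inj₁ refl) → l , ≤-refl ; (inj₂ (l′ , p)) → l′ , <⇒≤ p })
    (λ (l′ , p) → case m≤n⇒m<n∨m≡n p of λ { (inj₁ q) → inj₂ (l′ , q) ; (inj₂ refl) → inj₁ refl })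
    (enum-insert (λ (_ , p) → 1+n≰n p) (Sorted-lefts s))

  Sorted⇒Matching : ∀ {ps} → Sorted 0 ps → Matching ps
  Sorted⇒Matching s = matching (Sorted-good s) (Sorted-uniqueˡ s) (Sorted-uniqueʳ s)
    (enum-size-unique proj₁ (λ l → l , z≤n) (Sorted-lefts s) enum-left)

  -- The left ends are distinct and as many as the L's, so by pigeonhole every L occurs among them;
  -- the scan over step indices then finds a pair at each L it meets.
  Matching-sort : ∀ {qs} → Matching qs → ∃ λ ps → Sorted 0 ps × qs ↭ ps
  Matching-sort {qs} (matching g ul ur f) = go N 0 (+-identityʳ N) g (All.map (λ _ → z≤n) g) ul ur λ l _ →
      sound enum-us (enum-pigeonhole _≟_ (λ { u∈ → let p , p∈ , eq = ∈-map⁻ proj₁ u∈ in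
          subst IsLeft (sym eq) (proj₁ (proj₂ (All.lookup g p∈))) })
        enum-us enum-left (≤-reflexive (trans (sym f) (sym (length-map proj₁ qs)))) l)
    where
    enum-us : Enum (_∈ map proj₁ qs) (length (map proj₁ qs))
    enum-us = enum-∈ (map proj₁ qs) ul
    go : ∀ m k → m + k ≡ N → ∀ {qs} → All (λ p → proj₁ p < proj₂ p × IsLeft (proj₁ p) × IsRight (proj₂ p)) qs →
      All (λ p → k ≤ proj₁ p) qs → Unique (map proj₁ qs) → Unique (map proj₂ qs) →
      (∀ {u} → IsLeft u → k ≤ u → u ∈ map proj₁ qs) → ∃ λ ps → Sorted k ps × qs ↭ ps
    go zero k refl {[]} _ _ _ _ _ = [] , done refl , ↭-refl
    go zero k refl {q ∷ qs} ((_ , l , _) ∷ _) (p ∷ _) _ _ _ = ⊥-elim (<⇒≱ (left⇒<N l) p)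
    go (suc m) k eq {qs} g lo ul ur co with isLeft? k
    ... | no ¬l with go m (suc k) (trans (+-suc m k) eq) g
            (All.zipWith (λ ((_ , l , _) , p) → ≤∧≢⇒< p (λ { refl → ¬l l })) (g , lo)) ul ur (λ l p → co l (<⇒≤ p))
    ...   | ps , s , perm = ps , skip ¬l s , perm
    go (suc m) k eq {qs} g lo ul ur co | yes l with ∈-map⁻ proj₁ (co l ≤-refl)
    ... | (.k , v) , p∈ , refl with ∈⇒↭∷ p∈
    ...   | rest , perm with All-resp-↭ perm g | Unique-↭ (map⁺ proj₁ perm) ul | Unique-↭ (map⁺ proj₂ perm) ur
        | All-resp-↭ perm lo
    ...   | (k<v , _ , r) ∷ g′ | k∉ ∷ ul′ | v∉ ∷ ur′ | _ ∷ lo′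
          with go m (suc k) (trans (+-suc m k) eq) g′ (strict k∉ lo′) ul′ ur′ co′
      where
      strict : ∀ {rest} → All (k ≢_) (map proj₁ rest) → All (λ p → k ≤ proj₁ p) rest → All
          (λ p → suc k ≤ proj₁ p) rest
      strict {[]} _ _ = []
      strict {_ ∷ _} (n ∷ ns) (p ∷ ps) = ≤∧≢⇒< p n ∷ strict ns ps
      co′ : ∀ {u} → IsLeft u → suc k ≤ u → u ∈ map proj₁ rest
      co′ l p with ∈-resp-↭ (map⁺ proj₁ perm) (co l (<⇒≤ p))
      ... | here refl = ⊥-elim (1+n≰n p)
      ... | there q = q
    ...     | ps , s , perm′ = (k , v) ∷ ps , take l s r k<v
        (λ v∈ → All¬⇒¬Any v∉ (∈-resp-↭ (map⁺ proj₂ (↭-sym perm′)) v∈))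
                             , ↭-trans perm (prep (k , v) perm′)

  module Counting (a≤b : ∀ c → a c ≤ b c) where

    -- The number of squares of content `c`: they occupy the rows from `a c + 1` to `b c`.
    gap : ℕ → ℕ
    gap c = b c ∸ a c

    gap-left : ∀ {k} → IsLeft k → gap (suc k) ≡ suc (gap k)
    gap-left {k} (p , q) = begin
      b (suc k) ∸ a (suc k)             ≡⟨ +-∸-assoc 1 (subst₂ _≤_ q p (a≤b k)) ⟩
      suc (b (suc k) ∸ suc (a (suc k))) ≡⟨ cong suc (cong₂ _∸_ (sym p) (sym q)) ⟩
      suc (gap k)                       ∎
      where
      open ≡-Reasoning

    gap-right : ∀ {k} → IsRight k → gap k ≡ suc (gap (suc k))
    gap-right {k} (p , q) = trans (cong₂ _∸_ p q) (+-∸-assoc 1 (a≤b (suc k)))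

    gap-neither : ∀ {k} → ¬ IsLeft k → ¬ IsRight k → gap k ≡ gap (suc k)
    gap-neither {k} ¬l ¬r with letter k
    ... | hh p q = cong₂ _∸_ p q
    ... | vv p q = cong₂ _∸_ p q
    ... | left l = ⊥-elim (¬l l)
    ... | right r = ⊥-elim (¬r r)

    gap-N : gap N ≡ 0
    gap-N = trans (cong (_∸ a N) (Steps.end sb)) (0∸n≡0 (a N))

    gap-0 : gap 0 ≡ 0
    gap-0 = trans (cong₂ _∸_ (Steps.start sb) (Steps.start sa)) (n∸n≡0 M)

    -- Moving one place to the left over an R frees one more partner and raises `gap` by one; moving
    -- over an L uses one up and lowers `gap` by one. Both counts are 0 at `N`.
    enum-available : ∀ {k ps} → Sorted k ps → Enum (λ v → IsRight v × k ≤ v × v ∉ map proj₂ ps) (gap k)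
    enum-available (done refl) = subst (Enum _) (sym gap-N) (enum-∅ (λ (r , p , _) → <⇒≱ (right⇒<N r) p))
    enum-available {k} {ps} (skip ¬l s) with isRight? k
    ... | yes r = subst (Enum _) (sym (gap-right r)) (enum-⇔
      (λ { (inj₁ refl) → r , ≤-refl , k∉ ; (inj₂ (r′ , p , q)) → r′ , <⇒≤ p , q })
      (λ (r′ , p , q) → case m≤n⇒m<n∨m≡n p of λ { (inj₁ p′) → inj₂ (r′ , p′ , q) ; (inj₂ refl) → inj₁ refl })
      (enum-insert (λ (_ , p , _) → 1+n≰n p) (enum-available s)))
      where
      -- A used right end lies beyond its left end, which is itself beyond `k`.
      k∉ : k ∉ map proj₂ ps
      k∉ k∈ with ∈-map⁻ proj₂ k∈
      ... | p , p∈ , refl = <⇒≱ (<-trans (All.lookup (Sorted-lower s) p∈)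
          (proj₁ (All.lookup (Sorted-good s) p∈))) ≤-refl
    ... | no ¬r = subst (Enum _) (sym (gap-neither ¬l ¬r)) (enum-⇔
      (λ (r , p , q) → r , <⇒≤ p , q)
      (λ (r , p , q) → r , ≤∧≢⇒< p (λ { refl → ¬r r }) , q) (enum-available s))
    enum-available {k} (take l s r k<v v∉) = enum-⇔
      (λ ((r′ , p , q) , ≢) → r′ , <⇒≤ p , λ { (here e) → ≢ e ; (there e) → q e })
      (λ (r′ , p , q) → (r′ , ≤∧≢⇒< p (λ { refl → left⇒¬right l r′ }) , q ∘ there) , q ∘ here)
      (enum-remove (r , k<v , v∉) (subst (Enum _) (gap-left l) (enum-available s)))

    leftWeight rightWeight : ℕ → ℕ
    leftWeight k with isLeft? k
    ... | yes _ = gap (suc k)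
    ... | no _ = 1
    rightWeight k with isRight? k
    ... | yes _ = gap k
    ... | no _ = 1

    ∏ : (ℕ → ℕ) → ℕ → ℕ → ℕ
    ∏ w zero k = 1
    ∏ w (suc m) k = ∏ w m (suc k) * w k

    enum-Sorted : ∀ m k → m + k ≡ N → Enum (Sorted k) (∏ leftWeight m k)
    enum-Sorted zero k refl = enum-⇔ (λ { refl → done refl })
      (λ { (done _) → refl ; (skip _ s) → ⊥-elim (late s ≤-refl) ; (take l _ _ _ _) → ⊥-elim
          (<-irrefl refl (left⇒<N l)) })
      (enum-single [])
      where
      late : ∀ {k ps} → Sorted k ps → ¬ N < k
      late (done refl) p = <-irrefl refl p
      late (skip _ s) p = late s (m<n⇒m<1+n p)
      late (take l _ _ _ _) p = <-asym p (left⇒<N l)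
    enum-Sorted (suc m) k eq with isLeft? k
    ... | yes l = enum-⇔
      (λ { ((ps , v) , (s , r , p , q) , refl) → take l s r p q })
      (λ { (done refl) → ⊥-elim (<-irrefl refl (left⇒<N l)) ; (skip ¬l _) → ⊥-elim (¬l l)
         ; (take {ps = ps} {v = v} _ s r p q) → (ps , v) , (s , r , p , q) , refl })
      (enum-map (λ (ps , v) → (k , v) ∷ ps) (λ { _ _ refl → refl })
        (enum-Σ {R = λ ps v → IsRight v × k < v × v ∉ map proj₂ ps}
            (enum-Sorted m (suc k) (trans (+-suc m k) eq)) enum-available))
    ... | no ¬l = subst (Enum _) (sym (*-identityʳ _)) (enum-⇔ (skip ¬l)
      (λ { (done refl) → ⊥-elim (1+n≰n {k} (m+n≤o⇒n≤o m (≤-reflexive (trans (+-suc m k) eq))))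
         ; (skip _ s) → s ; (take l _ _ _ _) → ⊥-elim (¬l l) })
      (enum-Sorted m (suc k) (trans (+-suc m k) eq)))

    -- Each descent of the gap from h to h - 1 is matched by an ascent from h - 1 to h,
    -- except for those from the initial value down to 0.
    ∏-right : ∀ m k → m + k ≡ N → ∏ rightWeight m k ≡ ∏ leftWeight m k * gap k !
    ∏-right zero k refl rewrite gap-N = refl
    ∏-right (suc m) k eq with ∏-right m (suc k) (trans (+-suc m k) eq) | isLeft? k | isRight? k
    ... | ih | yes l | yes r = ⊥-elim (left⇒¬right l r)
    ... | ih | yes l | no _ rewrite gap-left l = begin
      ∏ rightWeight m (suc k) * 1                                ≡⟨ *-identityʳ _ ⟩
      ∏ rightWeight m (suc k)                                    ≡⟨ ih ⟩
      ∏ leftWeight m (suc k) * (suc (gap k) * gap k !)           ≡⟨ *-assoc (∏ leftWeight m (suc k)) _ _ ⟨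
      ∏ leftWeight m (suc k) * suc (gap k) * gap k !             ∎
      where open ≡-Reasoning
    ... | ih | no _ | yes r rewrite gap-right r = begin
      ∏ rightWeight m (suc k) * suc (gap (suc k))                      ≡⟨ cong (_* suc (gap (suc k))) ih ⟩
      ∏ leftWeight m (suc k) * gap (suc k) ! * suc (gap (suc k))       ≡⟨ *-assoc (∏ leftWeight m (suc k)) _ _ ⟩
      ∏ leftWeight m (suc k) * (gap (suc k) ! * suc (gap (suc k)))     ≡⟨ cong (∏ leftWeight m (suc k) *_)
          (*-comm (gap (suc k) !) _) ⟩
      ∏ leftWeight m (suc k) * (suc (gap (suc k)) * gap (suc k) !)     ≡⟨ cong
          (_* (suc (gap (suc k)) * gap (suc k) !)) (*-identityʳ (∏ leftWeight m (suc k))) ⟨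
      ∏ leftWeight m (suc k) * 1 * (suc (gap (suc k)) * gap (suc k) !) ∎
      where open ≡-Reasoning
    ... | ih | no ¬l | no ¬r rewrite gap-neither ¬l ¬r = trans (*-identityʳ _)
        (trans ih (cong (_* gap (suc k) !) (sym (*-identityʳ (∏ leftWeight m (suc k))))))

    #sorted : ℕ
    #sorted = ∏ leftWeight N 0

    ∏-right≡#sorted : ∏ rightWeight N 0 ≡ #sorted
    ∏-right≡#sorted = trans (∏-right N 0 (+-identityʳ N)) (trans (cong (λ g → #sorted * g !) gap-0) (*-identityʳ _))

    ∏-* : ∀ f g m k → ∏ (λ k → f k * g k) m k ≡ ∏ f m k * ∏ g m k
    ∏-* f g zero k = refl
    ∏-* f g (suc m) k = trans (cong (_* (f k * g k)) (∏-* f g m (suc k)))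
        ([m*n]*[o*p]≡[m*o]*[n*p] (∏ f m (suc k)) _ _ _)

    -- A matching is a sorted one followed by a permutation of its pairs; the sorted list can be
    -- read off from any reordering, so nothing is counted twice.
    enum-matching-orders : Enum Matching (#left ! * #sorted)
    enum-matching-orders = subst (Enum Matching) (*-comm #sorted _) (enum-⇔
      (λ { (_ , (s , p) , refl) → Matching-↭ (↭-sym p) (Sorted⇒Matching s) })
      (λ mt → let ps , s , p = Matching-sort mt in (ps , _) , (s , p) , refl)
      base)
      where
      inj : ∀ {x y : List (ℕ × ℕ) × List (ℕ × ℕ)} → Sorted 0 (proj₁ x) × proj₂ x ↭ proj₁ x → Sorted 0
          (proj₁ y) × proj₂ y ↭ proj₁ y →
        proj₂ x ≡ proj₂ y → x ≡ y
      inj (s , p) (s′ , p′) refl = cong₂ _,_ (sorted-↭⇒≡ <-asym (Sorted-sorted s) (Sorted-sorted s′)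
          (↭-trans (↭-sym p) p′)) refl
      base : Enum (λ qs → ∃ λ x → (Sorted 0 (proj₁ x) × proj₂ x ↭ proj₁ x) × qs ≡ proj₂ x) (#sorted * #left !)
      base = enum-map proj₂ inj (enum-Σ {R = λ ps qs → qs ↭ ps} (enum-Sorted N 0 (+-identityʳ N))
        λ {ps} s → enum-permutations _ ps (Matching.full (Sorted⇒Matching s))
            (AllPairs.map (λ { p refl → <-irrefl refl p }) (Sorted-sorted s)))

-- Squares and ribbons

Path-trans : ∀ {P x y z} → Path P x y → Path P y z → Path P x z
Path-trans here q = q
Path-trans (step a p r) q = step a p (Path-trans r q)

module Cells (M : ℕ) where

  -- Contents are shifted by M, so that they are natural numbers on the first M rows.
  content : Cell → ℕ
  content (i , j) = M ∸ i + j

  cell : ℕ → ℕ → Cell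
  cell c i = i , c + i ∸ M

  content-spec : ∀ {i j} → i ≤ M → content (i , j) + i ≡ M + j
  content-spec {i} {j} i≤M = trans (+-assoc (M ∸ i) j i) (trans (cong (λ m → M ∸ i + m) (+-comm j i))
    (trans (sym (+-assoc (M ∸ i) i j)) (cong (_+ j) (m∸n+n≡m i≤M))))

  cell-spec : ∀ {c i} → M ≤ c + i → c + i ≡ M + proj₂ (cell c i)
  cell-spec p = sym (m+[n∸m]≡n p)

  cell-content : ∀ {i j} → i ≤ M → cell (content (i , j)) i ≡ (i , j)
  cell-content {i} {j} i≤M = cong (i ,_) (trans (cong (_∸ M) (content-spec i≤M)) (m+n∸m≡n M j))

  content-unique : ∀ {c i j} → i ≤ M → c + i ≡ M + j → content (i , j) ≡ c
  content-unique {c} {i} i≤M eq = +-cancelʳ-≡ i _ c (trans (content-spec i≤M) (sym eq))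

  content-cell : ∀ {c i} → i ≤ M → M ≤ c + i → content (cell c i) ≡ c
  content-cell {c} {i} i≤M p = content-unique i≤M (cell-spec {c} {i} p)

  adj-left : ∀ {c i} → M ≤ c + i → Adj (cell (suc c) i) (cell c i)
  adj-left p = inj₂ (inj₂ (inj₂ (refl , sym (+-∸-assoc 1 p))))

  adj-right : ∀ {c i} → M ≤ c + i → Adj (cell c i) (cell (suc c) i)
  adj-right p = inj₂ (inj₂ (inj₁ (refl , +-∸-assoc 1 p)))

  adj-down : ∀ c i → Adj (cell (suc c) i) (cell c (suc i))
  adj-down c i = inj₁ (refl , cong (_∸ M) (+-suc c i))

  adj-up : ∀ c i → Adj (cell c (suc i)) (cell (suc c) i)
  adj-up c i = inj₂ (inj₁ (refl , cong (_∸ M) (sym (+-suc c i))))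

  adj-content : ∀ {x y} → proj₁ x ≤ M → proj₁ y ≤ M → Adj x y →
    (content y ≡ suc (content x) × (proj₁ x ≡ proj₁ y ⊎ proj₁ x ≡ suc (proj₁ y))) ⊎ suc (content y) ≡ content x
  adj-content {i , j} p q (inj₁ (refl , refl)) = inj₂ (cong (_+ j) (sym (+-∸-assoc 1 q)))
  adj-content {i , j} p q (inj₂ (inj₁ (refl , refl))) = inj₁ (cong (_+ j) (+-∸-assoc 1 p) , inj₂ refl)
  adj-content {i , j} p q (inj₂ (inj₂ (inj₁ (refl , refl)))) = inj₁ (+-suc (M ∸ i) j , inj₁ refl)
  adj-content {i , _} p q (inj₂ (inj₂ (inj₂ (refl , refl)))) = inj₂ (sym (+-suc (M ∸ i) _))

  -- A discrete intermediate value argument: one step of a path changes the content by exactly one,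
  -- so some step leads from content `c` to `c + 1`.
  crossing : ∀ {P} → (∀ {x} → P x → proj₁ x ≤ M) → ∀ {x y c} → Path P x y → P x → content x ≤ c → c < content y →
    ∃ λ z → ∃ λ w → P z × P w × content z ≡ c × content w ≡ suc c × (proj₁ z ≡ proj₁ w ⊎ proj₁ z ≡ suc (proj₁ w))
  crossing bd here px x≤c c<x = ⊥-elim (<⇒≱ c<x x≤c)
  crossing bd {x} {y} {c} (step {c' = x′} adj px′ path) px x≤c c<y with content x′ ≤? c
  ... | yes x′≤c = crossing bd path px′ x′≤c c<y
  ... | no x′≰c with adj-content {x} {x′} (bd px) (bd px′) adj
  ...   | inj₂ eq = ⊥-elim (x′≰c (≤-trans (n≤1+n _) (≤-trans (≤-reflexive eq) x≤c)))
  ...   | inj₁ (eq , rows) = x , x′ , px , px′ , eq′ , trans eq (cong suc eq′) , rows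
    where
    eq′ : content x ≡ c
    eq′ = ≤-antisym x≤c (≤-pred (≤-trans (≰⇒> x′≰c) (≤-reflexive eq)))

  module _ {P : Cell → Set} (no2 : No2×2 P) (skew : IsSkewDiagram P) where

    private
      ¬below : ∀ {c i j i′ j′} → P (i , j) → P (i′ , j′) → c + i ≡ M + j → c + i′ ≡ M + j′ → ¬ i < i′
      ¬below {c} {i} {j} {i′} {j′} p p′ eq eq′ i<i′ = no2 i j
        (p , at (n≤1+n i) i<i′ ≤-refl (<⇒≤ j<j′) , at ≤-refl (<⇒≤ i<i′) (n≤1+n j) j<j′ , at (n≤1+n i) i<i′
            (n≤1+n j) j<j′)
        where
        j<j′ : j < j′
        j<j′ = +-cancelˡ-< M _ _ (subst₂ _<_ eq eq′ (+-monoʳ-< c i<i′))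
        at : ∀ {k l} → i ≤ k → k ≤ i′ → j ≤ l → l ≤ j′ → P (k , l)
        at r s t u = let α , β , _ , P⇔ = skew in
          proj₂ (P⇔ _) (InSkew-convex (isPart α) (isPart β) (proj₁ (P⇔ _) p) (proj₁ (P⇔ _) p′) r s t u)

    -- Of two different squares on a diagonal, one is strictly below and to the right of the other,
    -- and convexity of a skew diagram would put the whole 2×2 block at the upper one into `P`.
    same-diagonal : ∀ {c i j i′ j′} → P (i , j) → P (i′ , j′) → c + i ≡ M + j → c + i′ ≡ M + j′ → i ≡ i′
    same-diagonal p p′ eq eq′ = ≤-antisym (≮⇒≥ (¬below p′ p eq′ eq)) (≮⇒≥ (¬below p p′ eq eq′))

  -- A set of cells with at most one cell per content, given by Q in (content , row)
  -- coordinates, in which every cell except the one of content c₀ has its left or lower neighbour.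
  module Ribbon {P : Cell → Set} {Q : ℕ → ℕ → Set}
    (Q-bound : ∀ {c i} → Q c i → (1 ≤ i × i ≤ M) × M < c + i)
    (P⇒Q : ∀ {i j} → P (i , j) → Q (content (i , j)) i)
    (Q⇒P : ∀ {c i} → Q c i → P (cell c i))
    (Q-unique : ∀ {c i i′} → Q c i → Q c i′ → i ≡ i′)
    (c₀ : ℕ) (Q-start : ∀ {c i} → Q c i → c₀ ≤ c)
    (Q-back : ∀ {c i} → Q (suc c) i → c₀ ≤ c → Q c i ⊎ Q c (suc i))
    where

    private
      Q-at : ∀ {i j} → P (i , j) → Q (content (i , j)) i × content (i , j) + i ≡ M + j
      Q-at p = P⇒Q p , content-spec (proj₂ (proj₁ (Q-bound (P⇒Q p))))

      M≤ : ∀ {c i} → Q c i → M ≤ c + i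
      M≤ q = <⇒≤ (proj₂ (Q-bound q))

      toStart : ∀ m {i} → Q (m + c₀) i → ∃ λ i₀ → Q c₀ i₀ ×
        Path P (cell (m + c₀) i) (cell c₀ i₀) × Path P (cell c₀ i₀) (cell (m + c₀) i)
      toStart zero q = _ , q , here , here
      toStart (suc m) {i} q with Q-back q (m≤n+m c₀ m)
      ... | inj₁ q′ = let i₀ , q₀ , forth , back = toStart m q′ in
        i₀ , q₀ , step (adj-left (M≤ q′)) (Q⇒P q′) forth , Path-trans back (step (adj-right (M≤ q′)) (Q⇒P q) here)
      ... | inj₂ q′ = let i₀ , q₀ , forth , back = toStart m q′ in
        i₀ , q₀ , step (adj-down (m + c₀) i) (Q⇒P q′) forth , Path-trans back (step (adj-up (m + c₀) i) (Q⇒P q) here)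

      fromCell : ∀ {x} → P x → ∃ λ i₀ → Q c₀ i₀ × Path P x (cell c₀ i₀) × Path P (cell c₀ i₀) x
      fromCell {i , j} p = subst (λ x → ∃ λ i₀ → Q c₀ i₀ × Path P x (cell c₀ i₀) × Path P (cell c₀ i₀) x)
        (trans (cong (λ c → cell c i) eq) (cell-content (proj₂ (proj₁ (Q-bound (P⇒Q p))))))
        (toStart (content (i , j) ∸ c₀) (subst (λ c → Q c i) (sym eq) (P⇒Q p)))
        where
        eq : content (i , j) ∸ c₀ + c₀ ≡ content (i , j)
        eq = m∸n+n≡m (Q-start (P⇒Q p))

    connected : EdgeConnected P
    connected x y px py with fromCell px | fromCell py
    ... | i₀ , q₀ , forth , _ | i₁ , q₁ , _ , back with Q-unique q₀ q₁
    ...   | refl = Path-trans forth back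

    no2×2 : No2×2 P
    no2×2 i j (p , _ , _ , p′) with Q-at p | Q-at p′
    ... | q , eq | q′ , eq′ = 1+n≢n (sym (Q-unique q (subst (λ c → Q c (suc i)) c-eq q′)))
      where
      c-eq : content (suc i , suc j) ≡ content (i , j)
      c-eq = +-cancelʳ-≡ (suc i) _ _ (trans eq′ (trans (+-suc M j) (trans (cong suc (sym eq)) (sym (+-suc _ i)))))

    private
      -- Since `c + i` is the column shifted by `M`, the two inequalities say that towards smaller
      -- contents rows do not decrease and columns do not increase.
      walk : ∀ m {c i} → Q (m + c) i → c₀ ≤ c → ∃ λ i′ → Q c i′ × i ≤ i′ × c + i′ ≤ m + c + i
      walk zero q _ = _ , q , ≤-refl , ≤-refl
      walk (suc m) {c} {i} q c₀≤c with Q-back q (≤-trans c₀≤c (m≤n+m c m))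
      ... | inj₁ q′ = let i′ , q″ , le , le′ = walk m q′ c₀≤c in i′ , q″ , le , ≤-trans le′ (n≤1+n _)
      ... | inj₂ q′ = let i′ , q″ , le , le′ = walk m q′ c₀≤c in
        i′ , q″ , ≤-trans (n≤1+n i) le , ≤-trans le′ (≤-reflexive (+-suc (m + c) i))

      walk′ : ∀ {c c′ i} → Q c′ i → c₀ ≤ c → c ≤ c′ → ∃ λ i′ → Q c i′ × i ≤ i′ × c + i′ ≤ c′ + i
      walk′ {c} {c′} {i} q c₀≤c c≤c′ with walk (c′ ∸ c) {c} {i} (subst (λ x → Q x i) (sym (m∸n+n≡m c≤c′)) q) c₀≤c
      ... | i′ , q′ , le , le′ = i′ , q′ , le , subst (λ x → c + i′ ≤ x + i) (m∸n+n≡m c≤c′) le′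

      between : ∀ {c c′ c″ i i″} → Q c i → Q c″ i″ → c ≤ c′ → c′ ≤ c″ →
        ∃ λ i′ → Q c′ i′ × i″ ≤ i′ × i′ ≤ i × c + i ≤ c′ + i′ × c′ + i′ ≤ c″ + i″
      between q q″ c≤c′ c′≤c″ with walk′ q″ (≤-trans (Q-start q) c≤c′) c′≤c″
      ... | i′ , q′ , le₁ , le₂ with walk′ q′ (Q-start q) c≤c′
      ...   | i₁ , q₁ , le₃ , le₄ with Q-unique q q₁
      ...     | refl = i′ , q′ , le₁ , le₃ , le₄ , le₂

    convex : ∀ {i₁ j₁ i₂ j₂ i j} → P (i₁ , j₁) → P (i₂ , j₂) → i₁ ≤ i → i ≤ i₂ → j₁ ≤ j → j ≤ j₂ → P (i , j)
    convex {i₁} {j₁} {i₂} {j₂} {i} {j} p₁ p₂ i₁≤i i≤i₂ j₁≤j j≤j₂ with Q-at p₁ | Q-at p₂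
    ... | q₁ , e₁ | q₂ , e₂ = subst P (cell-content i≤M) (Q⇒P q)
      where
      c₁ = content (i₁ , j₁)
      c₂ = content (i₂ , j₂)
      c = content (i , j)
      i≤M = ≤-trans i≤i₂ (proj₂ (proj₁ (Q-bound q₂)))
      e : c + i ≡ M + j
      e = content-spec i≤M
      c₁+i₁≤c+i : c₁ + i₁ ≤ c + i
      c₁+i₁≤c+i = subst₂ _≤_ (sym e₁) (sym e) (+-monoʳ-≤ M j₁≤j)
      c+i≤c₂+i₂ : c + i ≤ c₂ + i₂
      c+i≤c₂+i₂ = subst₂ _≤_ (sym e) (sym e₂) (+-monoʳ-≤ M j≤j₂)
      -- Rows fall and columns grow along the ribbon, so two comparable cells share a row or a column.
      q : Q c i
      q with ≤-total c₁ c₂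
      ... | inj₁ c₁≤c₂ with between q₁ q₂ ≤-refl c₁≤c₂
      ...   | i′ , q′ , i₂≤i′ , i′≤i₁ , _ with ≤-antisym i₁≤i (≤-trans i≤i₂ (≤-trans i₂≤i′ i′≤i₁)) | ≤-antisym i≤i₂
          (≤-trans i₂≤i′ (≤-trans i′≤i₁ i₁≤i))
      ...     | refl | refl with between q₁ q₂ (+-cancelʳ-≤ i c₁ c c₁+i₁≤c+i) (+-cancelʳ-≤ i c c₂ c+i≤c₂+i₂)
      ...       | i″ , q″ , le , ge , _ with ≤-antisym le ge
      ...         | refl = q″
      q | inj₂ c₂≤c₁ with between q₂ q₁ ≤-refl c₂≤c₁
      ...   | i′ , q′ , _ , _ , le₁ , le₂ = subst (Q c) (+-cancelˡ-≡ c _ _ (≤-antisym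
                (≤-trans le₄ c₁+i₁≤c+i) (≤-trans c+i≤c₂+i₂ le₃))) q″
        where
        c≤c₁ : c ≤ c₁
        c≤c₁ = +-cancelʳ-≤ i₁ c c₁ (≤-trans (+-monoʳ-≤ c i₁≤i) (≤-trans c+i≤c₂+i₂ (≤-trans le₁ le₂)))
        c₂≤c : c₂ ≤ c
        c₂≤c = +-cancelʳ-≤ i₂ c₂ c (≤-trans le₁ (≤-trans le₂ (≤-trans c₁+i₁≤c+i (+-monoʳ-≤ c i≤i₂))))
        mid = between q₂ q₁ c₂≤c c≤c₁
        i″ = proj₁ mid
        q″ : Q c i″
        q″ = proj₁ (proj₂ mid)
        le₃ : c₂ + i₂ ≤ c + i″
        le₃ = proj₁ (proj₂ (proj₂ (proj₂ (proj₂ mid))))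
        le₄ : c + i″ ≤ c₁ + i₁
        le₄ = proj₂ (proj₂ (proj₂ (proj₂ (proj₂ mid))))

-- The skew diagram α / β in (content , row) coordinates.
module SkewCells (M C : ℕ) {α β : List ℕ} (bα : InBox M C α) (bβ : InBox M C β) where
  open Depth M C
  open Cells M

  S : ℕ → ℕ → Set
  S c i = depth β c < i × i ≤ depth α c

  S-bound : ∀ {c i} → S c i → (1 ≤ i × i ≤ M) × M < c + i
  S-bound {c} {i} (p , q) = (≤-trans (s≤s z≤n) p , ≤depth⇒≤M bα q) ,
    ≤-<-trans (Steps.M≤c+d (depth-steps bβ) c) (+-monoʳ-< c p)

  InSkew-row≤M : ∀ {i j} → InSkew α β (i , j) → i ≤ M
  InSkew-row≤M {i} (p , q) = ≮⇒≥ λ M<i → <⇒≱ (≤-trans (s≤s z≤n) p) (≤-trans q (≤-reflexive (InBox.height bα M<i)))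

  InSkew-bound : ∀ {i j} → InSkew α β (i , j) → (1 ≤ i × i ≤ M) × (1 ≤ j × j ≤ C)
  InSkew-bound {zero} (p , q) = ⊥-elim (<⇒≱ p q)
  InSkew-bound {suc i} s@(p , q) = (s≤s z≤n , InSkew-row≤M s) , ≤-trans (s≤s z≤n) p ,
    ≤-trans q (≤-trans (antitone-≤ {row α} (InBox.antitone bα) ≤-refl (s≤s z≤n)) (InBox.width bα))

  InSkew⇒S′ : ∀ {i j c} → c + i ≡ M + j → InSkew α β (i , j) → S c i
  InSkew⇒S′ eq s@(p , q) with InSkew-bound s
  ... | (1≤i , i≤M) , _ = ≰⇒> (λ i≤d → <⇒≱ p (≤depth⇒≤row bβ 1≤i eq i≤d)) , ≤row⇒≤depth bα 1≤i i≤M eq q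

  InSkew⇒S : ∀ {i j} → InSkew α β (i , j) → S (content (i , j)) i
  InSkew⇒S {i} {j} s = InSkew⇒S′ (content-spec (InSkew-row≤M {i} {j} s)) s

  S⇒InSkew′ : ∀ {c i j} → c + i ≡ M + j → S c i → InSkew α β (i , j)
  S⇒InSkew′ eq s@(p , q) with S-bound s
  ... | (1≤i , i≤M) , _ = ≰⇒> (λ j≤r → <⇒≱ p (≤row⇒≤depth bβ 1≤i i≤M eq j≤r)) , ≤depth⇒≤row bα 1≤i eq q

  S⇒InSkew : ∀ {c i} → S c i → InSkew α β (cell c i)
  S⇒InSkew {c} {i} s = S⇒InSkew′ (cell-spec {c} {i} (<⇒≤ (proj₂ (S-bound s)))) s

-- Minimal border strip decompositions

-- Strip labels have to fill an initial segment of the naturals, so a strip is numbered by the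
-- position of its L in the list of all L's. An absent element would get the length of the list.
indexIn : List ℕ → ℕ → ℕ
indexIn [] k = 0
indexIn (x ∷ xs) k with k ≟ x
... | yes _ = 0
... | no _ = suc (indexIn xs k)

indexIn-< : ∀ {xs k} → k ∈ xs → indexIn xs k < length xs
indexIn-< {x ∷ xs} {k} k∈ with k ≟ x | k∈
... | yes _ | _ = s≤s z≤n
... | no k≢x | here k≡x = ⊥-elim (k≢x k≡x)
... | no _ | there k∈′ = s≤s (indexIn-< k∈′)

indexIn-injective : ∀ {xs k l} → k ∈ xs → l ∈ xs → indexIn xs k ≡ indexIn xs l → k ≡ l
indexIn-injective {x ∷ xs} {k} {l} k∈ l∈ eq with k ≟ x | l ≟ x | k∈ | l∈
... | yes refl | yes refl | _ | _ = refl
... | no k≢x | _ | here k≡x | _ = ⊥-elim (k≢x k≡x)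
... | _ | no l≢x | _ | here l≡x = ⊥-elim (l≢x l≡x)
... | no _ | no _ | there p | there q = indexIn-injective p q (suc-injective eq)

indexIn-onto : ∀ {xs n} → Unique xs → n < length xs → ∃ λ k → k ∈ xs × indexIn xs k ≡ n
indexIn-onto {x ∷ xs} {zero} _ _ = x , here refl , eq
  where
  eq : indexIn (x ∷ xs) x ≡ 0
  eq with x ≟ x
  ... | yes _ = refl
  ... | no x≢x = ⊥-elim (x≢x refl)
indexIn-onto {x ∷ xs} {suc n} (x∉ ∷ u) (s≤s p) with indexIn-onto u p
... | k , k∈ , refl = k , there k∈ , eq
  where
  eq : indexIn (x ∷ xs) k ≡ suc (indexIn xs k)
  eq with k ≟ x
  ... | yes refl = ⊥-elim (All¬⇒¬Any x∉ k∈)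
  ... | no _ = refl

module Decompositions (M C : ℕ) {la mu : List ℕ} (bla : InBox M C la) (bmu : InBox M C mu) (sub : mu ⊆ₚ la) where
  open Depth M C
  open Cells M
  open SkewCells M C bla bmu
  open Letters (depth-steps bmu) (depth-steps bla)
  open Counting (depth-⊆ bmu bla sub)

  a b : ℕ → ℕ
  a = depth mu
  b = depth la

  a≤b : ∀ c → a c ≤ b c
  a≤b = depth-⊆ bmu bla sub

  S? : ∀ c i → Dec (S c i)
  S? c i = (a c <? i) ×-dec (i ≤? b c)

  ¬S0 : ∀ {i} → ¬ S 0 i
  ¬S0 (p , q) = <⇒≱ p (≤-trans q (≤-reflexive
      (trans (Steps.start (depth-steps bla)) (sym (Steps.start (depth-steps bmu))))))

  S⇒<N : ∀ {k i} → S (suc k) i → k < N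
  S⇒<N (p , q) = ≤-trans (n≤1+n _) (Steps.pos⇒<N (depth-steps bla) (≤-trans (s≤s z≤n) (≤-trans p q)))

  content-cell-S : ∀ {c i} → S c i → content (cell c i) ≡ c
  content-cell-S {c} {i} s with S-bound s
  ... | (_ , i≤M) , M<c+i = content-cell {c} i≤M (<⇒≤ M<c+i)

  S-cell : ∀ {x c} → InSkew la mu x → content x ≡ c → S c (proj₁ x) × cell c (proj₁ x) ≡ x
  S-cell s refl = InSkew⇒S s , cell-content (InSkew-row≤M s)

  module OfDecomposition (D : Decomposition la mu) where

    lab : ℕ → ℕ → ℕ
    lab c i = label D (cell c i)

    -- The square of content k + 1 in row i is in the same strip as its left, respectively lower, neighbour.
    Left Down : ℕ → ℕ → Set
    Left k i = S k i × lab (suc k) i ≡ lab k i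
    Down k i = S k (suc i) × lab (suc k) i ≡ lab k (suc i)

    left? : ∀ k i → Dec (Left k i)
    left? k i = S? k i ×-dec (lab (suc k) i ≟ lab k i)

    down? : ∀ k i → Dec (Down k i)
    down? k i = S? k (suc i) ×-dec (lab (suc k) i ≟ lab k (suc i))

    lab-bound : ∀ {c i} → S c i → lab c i < nStrips D
    lab-bound s = label-bound D _ (S⇒InSkew s)

    lab-injective : ∀ {c i i′} → S c i → S c i′ → lab c i ≡ lab c i′ → i ≡ i′
    lab-injective {c} {i} {i′} s s′ eq with strip D (lab c i) (lab-bound s)
    ... | _ , _ , no2 , skew = same-diagonal no2 skew {c} (S⇒InSkew s , refl) (S⇒InSkew s′ , sym eq)
      (cell-spec {c} {i} (<⇒≤ (proj₂ (S-bound s)))) (cell-spec {c} {i′} (<⇒≤ (proj₂ (S-bound s′))))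

    -- Both squares would share the partner of content `k` in row `i + 1`, which puts two squares of
    -- equal content into one strip.
    clash : ∀ {k i} → S (suc k) i → S (suc k) (suc i) → Down k i → Left k (suc i) → ⊥
    clash s s′ (_ , p) (_ , q) = 1+n≢n (sym (lab-injective s s′ (trans p (sym q))))

    record Tail (k i : ℕ) : Set where
      constructor tail
      field
        inS   : S (suc k) i
        ¬left : ¬ Left k i
        ¬down : ¬ Down k i

    -- Strips are connected, so a strip cannot reach a tail from smaller contents.
    tail-first : ∀ {k i c i′} → Tail k i → S c i′ → c ≤ suc k → lab c i′ ≡ lab (suc k) i → c ≡ suc k × i′ ≡ i
    tail-first {k} {i} {c} {i′} (tail s ¬l ¬d) s′ c≤ eq with m≤n⇒m<n∨m≡n c≤
    ... | inj₂ refl = refl , lab-injective s′ s eq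
    ... | inj₁ (s≤s c≤k) with strip D (lab (suc k) i) (lab-bound s)
    ...   | _ , conn , _ , _ with crossing {λ x → InSkew la mu x × label D x ≡ lab (suc k) i}
        (λ {x} (p , _) → InSkew-row≤M {proj₁ x} {proj₂ x} p)
              {cell c i′} {cell (suc k) i} {k}
              (conn (cell c i′) (cell (suc k) i) (S⇒InSkew s′ , eq) (S⇒InSkew s , refl)) (S⇒InSkew s′ , eq)
              (subst (_≤ k) (sym (content-cell-S s′)) c≤k) (subst (k <_) (sym (content-cell-S s)) ≤-refl)
    ...     | z , w , (z∈ , lz) , (w∈ , lw) , cz , cw , rows with S-cell {z} z∈ cz | S-cell {w} w∈ cw
    ...       | sz , ez | sw , ew with lab-injective sw s (trans (cong (label D) ew) lw) | rows
    ...         | refl | inj₁ refl = ⊥-elim (¬l (sz , sym (trans (cong (label D) ez) lz)))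
    ...         | refl | inj₂ refl = ⊥-elim (¬d (sz , sym (trans (cong (label D) ez) lz)))

    tail-unique : ∀ {k i k′ i′} → Tail k i → Tail k′ i′ → lab (suc k) i ≡ lab (suc k′) i′ → k ≡ k′ × i ≡ i′
    tail-unique {k} {i} {k′} {i′} t t′ eq with ≤-total (suc k) (suc k′)
    ... | inj₁ p = let e , e′ = tail-first t′ (Tail.inS t) p eq in suc-injective e , e′
    ... | inj₂ p = let e , e′ = tail-first t (Tail.inS t′) p (sym eq) in sym (suc-injective e) , sym e′

    -- Scanning upwards from the bottom row, some square is not matched with its left neighbour: the
    -- top one, in row `a k`, has none in the diagram. The first such square is not matched
    -- downwards either, because its lower neighbour, if present, is already the partner of the
    -- square in the next row.
    lowest-tail : ∀ {k} → IsLeft k → ∃ λ i → Tail k i × (∀ {i′} → i < i′ → S (suc k) i′ → Left k i′)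
    lowest-tail {k} (p , q) = go (b (suc k) ∸ a k) (subst (_≤ b (suc k)) (sym eq) ≤-refl)
        (λ lt s → ⊥-elim (<⇒≱ (subst (_< _) eq lt) (proj₂ s)))
      where
      eq : b (suc k) ∸ a k + a k ≡ b (suc k)
      eq = m∸n+n≡m (subst (a k ≤_) p (a≤b k))
      go : ∀ m → m + a k ≤ b (suc k) → (∀ {i′} → m + a k < i′ → S (suc k) i′ → Left k i′) →
        ∃ λ i → Tail k i × (∀ {i′} → i < i′ → S (suc k) i′ → Left k i′)
      go m le below with left? k (m + a k)
      ... | no ¬l = m + a k , tail s ¬l (λ d@(s′ , _) → let s″ = <-trans (proj₁ s) ≤-refl , subst (suc (m + a k) ≤_) p (proj₂ s′)
                                     in clash s s″ d (below ≤-refl s″)) , below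
        where
        s : S (suc k) (m + a k)
        s = ≤-trans (≤-reflexive (sym q)) (m≤n+m (a k) m) , le
      go zero le below | yes ((lt , _) , _) = ⊥-elim (<-irrefl refl lt)
      go (suc m) le below | yes l = go m (≤-trans (n≤1+n _) le) λ lt s → case m≤n⇒m<n∨m≡n lt of λ
        { (inj₁ lt′) → below lt′ s ; (inj₂ refl) → l }

    tailRow : ℕ → ℕ
    tailRow k with isLeft? k
    ... | yes l = proj₁ (lowest-tail l)
    ... | no _ = 0

    tailRow-tail : ∀ {k} → IsLeft k → Tail k (tailRow k)
    tailRow-tail {k} l with isLeft? k
    ... | yes l′ = proj₁ (proj₂ (lowest-tail l′))
    ... | no ¬l = ⊥-elim (¬l l)

    tailRow-below : ∀ {k} → IsLeft k → ∀ {i} → tailRow k < i → S (suc k) i → Left k i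
    tailRow-below {k} l with isLeft? k
    ... | yes l′ = proj₂ (proj₂ (lowest-tail l′))
    ... | no ¬l = ⊥-elim (¬l l)

    enum-tailLabels : Enum (λ n → ∃ λ k → IsLeft k × n ≡ lab (suc k) (tailRow k)) #left
    enum-tailLabels = enum-map (λ k → lab (suc k) (tailRow k))
      (λ l l′ eq → proj₁ (tail-unique (tailRow-tail l) (tailRow-tail l′) eq)) enum-left

    tailLabel< : ∀ {n} → (∃ λ k → IsLeft k × n ≡ lab (suc k) (tailRow k)) → n < nStrips D
    tailLabel< (k , l , refl) = lab-bound (Tail.inS (tailRow-tail l))

    #left≤nStrips : #left ≤ nStrips D
    #left≤nStrips = enum-mono tailLabel< enum-tailLabels (enum-< (nStrips D))

    -- A matching described by one threshold. At an L the rule changes from lower to left neighbours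
    -- across the unmatched row `t`; elsewhere it changes from left to lower ones, so that no square
    -- of content `k + 1` takes the square of content `k` in row `t`.
    Realizes : ℕ → ℕ → Set
    Realizes k t = (IsLeft k → ∀ {i} → S (suc k) i → (i < t → Down k i) × (t < i → Left k i))
                 × (¬ IsLeft k → ∀ {i} → S (suc k) i → (i < t → Left k i) × (t ≤ i → Down k i))

  -- The row t of the square left out by a maximum matching of the snake of step k; if the matching is
  -- perfect, t is the value for which Realizes gives the right rule.
  data CodeAt (k t : ℕ) : Set where
    left  : IsLeft k → S (suc k) t → CodeAt k t
    right : IsRight k → S k t → CodeAt k t
    hh    : b k ≡ b (suc k) → a k ≡ a (suc k) → t ≡ suc (b (suc k)) → CodeAt k t
    vv    : b k ≡ suc (b (suc k)) → a k ≡ suc (a (suc k)) → t ≡ suc (a (suc k)) → CodeAt k t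

  left-S : ∀ {k t} → CodeAt k t → IsLeft k → S (suc k) t
  left-S (left _ s) _ = s
  left-S (right r _) l = ⊥-elim (left⇒¬right l r)
  left-S (hh _ q _) (_ , q′) = ⊥-elim (1+n≢n (trans (sym q′) q))
  left-S (vv p _ _) (p′ , _) = ⊥-elim (1+n≢n (trans (sym p) p′))

  enum-CodeAt : ∀ k → Enum (CodeAt k) (leftWeight k * rightWeight k)
  enum-CodeAt k with letter k | isLeft? k | isRight? k
  ... | left l | no ¬l | _ = ⊥-elim (¬l l)
  ... | left l | yes _ | yes r = ⊥-elim (left⇒¬right l r)
  ... | left l | yes _ | no _ = subst (Enum _) (sym (*-identityʳ _))
    (enum-⇔ (left l) (λ c → left-S c l) (enum-interval (a (suc k)) (b (suc k))))
  ... | right r | yes l | _ = ⊥-elim (left⇒¬right l r)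
  ... | right r | no _ | no ¬r = ⊥-elim (¬r r)
  ... | right r@(p , q) | no _ | yes _ = subst (Enum _) (sym (*-identityˡ _))
    (enum-⇔ (right r) (λ { (right _ s) → s ; (left l _) → ⊥-elim (left⇒¬right l r)
      ; (hh p′ _ _) → ⊥-elim (1+n≢n (trans (sym p) p′)) ; (vv _ q′ _) → ⊥-elim (1+n≢n (trans (sym q′) q)) })
          (enum-interval (a k) (b k)))
  ... | hh p q | yes (_ , q′) | _ = ⊥-elim (1+n≢n (trans (sym q′) q))
  ... | hh p q | no _ | yes (p′ , _) = ⊥-elim (1+n≢n (trans (sym p′) p))
  ... | hh p q | no ¬l | no ¬r = enum-⇔ (hh p q)
    (λ { (hh _ _ e) → e ; (vv p′ _ _) → ⊥-elim (1+n≢n (trans (sym p′) p)) ; (left l _) → ⊥-elim (¬l l) ;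
        (right r _) → ⊥-elim (¬r r) }) (enum-single _)
  ... | vv p q | yes (p′ , _) | _ = ⊥-elim (1+n≢n (trans (sym p) p′))
  ... | vv p q | no _ | yes (_ , q′) = ⊥-elim (1+n≢n (trans (sym q) q′))
  ... | vv p q | no ¬l | no ¬r = enum-⇔ (vv p q)
    (λ { (vv _ _ e) → e ; (hh p′ _ _) → ⊥-elim (1+n≢n (trans (sym p) p′)) ; (left l _) → ⊥-elim (¬l l) ;
        (right r _) → ⊥-elim (¬r r) }) (enum-single _)

  module _ (D : Decomposition la mu) where
    open OfDecomposition D

    -- Two thresholds would give contradictory orders: at an L, the rows `t′ - 1` and `t′` would
    -- compete for one square; at an R, the square in row `t` would be matched with both its
    -- neighbours. Otherwise the threshold is prescribed.
    Realizes-< : ∀ {k t t′} → CodeAt k t → CodeAt k t′ → Realizes k t → Realizes k t′ → ¬ t < t′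
    Realizes-< {t = t} {t′ = suc t′} (left l s) c′ (r , _) (r′ , _) (s≤s t≤t′) with left-S c′ l
    ... | s′ = clash s″ s′ (proj₁ (r′ l s″) ≤-refl) (proj₂ (r l s′) (s≤s t≤t′))
      where s″ = ≤-trans (proj₁ s) t≤t′ , ≤-trans (n≤1+n _) (proj₂ s′)
    Realizes-< (right rt s) (left l _) _ _ _ = left⇒¬right l rt
    Realizes-< {k} {t} (right rt@(p , q) s) (right _ s′) (_ , r) (_ , r′) t<t′ = 1+n≢n
        (sym (lab-injective sl sd (trans (sym el) ed)))
      where
      s″ : S (suc k) t
      s″ = subst (_< t) q (proj₁ s) , ≤-pred (≤-trans t<t′ (≤-trans (proj₂ s′) (≤-reflexive p)))
      ¬l : ¬ IsLeft k
      ¬l l = left⇒¬right l rt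
      sl = proj₁ (proj₁ (r′ ¬l s″) t<t′)
      el = proj₂ (proj₁ (r′ ¬l s″) t<t′)
      sd = proj₁ (proj₂ (r ¬l s″) ≤-refl)
      ed = proj₂ (proj₂ (r ¬l s″) ≤-refl)
    Realizes-< (right (p , _) _) (hh p′ _ _) _ _ _ = 1+n≢n (trans (sym p) p′)
    Realizes-< (right (_ , q) _) (vv _ q′ _) _ _ _ = 1+n≢n (trans (sym q′) q)
    Realizes-< (hh _ q _) (left (_ , q′) _) _ _ _ = 1+n≢n (trans (sym q′) q)
    Realizes-< (hh p _ _) (right (p′ , _) _) _ _ _ = 1+n≢n (trans (sym p′) p)
    Realizes-< (hh p q refl) (hh _ _ refl) _ _ lt = <-irrefl refl lt
    Realizes-< (hh p q e) (vv p′ _ _) _ _ _ = 1+n≢n (trans (sym p′) p)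
    Realizes-< (vv p _ _) (left (p′ , _) _) _ _ _ = 1+n≢n (trans (sym p) p′)
    Realizes-< (vv _ q _) (right (_ , q′) _) _ _ _ = 1+n≢n (trans (sym q) q′)
    Realizes-< (vv p q e) (hh p′ _ _) _ _ _ = 1+n≢n (trans (sym p) p′)
    Realizes-< (vv p q refl) (vv _ _ refl) _ _ lt = <-irrefl refl lt

    Realizes-unique : ∀ {k t t′} → CodeAt k t → CodeAt k t′ → Realizes k t → Realizes k t′ → t ≡ t′
    Realizes-unique c c′ r r′ = ≤-antisym (≮⇒≥ (Realizes-< c′ c r′ r)) (≮⇒≥ (Realizes-< c c′ r r′))

    -- The left neighbour is taken by the square in the row above, the lower neighbour by the one in
    -- the row below.
    Realizes-tail : ∀ {k t} → CodeAt k t → Realizes k t → IsLeft k → Tail k t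
    Realizes-tail {k} {suc t} c (r , _) l@(p , q) = tail s ¬left ¬down
      where
      s : S (suc k) (suc t)
      s = left-S c l
      ¬left : ¬ Left k (suc t)
      ¬left lt@((s′ , _) , _) = clash s″ s (proj₁ (r l s″) ≤-refl) lt
        where
        s″ : S (suc k) t
        s″ = ≤-pred (subst (_< suc t) q s′) , ≤-trans (n≤1+n t) (proj₂ s)
      ¬down : ¬ Down k (suc t)
      ¬down d@((_ , s′) , _) = clash s s″ d (proj₂ (r l s″) ≤-refl)
        where
        s″ : S (suc k) (suc (suc t))
        s″ = <-trans (proj₁ s) ≤-refl , subst (suc (suc t) ≤_) p s′
    Realizes-tail {k} {zero} c _ l = case left-S c l of λ { (() , _) }

    module _ (minimal : nStrips D ≤ #left) where

      private
        -- With only `#left` strips, the tails chosen at the L's already meet every label. A strip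
        -- has a single tail, so no others exist.
        tail⇒tailRow : ∀ {k i} → Tail k i → IsLeft k × i ≡ tailRow k
        tail⇒tailRow {k} {i} t with enum-pigeonhole _≟_ tailLabel< enum-tailLabels (enum-< (nStrips D)) minimal
            (lab-bound (Tail.inS t))
        ... | k′ , l , eq with tail-unique t (tailRow-tail l) eq
        ...   | refl , e = l , e

        left-or-down : ∀ {k i} → S (suc k) i → ¬ (IsLeft k × i ≡ tailRow k) → Left k i ⊎ Down k i
        left-or-down {k} {i} s ¬t with left? k i | down? k i
        ... | yes l | _ = inj₁ l
        ... | no _ | yes d = inj₂ d
        ... | no ¬l | no ¬d = ⊥-elim (¬t (tail⇒tailRow (tail s ¬l ¬d)))

        -- The top square has no left neighbour in the diagram, and by `clash` a downward match
        -- propagates from row to row; down to the tail no square is unmatched.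
        above-tail : ∀ {k} → IsLeft k → ∀ m {i} → i ≡ m + a k → S (suc k) i → i < tailRow k → Down k i
        above-tail {k} l m e s lt with left-or-down s (λ (_ , eq) → <⇒≢ lt eq)
        ... | inj₂ d = d
        above-tail {k} l zero refl s lt | inj₁ ((s′ , _) , _) = ⊥-elim (<-irrefl refl s′)
        above-tail {k} l@(_ , q) (suc m) refl s lt | inj₁ lf = ⊥-elim
            (clash s″ s (above-tail l m refl s″ (<-trans ≤-refl lt)) lf)
          where
          s″ : S (suc k) (m + a k)
          s″ = ≤-trans (≤-reflexive (sym q)) (m≤n+m (a k) m) , ≤-trans (n≤1+n _) (proj₂ s)

        down-below : ∀ {k t} → ¬ IsLeft k → S (suc k) t → Down k t → ∀ m {i} → i ≡ m + t → S (suc k) i → Down k i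
        down-below ¬l st d zero refl s = d
        down-below {k} {t} ¬l st d (suc m) refl s with left-or-down s (¬l ∘ proj₁)
        ... | inj₂ d′ = d′
        ... | inj₁ lf = ⊥-elim (clash s″ s (down-below ¬l st d m refl s″) lf)
          where
          s″ : S (suc k) (m + t)
          s″ = ≤-trans (proj₁ st) (m≤n+m t m) , ≤-trans (n≤1+n _) (proj₂ s)

        -- The threshold is the first row not matched to the left. No square is unmatched here, so
        -- that row is matched downwards, and `clash` forces the same on all rows below it.
        threshold : ∀ {k} → ¬ IsLeft k → ∀ m t → m + t ≡ suc (b (suc k)) → a (suc k) < t →
          (∀ {i} → S (suc k) i → i < t → Left k i) →
          ∃ λ t → a (suc k) < t × t ≤ suc (b (suc k)) ×
              (∀ {i} → S (suc k) i → (i < t → Left k i) × (t ≤ i → Down k i))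
        threshold ¬l zero t refl lt lefts = t , lt , ≤-refl , λ s → lefts s , λ le → ⊥-elim (<⇒≱ le (proj₂ s))
        threshold {k} ¬l (suc m) t e lt lefts with left? k t
        ... | yes lf = threshold ¬l m (suc t) (trans (+-suc m t) e) (<-trans lt ≤-refl) λ s i<t → case m≤n⇒m<n∨m≡n
            (≤-pred i<t) of λ
          { (inj₁ i<t) → lefts s i<t ; (inj₂ refl) → lf }
        ... | no ¬lf = t , lt , m+n≤o⇒n≤o (suc m) (≤-reflexive e) , λ {i} s → lefts s , λ t≤i →
            down-below ¬l st dt (i ∸ t) (sym (m∸n+n≡m t≤i)) s
          where
          st : S (suc k) t
          st = lt , m+n≤o⇒n≤o m (≤-reflexive (suc-injective e))
          dt : Down k t
          dt with left-or-down st (¬l ∘ proj₁)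
          ... | inj₁ lf = ⊥-elim (¬lf lf)
          ... | inj₂ d = d

      realized : ∀ k → ∃ λ t → CodeAt k t × Realizes k t
      realized k with isLeft? k
      ... | yes l@(_ , q) = tailRow k , left l (Tail.inS (tailRow-tail l)) ,
          (λ _ {i} s → (λ lt → above-tail l (i ∸ a k) (sym (m∸n+n≡m (≤-trans (≤-reflexive q) (proj₁ s)))) s lt) ,
              λ lt → tailRow-below l lt s) ,
          λ ¬l → ⊥-elim (¬l l)
      ... | no ¬l with threshold ¬l (b (suc k) ∸ a (suc k)) (suc (a (suc k)))
                    (trans (+-suc _ _) (cong suc (m∸n+n≡m (a≤b (suc k))))) ≤-refl
                        (λ s lt → ⊥-elim (<⇒≱ (proj₁ s) (≤-pred lt)))
      ...   | t , lt , le , rule = t , code , (λ l → ⊥-elim (¬l l)) , λ _ → rule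
        where
        code : CodeAt k t
        code with letter k
        ... | left l = ⊥-elim (¬l l)
        ... | right r@(p , q) = right r (subst (_< t) (sym q) lt , subst (t ≤_) (sym p) le)
        -- At `hh` a smaller threshold would match the bottom square downwards, past the last square
        -- of content `k`; at `vv` a larger one would match the top square to the left, where the
        -- diagram has no square.
        ... | hh p q = hh p q (≤-antisym le (≰⇒> λ t≤b → <⇒≱ ≤-refl
            (≤-trans (proj₂ (proj₁ (proj₂ (rule (≤-trans lt t≤b , ≤-refl)) t≤b))) (≤-reflexive p))))
        ... | vv p q = vv p q (≤-antisym (≮⇒≥ λ a<t → <⇒≱
            (≤-<-trans (≤-reflexive (sym q)) (proj₁
            (proj₁ (proj₁ (rule (≤-refl , ≤-pred (≤-trans a<t le))) a<t)))) ≤-refl) lt)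

  Realizes-≈ : (D E : Decomposition la mu) → D ≈D E → ∀ {k t} → OfDecomposition.Realizes D k t →
      OfDecomposition.Realizes E k t
  Realizes-≈ D E eq (r , r′) =
    (λ l s → (λ lt → let s′ , e = proj₁ (r l s) lt in s′ , to s s′ e) , λ lt → let s′ , e = proj₂ (r l s) lt in s′ , to s s′ e) ,
    (λ l s → (λ lt → let s′ , e = proj₁ (r′ l s) lt in s′ , to s s′ e) , λ lt → let s′ , e = proj₂ (r′ l s) lt in s′ , to s s′ e)
    where
    to : ∀ {c i c′ i′} → S c i → S c′ i′ → label D (cell c i) ≡ label D (cell c′ i′) → label E (cell c i) ≡ label E
        (cell c′ i′)
    to s s′ = proj₁ (eq _ _ (S⇒InSkew s) (S⇒InSkew s′))

  module _ (t : ℕ → ℕ) (code : ∀ {k} → k < N → CodeAt k (t k)) where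

    private
      module _ (D E : Decomposition la mu)
        (rD : ∀ {k} → k < N → OfDecomposition.Realizes D k (t k))
            (rE : ∀ {k} → k < N → OfDecomposition.Realizes E k (t k)) where

        -- The two decompositions obey the same rule, so following partners from a square reaches
        -- the same unmatched square in both. Equal labels in one then mean equal roots, hence equal
        -- labels in the other.
        Root : ℕ → ℕ → Set
        Root c i = ∃ λ k → IsLeft k × label D (cell c i) ≡ label D (cell (suc k) (t k))
                                    × label E (cell c i) ≡ label E (cell (suc k) (t k))

        extend : ∀ {k i i′} → S k i′ × label D (cell (suc k) i) ≡ label D (cell k i′) →
          S k i′ × label E (cell (suc k) i) ≡ label E (cell k i′) → (S k i′ → Root k i′) → Root (suc k) i
        extend (s , e) (_ , e′) r with r s
        ... | k′ , l , f , f′ = k′ , l , trans e f , trans e′ f′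

        common-root : ∀ c {i} → S c i → Root c i
        common-root zero s = ⊥-elim (¬S0 s)
        common-root (suc k) {i} s with isLeft? k | <-cmp i (t k) | rD (S⇒<N s) | rE (S⇒<N s)
        ... | yes l | tri< lt _ _ | d , _ | e , _ = extend (proj₁ (d l s) lt) (proj₁ (e l s) lt) (common-root k)
        ... | yes l | tri≈ _ refl _ | _ | _ = k , l , refl , refl
        ... | yes l | tri> _ _ gt | d , _ | e , _ = extend (proj₂ (d l s) gt) (proj₂ (e l s) gt) (common-root k)
        ... | no ¬l | tri< lt _ _ | _ , d | _ , e = extend (proj₁ (d ¬l s) lt) (proj₁ (e ¬l s) lt) (common-root k)
        ... | no ¬l | tri≈ _ eq _ | _ , d | _ , e =
          extend (proj₂ (d ¬l s) (≤-reflexive (sym eq))) (proj₂ (e ¬l s) (≤-reflexive (sym eq))) (common-root k)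
        ... | no ¬l | tri> _ _ gt | _ , d | _ , e = extend (proj₂ (d ¬l s) (<⇒≤ gt)) (proj₂ (e ¬l s) (<⇒≤ gt))
            (common-root k)

        same-label : ∀ {c i c′ i′} → S c i → S c′ i′ → label D (cell c i) ≡ label D (cell c′ i′) → label E
            (cell c i) ≡ label E (cell c′ i′)
        same-label {c} {i} {c′} {i′} s s′ eq with common-root c s | common-root c′ s′
        ... | k , l , e₁ , e₂ | k′ , l′ , e₁′ , e₂′ with OfDecomposition.tail-unique D
                (Realizes-tail D (code (left⇒<N l)) (rD (left⇒<N l)) l)
                    (Realizes-tail D (code (left⇒<N l′)) (rD (left⇒<N l′)) l′)
                (trans (sym e₁) (trans eq e₁′))
        ...   | refl , _ = trans e₂ (sym e₂′)

        same-label′ : ∀ x y → InSkew la mu x → InSkew la mu y → label D x ≡ label D y → label E x ≡ label E y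
        same-label′ x y x∈ y∈ eq with S-cell {x} x∈ refl | S-cell {y} y∈ refl
        ... | s , ex | s′ , ey = subst₂ (λ x y → label E x ≡ label E y) ex ey
          (same-label s s′ (subst₂ (λ x y → label D x ≡ label D y) (sym ex) (sym ey) eq))

    same-code⇒≈ : (D E : Decomposition la mu) → (∀ {k} → k < N → OfDecomposition.Realizes D k (t k)) →
      (∀ {k} → k < N → OfDecomposition.Realizes E k (t k)) → D ≈D E
    same-code⇒≈ D E rD rE x y x∈ y∈ = same-label′ D E rD rE x y x∈ y∈ , same-label′ E D rE rD x y x∈ y∈

    -- The smallest content in the strip through (c , i) is origin c i + 1.
    origin : ℕ → ℕ → ℕ
    origin zero i = 0
    origin (suc k) i with isLeft? k | <-cmp i (t k)
    ... | yes _ | tri< _ _ _ = origin k (suc i)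
    ... | yes _ | tri≈ _ _ _ = k
    ... | yes _ | tri> _ _ _ = origin k i
    ... | no _ | tri< _ _ _ = origin k i
    ... | no _ | tri≈ _ _ _ = origin k (suc i)
    ... | no _ | tri> _ _ _ = origin k (suc i)

    private
      -- The cases of `origin`, enriched with the fact that the square referred to really lies in
      -- the diagram; that is where admissibility of the codes enters.
      data Link (k i : ℕ) : ℕ → Set where
        root : IsLeft k → i ≡ t k → Link k i k
        left : (IsLeft k × t k < i) ⊎ (¬ IsLeft k × i < t k) → S k i → Link k i (origin k i)
        down : (IsLeft k × i < t k) ⊎ (¬ IsLeft k × t k ≤ i) → S k (suc i) → Link k i (origin k (suc i))

      left-below : ∀ {k i} → S (suc k) i → IsLeft k → t k < i → S k i
      left-below {k} {i} s l@(p , q) lt = ≤-trans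
          (s≤s (≤-trans (≤-reflexive q) (proj₁ (left-S (code (S⇒<N s)) l)))) lt , subst (i ≤_) (sym p) (proj₂ s)

      down-above : ∀ {k i} → S (suc k) i → IsLeft k → i < t k → S k (suc i)
      down-above {k} {i} s l@(p , q) lt = ≤-trans (≤-reflexive (cong suc q)) (s≤s (proj₁ s)) , ≤-trans lt
          (≤-trans (proj₂ (left-S (code (S⇒<N s)) l)) (≤-reflexive (sym p)))

      left-above : ∀ {k i} → S (suc k) i → ¬ IsLeft k → i < t k → S k i
      left-above {k} {i} s ¬l lt with code (S⇒<N s)
      ... | left l _ = ⊥-elim (¬l l)
      ... | right (p , q) _ = subst (_< i) (sym q) (proj₁ s) , ≤-trans (proj₂ s)
          (≤-trans (n≤1+n _) (≤-reflexive (sym p)))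
      ... | hh p q _ = subst (_< i) (sym q) (proj₁ s) , subst (i ≤_) (sym p) (proj₂ s)
      ... | vv _ _ e = ⊥-elim (<⇒≱ (proj₁ s) (≤-pred (subst (i <_) e lt)))

      down-below : ∀ {k i} → S (suc k) i → ¬ IsLeft k → t k ≤ i → S k (suc i)
      down-below {k} {i} s ¬l le with code (S⇒<N s)
      ... | left l _ = ⊥-elim (¬l l)
      ... | right (p , q) _ = ≤-trans (s≤s (≤-reflexive q)) (≤-trans (proj₁ s) (n≤1+n i)) , ≤-trans (s≤s (proj₂ s))
          (≤-reflexive (sym p))
      ... | hh _ _ e = ⊥-elim (<⇒≱ (subst (_≤ i) e le) (proj₂ s))
      ... | vv p q _ = ≤-trans (≤-reflexive (cong suc q)) (s≤s (proj₁ s)) , ≤-trans (s≤s (proj₂ s))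
          (≤-reflexive (sym p))

      link : ∀ {k i} → S (suc k) i → Link k i (origin (suc k) i)
      link {k} {i} s with isLeft? k | <-cmp i (t k)
      ... | yes l | tri< lt _ _ = down (inj₁ (l , lt)) (down-above s l lt)
      ... | yes l | tri≈ _ e _ = root l e
      ... | yes l | tri> _ _ gt = left (inj₁ (l , gt)) (left-below s l gt)
      ... | no ¬l | tri< lt _ _ = left (inj₂ (¬l , lt)) (left-above s ¬l lt)
      ... | no ¬l | tri≈ _ e _ = down (inj₂ (¬l , ≤-reflexive (sym e))) (down-below s ¬l (≤-reflexive (sym e)))
      ... | no ¬l | tri> _ _ gt = down (inj₂ (¬l , <⇒≤ gt)) (down-below s ¬l (<⇒≤ gt))

      origin-left : ∀ c {i} → S c i → IsLeft (origin c i) × origin c i < c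
      origin-left zero s = ⊥-elim (¬S0 s)
      origin-left (suc k) {i} s with origin (suc k) i | link s
      ... | _ | root l _ = l , ≤-refl
      ... | _ | left _ s′ = let l , lt = origin-left k s′ in l , m<n⇒m<1+n lt
      ... | _ | down _ s′ = let l , lt = origin-left k s′ in l , m<n⇒m<1+n lt

      left-down-apart : ∀ {k i i′} → (IsLeft k × t k < i) ⊎ (¬ IsLeft k × i < t k) → (IsLeft k × i′ < t k) ⊎
          (¬ IsLeft k × t k ≤ i′) → i ≢ suc i′
      left-down-apart (inj₁ (_ , p)) (inj₁ (_ , q)) refl = <⇒≱ p q
      left-down-apart (inj₂ (_ , p)) (inj₂ (_ , q)) refl = <⇒≱ p (m≤n⇒m≤1+n q)
      left-down-apart (inj₁ (l , _)) (inj₂ (¬l , _)) _ = ¬l l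
      left-down-apart (inj₂ (¬l , _)) (inj₁ (l , _)) _ = ¬l l

      -- Different squares of content `k + 1` refer to different squares of content `k`, to which
      -- induction applies; a new root has an origin larger than all inherited ones.
      origin-injective : ∀ c {i i′} → S c i → S c i′ → origin c i ≡ origin c i′ → i ≡ i′
      origin-injective zero s _ _ = ⊥-elim (¬S0 s)
      origin-injective (suc k) {i} {i′} s s′ eq with origin (suc k) i | link s | origin (suc k) i′ | link s′
      ... | _ | root _ e | _ | root _ e′ = trans e (sym e′)
      ... | _ | root _ _ | _ | left _ r = ⊥-elim (<⇒≢ (proj₂ (origin-left k r)) (sym eq))
      ... | _ | root _ _ | _ | down _ r = ⊥-elim (<⇒≢ (proj₂ (origin-left k r)) (sym eq))
      ... | _ | left _ r | _ | root _ _ = ⊥-elim (<⇒≢ (proj₂ (origin-left k r)) eq)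
      ... | _ | down _ r | _ | root _ _ = ⊥-elim (<⇒≢ (proj₂ (origin-left k r)) eq)
      ... | _ | left _ r | _ | left _ r′ = origin-injective k r r′ eq
      ... | _ | down _ r | _ | down _ r′ = suc-injective (origin-injective k r r′ eq)
      ... | _ | left o r | _ | down o′ r′ = ⊥-elim (left-down-apart o o′ (origin-injective k r r′ eq))
      ... | _ | down o r | _ | left o′ r′ = ⊥-elim (left-down-apart o′ o (sym (origin-injective k r r′ eq)))

      origin-root : ∀ {k} → IsLeft k → origin (suc k) (t k) ≡ k
      origin-root {k} l with isLeft? k | <-cmp (t k) (t k)
      ... | yes _ | tri≈ _ _ _ = refl
      ... | yes _ | tri< lt _ _ = ⊥-elim (<-irrefl refl lt)
      ... | yes _ | tri> _ _ gt = ⊥-elim (<-irrefl refl gt)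
      ... | no ¬l | _ = ⊥-elim (¬l l)

      idx : ℕ → ℕ
      idx = indexIn (list enum-left)

      lb : Cell → ℕ
      lb x = idx (origin (content x) (proj₁ x))

      lb-cell : ∀ {c i} → S c i → lb (cell c i) ≡ idx (origin c i)
      lb-cell {c} {i} s = cong (λ c → idx (origin c i)) (content-cell-S s)

      origin∈ : ∀ i j → InSkew la mu (i , j) → IsLeft (origin (content (i , j)) i)
      origin∈ i j p = proj₁ (origin-left (content (i , j)) {i} (InSkew⇒S {i} {j} p))

      isStrip : ∀ {k} → IsLeft k → IsBorderStrip (λ x → InSkew la mu x × lb x ≡ idx k)
      isStrip {k} l = (cell (suc k) (t k) , Q⇒P (left-S (code (left⇒<N l)) l , origin-root l)) ,
          connected , no2×2 , convex⇒skew (λ x → inSkew? la mu x ×-dec (lb x ≟ idx k)) M C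
              (λ (p , _) → InSkew-bound p) convex
        where
        Strip : Cell → Set
        Strip x = InSkew la mu x × lb x ≡ idx k
        Stripᶜ : ℕ → ℕ → Set
        Stripᶜ c i = S c i × origin c i ≡ k
        Q⇒P : ∀ {c i} → Stripᶜ c i → Strip (cell c i)
        Q⇒P (s , e) = S⇒InSkew s , trans (lb-cell s) (cong idx e)
        Q-back : ∀ {c i} → Stripᶜ (suc c) i → suc k ≤ c → Stripᶜ c i ⊎ Stripᶜ c (suc i)
        Q-back {c} {i} (s , e) k<c with origin (suc c) i | link s
        ... | _ | root _ _ = ⊥-elim (<⇒≢ k<c (sym e))
        ... | _ | left _ s′ = inj₁ (s′ , e)
        ... | _ | down _ s′ = inj₂ (s′ , e)
        P⇒Q : ∀ {i j} → Strip (i , j) → Stripᶜ (content (i , j)) i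
        P⇒Q {i} {j} (p , e) = InSkew⇒S {i} {j} p ,
          indexIn-injective (complete enum-left (origin∈ i j p)) (complete enum-left l) e
        Q-unique : ∀ {c i i′} → Stripᶜ c i → Stripᶜ c i′ → i ≡ i′
        Q-unique {c} (s , e) (s′ , e′) = origin-injective c s s′ (trans e (sym e′))
        Q-start : ∀ {c i} → Stripᶜ c i → suc k ≤ c
        Q-start {c} (s , refl) = proj₂ (origin-left c s)
        open Ribbon {Strip} {Stripᶜ} (S-bound ∘ proj₁) P⇒Q Q⇒P Q-unique (suc k) Q-start Q-back

    decomposition : Decomposition la mu
    decomposition = record
      { nStrips = #left
      ; label = lb
      ; label-bound = λ (i , j) p → subst (lb (i , j) <_) (size enum-left)
          (indexIn-< (complete enum-left (origin∈ i j p)))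
      ; label-onto = λ n n< → let k , l , e = left-of n< ; (x , p , q) , _ = isStrip l in x , p , trans q e
      ; strip = λ n n< → let k , l , e = left-of n< in subst (λ n → IsBorderStrip (λ x → InSkew la mu x × lb x ≡ n)) e (isStrip l)
      }
      where
      left-of : ∀ {n} → n < #left → ∃ λ k → IsLeft k × idx k ≡ n
      left-of n< with indexIn-onto (unique enum-left) (subst (_ <_) (sym (size enum-left)) n<)
      ... | k , k∈ , e = k , sound enum-left k∈ , e

    decomposition-realizes : ∀ {k} → OfDecomposition.Realizes decomposition k (t k)
    decomposition-realizes {k} = (λ l s → (λ lt → dn s (inj₁ (l , lt))) , λ gt → lf s (inj₁ (l , gt))) ,
      (λ ¬l s → (λ lt → lf s (inj₂ (¬l , lt))) , λ le → dn s (inj₂ (¬l , le)))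
      where
      open OfDecomposition decomposition using (Left; Down)
      lf : ∀ {i} → S (suc k) i → (IsLeft k × t k < i) ⊎ (¬ IsLeft k × i < t k) → Left k i
      lf {i} s o = s′ , trans (lb-cell s) (trans (cong idx e) (sym (lb-cell s′)))
        where
        both : (IsLeft k × t k < i) ⊎ (¬ IsLeft k × i < t k) → S k i × origin (suc k) i ≡ origin k i
        both o with origin (suc k) i | link s | o
        ... | _ | left _ s′ | _ = s′ , refl
        ... | _ | root l eq | inj₁ (_ , lt) = ⊥-elim (<⇒≢ lt (sym eq))
        ... | _ | root l eq | inj₂ (¬l , _) = ⊥-elim (¬l l)
        ... | _ | down (inj₁ (_ , lt)) _ | inj₁ (_ , gt) = ⊥-elim (<-asym lt gt)
        ... | _ | down (inj₁ (l , _)) _ | inj₂ (¬l , _) = ⊥-elim (¬l l)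
        ... | _ | down (inj₂ (¬l , _)) _ | inj₁ (l , _) = ⊥-elim (¬l l)
        ... | _ | down (inj₂ (_ , le)) _ | inj₂ (_ , lt) = ⊥-elim (<⇒≱ lt le)
        s′ = proj₁ (both o)
        e = proj₂ (both o)
      dn : ∀ {i} → S (suc k) i → (IsLeft k × i < t k) ⊎ (¬ IsLeft k × t k ≤ i) → Down k i
      dn {i} s o = s′ , trans (lb-cell s) (trans (cong idx e) (sym (lb-cell s′)))
        where
        both : (IsLeft k × i < t k) ⊎ (¬ IsLeft k × t k ≤ i) → S k (suc i) × origin (suc k) i ≡ origin k (suc i)
        both o with origin (suc k) i | link s | o
        ... | _ | down _ s′ | _ = s′ , refl
        ... | _ | root l eq | inj₁ (_ , lt) = ⊥-elim (<⇒≢ lt eq)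
        ... | _ | root l eq | inj₂ (¬l , _) = ⊥-elim (¬l l)
        ... | _ | left (inj₁ (_ , gt)) _ | inj₁ (_ , lt) = ⊥-elim (<-asym lt gt)
        ... | _ | left (inj₁ (l , _)) _ | inj₂ (¬l , _) = ⊥-elim (¬l l)
        ... | _ | left (inj₂ (¬l , _)) _ | inj₁ (l , _) = ⊥-elim (¬l l)
        ... | _ | left (inj₂ (_ , lt)) _ | inj₂ (_ , le) = ⊥-elim (<⇒≱ lt le)
        s′ = proj₁ (both o)
        e = proj₂ (both o)

-- Out-of-range positions have the junk value 0.
at : List ℕ → ℕ → ℕ
at [] _ = 0
at (x ∷ xs) zero = x
at (x ∷ xs) (suc n) = at xs n

-- Codes of minimal decompositions

module CountDecompositions (M C : ℕ) {la mu : List ℕ} (bla : InBox M C la) (bmu : InBox M C mu) (sub : mu ⊆ₚ la) where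
  open Depth M C
  open SkewCells M C bla bmu
  open Letters (depth-steps bmu) (depth-steps bla)
  open Counting (depth-⊆ bmu bla sub)
  open Decompositions M C bla bmu sub

  -- Finite lists instead of functions, so that codes with the same values are equal without
  -- extensionality.
  data Codes : ℕ → ℕ → List ℕ → Set where
    []  : ∀ {k} → Codes 0 k []
    _∷_ : ∀ {m k t ts} → CodeAt k t → Codes m (suc k) ts → Codes (suc m) k (t ∷ ts)

  enum-Codes : ∀ m k → Enum (Codes m k) (∏ (λ k → leftWeight k * rightWeight k) m k)
  enum-Codes zero k = enum-⇔ (λ { refl → [] }) (λ { [] → refl }) (enum-single [])
  enum-Codes (suc m) k = enum-⇔ (λ { (_ , (cs , c) , refl) → c ∷ cs }) (λ { (c ∷ cs) → _ , (cs , c) , refl })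
    (enum-map (λ (ts , t) → t ∷ ts) (λ { _ _ refl → refl })
        (enum-Σ {R = λ _ t → CodeAt k t} (enum-Codes m (suc k)) (λ _ → enum-CodeAt k)))

  Codes-at : ∀ {m k ts} → Codes m k ts → ∀ {n} → n < m → CodeAt (n + k) (at ts n)
  Codes-at (c ∷ cs) {zero} _ = c
  Codes-at {k = k} {ts = _ ∷ ts} (c ∷ cs) {suc n} (s≤s n<m) = subst (λ l → CodeAt l (at ts n)) (+-suc n k)
      (Codes-at cs n<m)

  Codes-at₀ : ∀ {ts} → Codes N 0 ts → ∀ {n} → n < N → CodeAt n (at ts n)
  Codes-at₀ {ts} cs {n} n<N = subst (λ l → CodeAt l (at ts n)) (+-identityʳ n) (Codes-at cs n<N)

  Codes-ext : ∀ {m k ts us} → Codes m k ts → Codes m k us → (∀ {n} → n < m → at ts n ≡ at us n) → ts ≡ us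
  Codes-ext [] [] _ = refl
  Codes-ext (_ ∷ cs) (_ ∷ ds) eq = cong₂ _∷_ (eq {0} (s≤s z≤n)) (Codes-ext cs ds λ {n} lt → eq {suc n} (s≤s lt))

  Codes-build : {R : ℕ → ℕ → Set} → (∀ k → ∃ λ t → CodeAt k t × R k t) → ∀ m k →
    ∃ λ ts → Codes m k ts × (∀ {n} → n < m → R (n + k) (at ts n))
  Codes-build f zero k = [] , [] , λ ()
  Codes-build {R} f (suc m) k with f k | Codes-build {R} f m (suc k)
  ... | t , c , r | ts , cs , rs = t ∷ ts , c ∷ cs ,
      λ { {zero} _ → r ; {suc n} (s≤s lt) → subst (λ l → R l (at ts n)) (+-suc n k) (rs lt) }

  someCode : ∀ k → ∃ λ t → CodeAt k t
  someCode k with letter k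
  ... | left l@(p , q) = b (suc k) , left l (subst₂ _≤_ q p (a≤b k) , ≤-refl)
  ... | right r@(p , q) = b k , right r (subst₂ _<_ (sym q) (sym p) (s≤s (a≤b (suc k))) , ≤-refl)
  ... | hh p q = _ , hh p q refl
  ... | vv p q = _ , vv p q refl

  -- Attains the lower bound `#left`; minimal decompositions and tableaux are compared with it.
  someDecomposition : Decomposition la mu
  someDecomposition = decomposition (proj₁ ∘ someCode) (λ {k} _ → proj₂ (someCode k))

  minimal⇒≤#left : ((D , _) : MinDecomposition la mu) → nStrips D ≤ #left
  minimal⇒≤#left (D , min) = min someDecomposition

  minDecomposition-inverse : Inverse (setoid (Fin (#sorted * #sorted))) (MinDecompositionSetoid la mu)
  minDecomposition-inverse = enum-inverse (MinDecompositionSetoid la mu)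
    codes R encode decode (λ {x} {y} → injective {x} {y}) (λ {x} {y} → deterministic {x} {y})
    where
    codes : Enum (Codes N 0) (#sorted * #sorted)
    codes = subst (Enum _) (trans (∏-* leftWeight rightWeight N 0) (cong (#sorted *_) ∏-right≡#sorted))
        (enum-Codes N 0)
    R : MinDecomposition la mu → List ℕ → Set
    R (D , _) ts = ∀ {k} → k < N → OfDecomposition.Realizes D k (at ts k)
    encode : ∀ x → ∃ λ ts → ts ∈ list codes × R x ts
    encode x@(D , _) with Codes-build {λ k t → OfDecomposition.Realizes D k t} (realized D (minimal⇒≤#left x)) N 0
    ... | ts , cs , r = ts , complete codes cs , λ {k} k<N → subst (λ l → OfDecomposition.Realizes D l (at ts k))
        (+-identityʳ k) (r k<N)
    decode : ∀ ts → Codes N 0 ts → ∃ λ x → R x ts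
    decode ts cs = (decomposition (at ts) (Codes-at₀ cs) , λ E → OfDecomposition.#left≤nStrips E) , λ _ →
        decomposition-realizes (at ts) (Codes-at₀ cs)
    injective : ∀ {x y ts us} → proj₁ x ≈D proj₁ y → Codes N 0 ts → Codes N 0 us → R x ts → R y us → ts ≡ us
    injective {D , _} {E , _} D≈E cs ds r r′ = Codes-ext cs ds λ n<N →
      Realizes-unique E (Codes-at₀ cs n<N) (Codes-at₀ ds n<N) (Realizes-≈ D E D≈E (r n<N)) (r′ n<N)
    deterministic : ∀ {x y ts} → Codes N 0 ts → R x ts → R y ts → proj₁ x ≈D proj₁ y
    deterministic {D , _} {E , _} {ts} cs r r′ = same-code⇒≈ (at ts) (Codes-at₀ cs) D E r r′

-- Minimal border strip tableaux

-- d′ is the depth function obtained from d by adding a border strip with contents u + 1, …, v.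
record Bump (d d′ : ℕ → ℕ) (u v : ℕ) : Set where
  constructor mkBump
  field
    u<v     : u < v
    inside  : ∀ {c} → u < c → c ≤ v → d′ c ≡ suc (d c)
    outside : ∀ {c} → c ≤ u ⊎ v < c → d′ c ≡ d c

  d≤d′ : ∀ c → d c ≤ d′ c
  d≤d′ c with u <? c | c ≤? v
  ... | yes p | yes q = ≤-trans (n≤1+n _) (≤-reflexive (sym (inside p q)))
  ... | no p | _ = ≤-reflexive (sym (outside (inj₁ (≮⇒≥ p))))
  ... | yes _ | no q = ≤-reflexive (sym (outside (inj₂ (≰⇒> q))))

  raised : ∀ {c} → d c < d′ c → u < c × c ≤ v
  raised {c} lt = ≰⇒> (λ c≤u → <⇒≢ lt (sym (outside (inj₁ c≤u)))) , ≮⇒≥ (λ v<c → <⇒≢ lt (sym (outside (inj₂ v<c))))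

Bump-unique : ∀ {d d′ u v u′ v′} → Bump d d′ u v → Bump d d′ u′ v′ → u ≡ u′ × v ≡ v′
Bump-unique b b′ = ≤-antisym (u≤ b′ b) (u≤ b b′) , ≤-antisym (v≤ b b′) (v≤ b′ b)
  where
  raises : ∀ {d d′ u v c} → Bump d d′ u v → u < c → c ≤ v → d c < d′ c
  raises b p q = ≤-reflexive (sym (Bump.inside b p q))
  u≤ : ∀ {d d′ u v u′ v′} → Bump d d′ u v → Bump d d′ u′ v′ → u′ ≤ u
  u≤ b b′ = ≤-pred (proj₁ (Bump.raised b′ (raises b ≤-refl (Bump.u<v b))))
  v≤ : ∀ {d d′ u v u′ v′} → Bump d d′ u v → Bump d d′ u′ v′ → v ≤ v′
  v≤ b b′ = proj₂ (Bump.raised b′ (raises b (Bump.u<v b) ≤-refl))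

bump : (ℕ → ℕ) → ℕ → ℕ → ℕ → ℕ
bump d u v c with (u <? c) ×-dec (c ≤? v)
... | yes _ = suc (d c)
... | no _ = d c

bump-Bump : ∀ d {u v} → u < v → Bump d (bump d u v) u v
bump-Bump d {u} {v} u<v = mkBump u<v ins out
  where
  ins : ∀ {c} → u < c → c ≤ v → bump d u v c ≡ suc (d c)
  ins {c} p q with (u <? c) ×-dec (c ≤? v)
  ... | yes _ = refl
  ... | no ¬pq = ⊥-elim (¬pq (p , q))
  out : ∀ {c} → c ≤ u ⊎ v < c → bump d u v c ≡ d c
  out {c} o with (u <? c) ×-dec (c ≤? v) | o
  ... | no _ | _ = refl
  ... | yes (p , _) | inj₁ q = ⊥-elim (<⇒≱ p q)
  ... | yes (_ , p) | inj₂ q = ⊥-elim (<⇒≱ q p)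

-- Which ends of the step from `c` to `c + 1` are raised when the contents `u + 1` to `v` are: both,
-- only the right one, only the left one, or none.
data Side (u v c : ℕ) : Set where
  both    : u < c → suc c ≤ v → Side u v c
  enter   : c ≡ u → Side u v c
  leave   : c ≡ v → Side u v c
  neither : c ≤ u ⊎ v < c → suc c ≤ u ⊎ v < suc c → Side u v c

side : ∀ u v c → Side u v c
side u v c with <-cmp c u | <-cmp c v
... | tri≈ _ p _ | _ = enter p
... | _ | tri≈ _ p _ = leave p
... | tri< p _ _ | _ = neither (inj₁ (<⇒≤ p)) (inj₁ p)
... | tri> _ _ p | tri< q _ _ = both p q
... | tri> _ _ p | tri> _ _ q = neither (inj₂ q) (inj₂ (m<n⇒m<1+n q))

-- Only the steps `u` and `v` have exactly one end raised. A vertical `u` becomes horizontal and a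
-- horizontal `v` becomes vertical; in the opposite cases the new depth would rise at `u` or drop by
-- two at `v`.
Bump-steps : ∀ {M N d d′ u v} → Steps M N d → Bump d d′ u v → v < N → d u ≡ suc (d (suc u)) → d v ≡ d (suc v) →
    Steps M N d′
Bump-steps {M} {N} {d} {d′} {u} {v} st (mkBump u<v ins out) v<N Vu Hv = record
  { start = trans (out (inj₁ z≤n)) start
  ; end = trans (out (inj₂ v<N)) end
  ; fall = fall′
  ; slow = slow′
  }
  where
  open Steps st
  fall′ : ∀ c → d′ (suc c) ≤ d′ c
  fall′ c with side u v c
  ... | both p q rewrite ins (m<n⇒m<1+n p) q | ins p (<⇒≤ q) = s≤s (fall c)
  ... | enter refl rewrite ins (n<1+n u) u<v | out {u} (inj₁ ≤-refl) = ≤-reflexive (sym Vu)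
  ... | leave refl rewrite ins u<v ≤-refl | out {suc v} (inj₂ ≤-refl) = m≤n⇒m≤1+n (fall v)
  ... | neither p q rewrite out p | out q = fall c
  slow′ : ∀ c → d′ c ≤ suc (d′ (suc c))
  slow′ c with side u v c
  ... | both p q rewrite ins (m<n⇒m<1+n p) q | ins p (<⇒≤ q) = s≤s (slow c)
  ... | enter refl rewrite ins (n<1+n u) u<v | out {u} (inj₁ ≤-refl) = m≤n⇒m≤1+n (slow u)
  ... | leave refl rewrite ins u<v ≤-refl | out {suc v} (inj₂ ≤-refl) = s≤s (≤-reflexive Hv)
  ... | neither p q rewrite out p | out q = slow c

module BumpSteps {M N : ℕ} {d d′ : ℕ → ℕ} {u v : ℕ} (st : Steps M N d) (st′ : Steps M N d′) (bp : Bump d d′ u v) where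
  open Bump bp

  down-u : d u ≡ suc (d (suc u))
  down-u = ≤-antisym (Steps.slow st u) (subst₂ _≤_ (inside ≤-refl u<v) (outside (inj₁ ≤-refl)) (Steps.fall st′ u))

  flat-v : d v ≡ d (suc v)
  flat-v = ≤-antisym (≤-pred (subst₂ _≤_ (inside u<v ≤-refl) (cong suc (outside (inj₂ ≤-refl))) (Steps.slow st′ v)))
      (Steps.fall st v)

  flat-u′ : d′ u ≡ d′ (suc u)
  flat-u′ = trans (outside (inj₁ ≤-refl)) (trans down-u (sym (inside ≤-refl u<v)))

  down-v′ : d′ v ≡ suc (d′ (suc v))
  down-v′ = trans (inside u<v ≤-refl) (cong suc (trans flat-v (sym (outside (inj₂ ≤-refl)))))

  v<N : v < N
  v<N = Steps.pos⇒<N st′ (subst (1 ≤_) (sym (inside u<v ≤-refl)) (s≤s z≤n))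

  keep-flat : ∀ {k} → k ≢ u → k ≢ v → d k ≡ d (suc k) → d′ k ≡ d′ (suc k)
  keep-flat {k} k≢u k≢v e with side u v k
  ... | both p q = trans (inside p (<⇒≤ q)) (trans (cong suc e) (sym (inside (m<n⇒m<1+n p) q)))
  ... | enter p = ⊥-elim (k≢u p)
  ... | leave p = ⊥-elim (k≢v p)
  ... | neither p q = trans (outside p) (trans e (sym (outside q)))

  keep-down : ∀ {k} → k ≢ u → k ≢ v → d k ≡ suc (d (suc k)) → d′ k ≡ suc (d′ (suc k))
  keep-down {k} k≢u k≢v e with side u v k
  ... | both p q = trans (inside p (<⇒≤ q)) (cong suc (trans e (sym (inside (m<n⇒m<1+n p) q))))
  ... | enter p = ⊥-elim (k≢u p)
  ... | leave p = ⊥-elim (k≢v p)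
  ... | neither p q = trans (outside p) (trans e (cong suc (sym (outside q))))

  keep-flat⁻¹ : ∀ {k} → k ≢ u → k ≢ v → d′ k ≡ d′ (suc k) → d k ≡ d (suc k)
  keep-flat⁻¹ {k} k≢u k≢v e with Steps.flat-or-down st k
  ... | inj₁ p = p
  ... | inj₂ p = ⊥-elim (1+n≢n (trans (sym (keep-down k≢u k≢v p)) e))

  keep-down⁻¹ : ∀ {k} → k ≢ u → k ≢ v → d′ k ≡ suc (d′ (suc k)) → d k ≡ suc (d (suc k))
  keep-down⁻¹ {k} k≢u k≢v e with Steps.flat-or-down st k
  ... | inj₁ p = ⊥-elim (1+n≢n (trans (sym e) (keep-flat k≢u k≢v p)))
  ... | inj₂ p = p

  module Letters′ {b : ℕ → ℕ} (sb : Steps M N b) where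
    open Letters st sb
    open Letters st′ sb using () renaming (IsLeft to IsLeft′; IsRight to IsRight′; #left to #left′; enum-left to enum-left′)

    left-kept : ∀ {k} → IsLeft k → k ≢ u → IsLeft′ k
    left-kept {k} (p , q) k≢u = p , keep-down k≢u (λ { refl → 1+n≢n (trans (sym q) flat-v) }) q

    private
      -- An L can be lost only at `u`, as `v` is horizontal before the exchange and so not an L. The
      -- size is a variable so that it can be split as a successor when `u` is removed.
      #left≤suc : ∀ n → Enum IsLeft n → n ≤ suc #left′
      #left≤suc zero e = z≤n
      #left≤suc (suc n) e with isLeft? u
      ... | yes l = s≤s (enum-mono (λ (l , k≢u) → left-kept l k≢u) (enum-remove l e) enum-left′)
      ... | no ¬l = m≤n⇒m≤1+n (enum-mono (λ l → left-kept l (λ { refl → ¬l l })) e enum-left′)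

      -- If `u` is an L that gets lost, then `v` is not an R, hence horizontal in both paths; made
      -- vertical in the lower profile, it becomes an L and replaces `u`.
      #left≤#left′ : ¬ (IsLeft u × IsRight v) → ∀ n → Enum IsLeft n → n ≤ #left′
      #left≤#left′ bad zero e = z≤n
      #left≤#left′ bad (suc n) e with isLeft? u
      ... | no ¬l = enum-mono (λ l → left-kept l (λ { refl → ¬l l })) e enum-left′
      ... | yes l = enum-mono (λ { (inj₁ refl) → left-v ; (inj₂ (l , k≢u)) → left-kept l k≢u })
              (enum-insert {x = v} (λ ((_ , q) , _) → 1+n≢n (trans (sym q) flat-v)) (enum-remove l e)) enum-left′
        where
        left-v : IsLeft′ v
        left-v with Steps.flat-or-down sb v
        ... | inj₁ p = p , down-v′
        ... | inj₂ p = ⊥-elim (bad (l , p , flat-v))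

    #left-drop : #left ≤ suc #left′
    #left-drop = #left≤suc _ enum-left

    #left-keep : ¬ (IsLeft u × IsRight v) → #left ≤ #left′
    #left-keep bad = #left≤#left′ bad _ enum-left

    module _ (lu : IsLeft u) (rv : IsRight v) where

      left⇒left′ : ∀ {k} → IsLeft k × k ≢ u → IsLeft′ k
      left⇒left′ (l , k≢u) = left-kept l k≢u

      left′⇒left : ∀ {k} → IsLeft′ k → IsLeft k × k ≢ u
      left′⇒left {k} (p , q) = (p , keep-down⁻¹ k≢u k≢v q) , k≢u
        where
        k≢u : k ≢ u
        k≢u refl = 1+n≢n (trans (sym q) flat-u′)
        k≢v : k ≢ v
        k≢v refl = 1+n≢n (trans (sym (proj₁ rv)) p)

      right⇒right′ : ∀ {k} → IsRight k × k ≢ v → IsRight′ k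
      right⇒right′ {k} ((p , q) , k≢v) = p , keep-flat (λ { refl → 1+n≢n (trans (sym p) (proj₁ lu)) }) k≢v q

      right′⇒right : ∀ {k} → IsRight′ k → IsRight k × k ≢ v
      right′⇒right {k} (p , q) = (p , keep-flat⁻¹ k≢u k≢v q) , k≢v
        where
        k≢v : k ≢ v
        k≢v refl = 1+n≢n (trans (sym down-v′) q)
        k≢u : k ≢ u
        k≢u refl = 1+n≢n (trans (sym p) (proj₁ lu))

      #left≡suc : #left ≡ suc #left′
      #left≡suc = go _ enum-left
        where
        go : ∀ n → Enum IsLeft n → n ≡ suc #left′
        go zero e = absurd (list e) (size e) (complete e lu)
          where
          absurd : ∀ xs → length xs ≡ 0 → u ∈ xs → 0 ≡ suc #left′
          absurd (_ ∷ _) () _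
        go (suc n) e = cong suc (enum-size-unique left⇒left′ left′⇒left (enum-remove lu e) enum-left′)

      Matching-cons : ∀ {ps} → Letters.Matching st′ sb ps → Matching ((u , v) ∷ ps)
      Matching-cons {ps} (Letters.matching g ul ur f) = matching
        ((u<v , lu , rv) ∷ All.map (λ (lt , l , r) → lt , proj₁ (left′⇒left l) , proj₁ (right′⇒right r)) g)
        (¬Any⇒All¬ _ (λ u∈ → let p , p∈ , e = ∈-map⁻ proj₁ u∈ in proj₂ (left′⇒left (proj₁ (proj₂ (All.lookup g p∈)))) (sym e)) ∷ ul)
        (¬Any⇒All¬ _ (λ v∈ → let p , p∈ , e = ∈-map⁻ proj₂ v∈ in proj₂ (right′⇒right (proj₂ (proj₂ (All.lookup g p∈)))) (sym e)) ∷ ur)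
        (trans (cong suc f) (sym #left≡suc))

      Matching-tail : ∀ {ps} → Matching ((u , v) ∷ ps) → Letters.Matching st′ sb ps
      Matching-tail (matching (_ ∷ g) (u∉ ∷ ul) (v∉ ∷ ur) f) = Letters.matching
        (kept g u∉ v∉) ul ur (suc-injective (trans f #left≡suc))
        where
        kept : ∀ {ps} → All (λ p → proj₁ p < proj₂ p × IsLeft (proj₁ p) × IsRight (proj₂ p)) ps →
          All (u ≢_) (map proj₁ ps) → All (v ≢_) (map proj₂ ps) →
          All (λ p → proj₁ p < proj₂ p × IsLeft′ (proj₁ p) × IsRight′ (proj₂ p)) ps
        kept [] [] [] = []
        kept ((lt , l , r) ∷ g) (n ∷ ns) (m ∷ ms) =
            (lt , left⇒left′ (l , n ∘ sym) , right⇒right′ (r , m ∘ sym)) ∷ kept g ns ms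

-- Without an L the difference of `b` and `a` never rises, and it is 0 at both ends: the scan from
-- the start gives `b ≤ a`, the scan back from `N` gives `a ≤ b`.
no-left⇒≡ : ∀ {M N a b} (sa : Steps M N a) (sb : Steps M N b) → Letters.#left sa sb ≡ 0 → ∀ c → a c ≡ b c
no-left⇒≡ {M} {N} {a} {b} sa sb eq c = ≤-antisym (case ≤-total N c of λ
    { (inj₁ N≤c) → ≤-trans (≤-reflexive (Steps.beyond sa N≤c)) z≤n
    ; (inj₂ c≤N) → down (N ∸ c) (m∸n+n≡m c≤N) }) (up c)
  where
  open Letters sa sb
  ¬left : ∀ {k} → ¬ IsLeft k
  ¬left l = none (list enum-left) (trans (size enum-left) eq) (complete enum-left l)
    where
    none : ∀ {k} xs → length xs ≡ 0 → k ∉ xs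
    none [] _ ()
    none (_ ∷ _) ()
  up : ∀ c → b c ≤ a c
  up zero = ≤-reflexive (trans (Steps.start sb) (sym (Steps.start sa)))
  up (suc k) with letter k
  ... | hh p q = subst₂ _≤_ p q (up k)
  ... | vv p q = ≤-pred (subst₂ _≤_ p q (up k))
  ... | left l = ⊥-elim (¬left l)
  ... | right (p , q) = ≤-trans (n≤1+n _) (subst₂ _≤_ p q (up k))
  down : ∀ m {c} → m + c ≡ N → a c ≤ b c
  down zero refl = ≤-reflexive (trans (Steps.end sa) (sym (Steps.end sb)))
  down (suc m) {c} e with letter c | down m {suc c} (trans (+-suc m c) e)
  ... | hh p q | ih = subst₂ _≤_ (sym q) (sym p) ih
  ... | vv p q | ih = subst₂ _≤_ (sym q) (sym p) (s≤s ih)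
  ... | left l | _ = ⊥-elim (¬left l)
  ... | right (p , q) | ih = subst₂ _≤_ (sym q) (sym p) (m≤n⇒m≤1+n ih)

-- Border strips as bumps of the depth profile

module AddStrip (M C : ℕ) {α p : List ℕ} (bα : InBox M C α) (bp : InBox M C p) where
  open Depth M C
  open Cells M
  open SkewCells M C bp bα

  private
    stα = depth-steps bα
    stp = depth-steps bp

  -- The added squares lie just below the path of `α`, one for each content from `u + 1` to `v`. The
  -- step of `α` between two consecutive contents decides whether their squares are side by side or
  -- one above the other.
  Bump⇒strip : ∀ {u v} → Bump (depth α) (depth p) u v → α ⊆ₚ p × IsBorderStrip (InSkew p α)
  Bump⇒strip {u} {v} bump = α⊆p , (cell (suc u) (suc (depth α (suc u))) , S⇒InSkew {suc u} {suc (depth α (suc u))}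
      (≤-refl , ≤-reflexive (sym (inside ≤-refl u<v)))) , connected , no2×2 ,
      mkPartition p (InBox.partition bp) , mkPartition α (InBox.partition bα) , α⊆p , λ _ → id , id
    where
    open Bump bump
    α⊆p : α ⊆ₚ p
    α⊆p = depth-⊆⁻¹ bα bp d≤d′
    range : ∀ {c i} → S c i → u < c × c ≤ v
    range (q , r) = raised (≤-trans q r)
    row-of : ∀ {c i} → S c i → i ≡ suc (depth α c)
    row-of s@(q , r) = let lt , le = range s in ≤-antisym (≤-trans r (≤-reflexive (inside lt le))) q
    back : ∀ {c i} → S (suc c) i → suc u ≤ c → S c i ⊎ S c (suc i)
    back {c} {i} s u<c with Steps.flat-or-down stα c | row-of s | inside u<c (<⇒≤ (proj₂ (range s)))
    ... | inj₁ e | refl | in-c = inj₁ (≤-reflexive (cong suc e) , ≤-reflexive (trans (cong suc (sym e)) (sym in-c)))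
    ... | inj₂ e | refl | in-c = inj₂ (≤-reflexive (cong suc e) , ≤-reflexive (trans (cong suc (sym e)) (sym in-c)))
    open Ribbon {InSkew p α} {S} S-bound InSkew⇒S S⇒InSkew (λ s s′ → trans (row-of s) (sym (row-of s′)))
      (suc u) (proj₁ ∘ range) back

  -- A strip has at most one square per content, so the depth grows by at most one, and
  -- connectedness makes its contents an interval. Then `u` is the content just before the first one
  -- and `v` is the last one.
  strip⇒Bump : α ⊆ₚ p → IsBorderStrip (InSkew p α) → ∃ λ u → ∃ λ v → Bump (depth α) (depth p) u v
  strip⇒Bump α⊆p ((x , x∈) , conn , no2 , skew) = build (supported {proj₁ x} {proj₂ x} x∈)
    where
    Supp : ℕ → Set
    Supp c = depth α c < depth p c
    supp? : ∀ c → Dec (Supp c)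
    supp? c = depth α c <? depth p c
    ¬supp0 : ¬ Supp 0
    ¬supp0 lt = <⇒≢ lt (trans (Steps.start stα) (sym (Steps.start stp)))
    supported : ∀ {i j} → InSkew p α (i , j) → Supp (content (i , j))
    supported {i} {j} s = let q , r = InSkew⇒S {i} {j} s in ≤-trans q r
    top : ∀ {c} → Supp c → S c (suc (depth α c))
    top lt = ≤-refl , lt
    single : ∀ {c} → Supp c → depth p c ≡ suc (depth α c)
    single {c} lt = ≤-antisym (≮⇒≥ λ lt′ → 1+n≢n (sym (twice (m≤n⇒m≤1+n ≤-refl , lt′)))) lt
      where
      spec : ∀ {i} → S c i → c + i ≡ M + proj₂ (cell c i)
      spec {i} s = cell-spec {c} {i} (<⇒≤ (proj₂ (S-bound s)))
      twice : S c (suc (suc (depth α c))) → suc (depth α c) ≡ suc (suc (depth α c))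
      twice s′ = same-diagonal no2 skew {c} (S⇒InSkew (top lt)) (S⇒InSkew s′) (spec (top lt)) (spec s′)
    content-top : ∀ {c} (lt : Supp c) → content (cell c (suc (depth α c))) ≡ c
    content-top {c} lt with S-bound (top lt)
    ... | (_ , i≤M) , M<c+i = content-cell {c} i≤M (<⇒≤ M<c+i)
    interval : ∀ {c₁ c c₂} → Supp c₁ → Supp c₂ → c₁ ≤ c → c ≤ c₂ → Supp c
    interval {c₁} {c} {c₂} s₁ s₂ p q with m≤n⇒m<n∨m≡n p
    ... | inj₂ refl = s₁
    interval {c₁} {suc c} {c₂} s₁ s₂ _ q | inj₁ (s≤s c₁≤c)
        with crossing (λ {x} x∈ → InSkew-row≤M {proj₁ x} {proj₂ x} x∈) {cell c₁ (suc (depth α c₁))} {cell c₂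
            (suc (depth α c₂))} {c}
               (conn _ _ (S⇒InSkew (top s₁)) (S⇒InSkew (top s₂))) (S⇒InSkew (top s₁))
               (≤-trans (≤-reflexive (content-top s₁)) c₁≤c) (≤-trans q (≤-reflexive (sym (content-top s₂))))
    ... | _ , (i , j) , _ , w∈ , _ , cw , _ = subst Supp cw (supported {i} {j} w∈)
    first : ∀ c → Supp (suc c) → ∃ λ u → ¬ Supp u × Supp (suc u)
    first c s with supp? c
    ... | no ¬s = c , ¬s , s
    first zero s | yes s′ = ⊥-elim (¬supp0 s′)
    first (suc c) s | yes s′ = first c s′
    build : ∀ {c} → Supp c → ∃ λ u → ∃ λ v → Bump (depth α) (depth p) u v
    build {zero} s = ⊥-elim (¬supp0 s)
    build {suc c} s with first c s
    ... | u , ¬su , su = u , v , mkBump (upper su) (λ p q → single (interval su sv p q))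
        (λ { (inj₁ c≤u) → same (λ sc → ¬su (interval sc su c≤u (n≤1+n u))) ; (inj₂ v<c) → same
            (λ sc → <⇒≱ v<c (upper sc)) })
      where
      v = maxUpTo supp? N
      upper : ∀ {c} → Supp c → c ≤ v
      upper {zero} s = z≤n
      upper {suc c} s = maxUpTo-upper supp? N (s≤s z≤n) (<⇒≤ (Steps.pos⇒<N stp (≤-trans (s≤s z≤n) s))) s
      sv : Supp v
      sv = maxUpTo-sat supp? N (≤-trans (s≤s z≤n) (upper su))
      same : ∀ {c} → ¬ Supp c → depth p c ≡ depth α c
      same {c} ¬s = ≤-antisym (≮⇒≥ ¬s) (depth-⊆ bα bp α⊆p c)

module Tableaux (M C : ℕ) {la : List ℕ} (bla : InBox M C la) where
  open Depth M C

  private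
    module Lt {α : List ℕ} (bα : InBox M C α) = Letters (depth-steps bα) (depth-steps bla)

  chainOf : List ℕ → List (ℕ × ℕ) → List (List ℕ)
  chainOf α [] = []
  chainOf α ((u , v) ∷ ps) = let p = shape (bump (depth α) u v) in p ∷ chainOf p ps

  module _ {α : List ℕ} (bα : InBox M C α) {u v : ℕ} (u<v : u < v) (lu : Lt.IsLeft bα u) (rv : Lt.IsRight bα v) where

    private
      st : Steps M N (bump (depth α) u v)
      st = Bump-steps (depth-steps bα) (bump-Bump (depth α) u<v)
          (Letters.right⇒<N (depth-steps bα) (depth-steps bla) rv) (proj₂ lu) (proj₂ rv)

    added-inBox : InBox M C (shape (bump (depth α) u v))
    added-inBox = shape-inBox st

    added-Bump : Bump (depth α) (depth (shape (bump (depth α) u v))) u v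
    added-Bump with bump-Bump (depth α) u<v
    ... | mkBump lt ins out = mkBump lt (λ p q → trans (depth-shape st _) (ins p q))
        (λ o → trans (depth-shape st _) (out o))

    Matching-added : ∀ {ps} → Lt.Matching bα ((u , v) ∷ ps) → Lt.Matching added-inBox ps
    Matching-added = BumpSteps.Letters′.Matching-tail (depth-steps bα) (depth-steps added-inBox) added-Bump
        (depth-steps bla) lu rv

  matching⇒chain : ∀ {α} (bα : InBox M C α) ps → Lt.Matching bα ps → ChainFrom α (chainOf α ps) la × length
      (chainOf α ps) ≡ Lt.#left bα
  matching⇒chain bα [] (Letters.matching _ _ _ f) =
    depth-injective bα bla (no-left⇒≡ (depth-steps bα) (depth-steps bla) (sym f)) , f
  matching⇒chain bα ((u , v) ∷ ps) m@(Letters.matching ((u<v , lu , rv) ∷ _) _ _ f) =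
    let bp = added-inBox bα u<v lu rv
        ⊆p , st = AddStrip.Bump⇒strip M C bα bp (added-Bump bα u<v lu rv)
        rest , len = matching⇒chain bp ps (Matching-added bα u<v lu rv m)
    in (InBox.partition bp , ⊆p , st , rest) ,
       trans (cong suc (trans len (sym (Lt.Matching.full (Matching-added bα u<v lu rv m))))) f

  chainOf-injective : ∀ {α} (bα : InBox M C α) ps qs → Lt.Matching bα ps → Lt.Matching bα qs →
      chainOf α ps ≡ chainOf α qs → ps ≡ qs
  chainOf-injective bα [] [] _ _ _ = refl
  chainOf-injective {α} bα ((u , v) ∷ ps) ((u′ , v′) ∷ qs) m@(Letters.matching
      ((u<v , lu , rv) ∷ _) _ _ _) m′@(Letters.matching ((u<v′ , lu′ , rv′) ∷ _) _ _ _) eq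
    with ∷-injective eq
  ... | e , es with Bump-unique (added-Bump bα u<v lu rv)
      (subst (λ p → Bump (depth α) (depth p) u′ v′) (sym e) (added-Bump bα u<v′ lu′ rv′))
  ...   | refl , refl = cong ((u , v) ∷_) (chainOf-injective (added-inBox bα u<v lu rv) ps qs
            (Matching-added bα u<v lu rv m) (Matching-added bα u<v lu rv m′) es)

  chain-⊆ : ∀ {α} ps → ChainFrom α ps la → α ⊆ₚ la
  chain-⊆ [] refl i = ≤-refl
  chain-⊆ (p ∷ ps) (_ , α⊆p , _ , rest) i = ≤-trans (α⊆p i) (chain-⊆ ps rest i)

  ⊆⇒inBox : ∀ {α} → IsPartition α → α ⊆ₚ la → InBox M C α
  ⊆⇒inBox pα α⊆ = inBox pα (λ {i} M<i → n≤0⇒n≡0 (≤-trans (α⊆ i) (≤-reflexive (InBox.height bla M<i))))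
      (≤-trans (α⊆ 1) (InBox.width bla))

  -- Each strip lowers the number of L's by at most one, and none are left at the end. A chain of
  -- that minimal length cannot afford a strip that fails to lower it, so each strip exchanges an L
  -- with an R.
  chain⇒matching : ∀ {α} (bα : InBox M C α) ps → ChainFrom α ps la →
    Lt.#left bα ≤ length ps × (length ps ≤ Lt.#left bα → ∃ λ qs → Lt.Matching bα qs × ps ≡ chainOf α qs)
  chain⇒matching {α} bα [] refl = ≤-reflexive #left≡0 , λ _ → [] , Letters.matching [] [] [] (sym #left≡0) , refl
    where
    #left≡0 : Lt.#left bα ≡ 0
    #left≡0 = enum-size-unique {P = Lt.IsLeft bα} {Q = λ _ → ⊥} (λ (p , q) → 1+n≢n (trans (sym q) p)) (λ ())
        (Lt.enum-left bα) (enum-∅ (λ ()))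
  chain⇒matching {α} bα (p ∷ ps) (pp , α⊆p , st , rest) with ⊆⇒inBox pp (chain-⊆ ps rest)
  ... | bp with AddStrip.strip⇒Bump M C bα bp α⊆p st | chain⇒matching bp ps rest
  ...   | u , v , bmp | lower , ih = ≤-trans #left-drop (s≤s lower) , match
    where
    open BumpSteps (depth-steps bα) (depth-steps bp) bmp
    open Letters′ (depth-steps bla)
    match : suc (length ps) ≤ Lt.#left bα → ∃ λ qs → Lt.Matching bα qs × p ∷ ps ≡ chainOf α qs
    match le with Lt.isLeft? bα u ×-dec Lt.isRight? bα v
    ... | no bad = ⊥-elim (<⇒≱ le (≤-trans (#left-keep bad) lower))
    ... | yes (lu , rv) with ih (≤-pred (≤-trans le #left-drop))
    ...   | qs , m , refl = (u , v) ∷ qs , Matching-cons lu rv m , cong (λ p → p ∷ chainOf p qs) p≡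
      where
      p≡ : p ≡ shape (bump (depth α) u v)
      p≡ = depth-injective bp (added-inBox bα (Bump.u<v bmp) lu rv) (λ c → agree c)
        where
        bmp′ = added-Bump bα (Bump.u<v bmp) lu rv
        agree : ∀ c → depth p c ≡ depth (shape (bump (depth α) u v)) c
        agree c with u <? c | c ≤? v
        ... | yes q | yes r = trans (Bump.inside bmp q r) (sym (Bump.inside bmp′ q r))
        ... | no q | _ = trans (Bump.outside bmp (inj₁ (≮⇒≥ q))) (sym (Bump.outside bmp′ (inj₁ (≮⇒≥ q))))
        ... | yes _ | no r = trans (Bump.outside bmp (inj₂ (≰⇒> r))) (sym (Bump.outside bmp′ (inj₂ (≰⇒> r))))

  module _ {mu : List ℕ} (bmu : InBox M C mu) (sub : mu ⊆ₚ la) where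
    open Letters (depth-steps bmu) (depth-steps bla)
    open Counting (depth-⊆ bmu bla sub)

    enum-chains : Enum (λ ps → ChainFrom mu ps la × length ps ≤ #left) (#left ! * #sorted)
    enum-chains = enum-⇔
      (λ { (qs , m , refl) → let ch , len = matching⇒chain bmu qs m in ch , ≤-reflexive len })
      (λ (ch , len) → proj₂ (chain⇒matching bmu _ ch) len)
      (enum-map (chainOf mu) (λ {ps} {qs} → chainOf-injective bmu ps qs) enum-matching-orders)

    minTableau-↔ : Fin (#left ! * #sorted) ↔ MinTableau la mu
    minTableau-↔ = enum-inverse (setoid (MinTableau la mu)) enum-chains (λ x ps → MinTableau.chain x ≡ ps)
      -- The proofs in a tableau are irrelevant; decidable membership in the list of chains can
      -- nevertheless be recomputed from them.
      (λ { (mkMinTableau ps ch min) → ps , recompute (DecMembership._∈?_ (≡-dec (≡-dec _≟_)) ps (list enum-chains))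
            (complete enum-chains (ch , min (CountDecompositions.someDecomposition M C bla bmu sub))) , refl })
      (λ ps (ch , len) → mkMinTableau ps ch (λ E → ≤-trans len
          (Decompositions.OfDecomposition.#left≤nStrips M C bla bmu sub E)) , refl)
      (λ { refl _ _ refl refl → refl })
      (λ { {mkMinTableau _ _ _} {mkMinTableau _ _ _} _ refl refl → refl })

-- Snakes

sumTo : ℕ → (ℕ → ℕ) → ℕ
sumTo zero f = 0
sumTo (suc n) f = sumTo n f + f n

sum-upTo : ∀ (f : ℕ → ℕ) n → sum (map f (upTo n)) ≡ sumTo n f
sum-upTo f zero = refl
sum-upTo f (suc n) = begin
  sum (map f (upTo (suc n)))            ≡⟨ cong (sum ∘ map f) (upTo-∷ʳ n) ⟨
  sum (map f (upTo n ∷ʳ n))             ≡⟨ cong sum (map-++ f (upTo n) (n ∷ [])) ⟩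
  sum (map f (upTo n) ++ f n ∷ [])      ≡⟨ sum-++ (map f (upTo n)) (f n ∷ []) ⟩
  sum (map f (upTo n)) + (f n + 0)      ≡⟨ cong₂ _+_ (sum-upTo f n) (+-identityʳ (f n)) ⟩
  sumTo n f + f n                       ∎
  where open ≡-Reasoning

sumTo-cong : ∀ n {f g : ℕ → ℕ} → (∀ {i} → i < n → f i ≡ g i) → sumTo n f ≡ sumTo n g
sumTo-cong zero eq = refl
sumTo-cong (suc n) eq = cong₂ _+_ (sumTo-cong n (eq ∘ m<n⇒m<1+n)) (eq ≤-refl)

sumTo-+ : ∀ n (f g : ℕ → ℕ) → sumTo n (λ i → f i + g i) ≡ sumTo n f + sumTo n g
sumTo-+ zero f g = refl
sumTo-+ (suc n) f g = trans (cong (_+ (f n + g n)) (sumTo-+ n f g)) (interchange (sumTo n f) _ _ _)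

sumTo-step : ∀ n {g f} → (∀ {p} → p < g → f p ≡ 1) → (∀ {p} → g ≤ p → f p ≡ 0) → g ≤ n → sumTo n f ≡ g
sumTo-step zero one zer z≤n = refl
sumTo-step (suc n) {g} {f} one zer g≤ with m≤n⇒m<n∨m≡n g≤
... | inj₁ (s≤s g≤n) = trans (cong₂ _+_ (sumTo-step n one zer g≤n) (zer g≤n)) (+-identityʳ g)
... | inj₂ refl = trans (cong₂ _+_ (ones n (one ∘ m<n⇒m<1+n)) (one ≤-refl)) (+-comm n 1)
  where
  ones : ∀ n → (∀ {p} → p < n → f p ≡ 1) → sumTo n f ≡ n
  ones zero _ = refl
  ones (suc n) one = trans (cong₂ _+_ (ones n (one ∘ m<n⇒m<1+n)) (one ≤-refl)) (+-comm n 1)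

module _ {P : Set} {x y : ℕ} (P? : Dec P) where

  if-yes : P → (if does P? then x else y) ≡ x
  if-yes p rewrite dec-true P? p = refl

  if-no : ¬ P → (if does P? then x else y) ≡ y
  if-no ¬p rewrite dec-false P? ¬p = refl

module _ (M : ℕ) where
  -- The boundary-path index of the step numbered `k` in the shifted count.
  ι : ℕ → ℤ
  ι k = + k - + M

  ι-< : ∀ {k l} → k < l → ι k ℤ.< ι l
  ι-< lt = ℤₚ.+-monoˡ-< (ℤ.- + M) (ℤ.+<+ lt)

  ι-<⁻¹ : ∀ {k l} → ι k ℤ.< ι l → k < l
  ι-<⁻¹ lt = ≰⇒> λ le → ℤₚ.<⇒≱ lt (ℤₚ.+-monoˡ-≤ (ℤ.- + M) (ℤ.+≤+ le))

  ι-injective : ∀ {k l} → ι k ≡ ι l → k ≡ l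
  ι-injective eq = ≤-antisym (≮⇒≥ (λ lt → ℤₚ.<-irrefl (sym eq) (ι-< lt))) (≮⇒≥ (λ lt → ℤₚ.<-irrefl eq (ι-< lt)))

  ι-content : ∀ {k i x} → k + i ≡ M + x → + x - + i ≡ ι k
  ι-content {k} {i} {x} eq = begin
    + x - + i            ≡⟨ ℤₚ.m-n≡m⊖n x i ⟩
    x ⊖ i                ≡⟨ ℤₚ.+-cancelˡ-⊖ M x i ⟨
    (M + x) ⊖ (M + i)    ≡⟨ cong₂ _⊖_ (trans (sym eq) (+-comm k i)) (+-comm M i) ⟩
    (i + k) ⊖ (i + M)    ≡⟨ ℤₚ.+-cancelˡ-⊖ i k M ⟩
    k ⊖ M                ≡⟨ ℤₚ.m-n≡m⊖n k M ⟨
    ι k                  ∎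
    where open ≡-Reasoning

¬EvenSnake-double : ∀ n → ¬ EvenSnake (n + n)
¬EvenSnake-double n (l , eq , 2∣l) with ∣⇒≤ (∣m+n∣m⇒∣n {2} {l} {1}
    (divides n (trans (+-comm l 1) (trans (sym eq)
    (trans (cong (λ m → n + m) (sym (+-identityʳ n))) (*-comm 2 n))))) 2∣l)
... | s≤s ()

EvenSnake-odd : ∀ n → EvenSnake (suc n + n)
EvenSnake-odd n = n + n , refl , divides n (trans (cong (λ m → n + m) (sym (+-identityʳ n))) (*-comm 2 n))

module Snakes (M C : ℕ) {la mu : List ℕ} (bla : InBox M C la) (bmu : InBox M C mu) (sub : mu ⊆ₚ la) where
  open Depth M C
  open Cells M
  open SkewCells M C bla bmu
  open Letters (depth-steps bmu) (depth-steps bla)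
  open Counting (depth-⊆ bmu bla sub)

  private
    a b : ℕ → ℕ
    a = depth mu
    b = depth la

  ind-yes : ∀ x → InSkew la mu x → ind la mu x ≡ 1
  ind-yes x = if-yes (inSkew? la mu x)

  ind-no : ∀ x → ¬ InSkew la mu x → ind la mu x ≡ 0
  ind-no x = if-no (inSkew? la mu x)

  -- Going up from row `b c`, the first `gap c` squares belong to the diagram. The later ones lie in
  -- `mu` or have a coordinate truncated to 0, so any bound `K` of at least `i` gives the same sum.
  diagonal-up : ∀ {c i j} K → c + i ≡ M + j → i ≡ b c → i ≤ K → sumTo K (λ p → ind la mu (i ∸ p , j ∸ p)) ≡ gap c
  diagonal-up {c} {i} {j} K eq refl i≤K = sumTo-step K (λ {p} lt → ind-yes (i ∸ p , j ∸ p) (inn lt))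
      (λ {p} g≤p → ind-no (i ∸ p , j ∸ p) (out g≤p)) (≤-trans (m∸n≤m (b c) (a c)) i≤K)
    where
    inn : ∀ {p} → p < gap c → InSkew la mu (i ∸ p , j ∸ p)
    inn {p} p<g = S⇒InSkew′ spec s
      where
      p+a<i : p + a c < i
      p+a<i = ≤-trans (+-monoˡ-≤ (a c) p<g) (≤-reflexive (m∸n+n≡m (depth-⊆ bmu bla sub c)))
      p≤i : p ≤ i
      p≤i = ≤-trans (m≤m+n p (a c)) (<⇒≤ p+a<i)
      s : S c (i ∸ p)
      s = m+n≤o⇒m≤o∸n (suc (a c)) (≤-trans (≤-reflexive (cong suc (+-comm (a c) p))) p+a<i) , m∸n≤m i p
      sum-eq : c + (i ∸ p) + p ≡ M + j
      sum-eq = trans (+-assoc c (i ∸ p) p) (trans (cong (λ m → c + m) (m∸n+n≡m p≤i)) eq)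
      p≤j : p ≤ j
      p≤j = +-cancelˡ-≤ M p j (≤-trans (+-monoˡ-≤ p (<⇒≤ (proj₂ (S-bound s)))) (≤-reflexive sum-eq))
      spec : c + (i ∸ p) ≡ M + (j ∸ p)
      spec = +-cancelʳ-≡ p _ _ (trans sum-eq (trans (cong (λ m → M + m) (sym (m∸n+n≡m p≤j)))
          (sym (+-assoc M (j ∸ p) p))))
    out : ∀ {p} → gap c ≤ p → ¬ InSkew la mu (i ∸ p , j ∸ p)
    out {p} g≤p s with InSkew-bound s
    ... | (1≤i , _) , 1≤j , _ = <⇒≱ (proj₁ (InSkew⇒S′ spec s))
        (m≤n+o⇒m∸n≤o i p (≤-trans (m≤n+m∸n i (a c)) (≤-trans (+-monoʳ-≤ (a c) g≤p) (≤-reflexive (+-comm (a c) p)))))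
      where
      p≤i : p ≤ i
      p≤i = <⇒≤ (m∸n≢0⇒n<m (λ e → <⇒≱ 1≤i (≤-reflexive e)))
      p≤j : p ≤ j
      p≤j = <⇒≤ (m∸n≢0⇒n<m (λ e → <⇒≱ 1≤j (≤-reflexive e)))
      spec : c + (i ∸ p) ≡ M + (j ∸ p)
      spec = +-cancelʳ-≡ p _ _ (trans (+-assoc c (i ∸ p) p) (trans (cong (λ m → c + m) (m∸n+n≡m p≤i)) (trans eq
        (trans (cong (λ m → M + m) (sym (m∸n+n≡m p≤j))) (sym (+-assoc M (j ∸ p) p))))))

  diagonal-down : ∀ {c i j} → c + i ≡ M + j → i ≡ suc (a c) → sumTo (suc M) (λ p → ind la mu (i + p , j + p)) ≡ gap c
  diagonal-down {c} {i} {j} eq refl = sumTo-step (suc M)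
      (λ {p} lt → ind-yes (i + p , j + p) (S⇒InSkew′ (spec {p}) (s≤s (m≤m+n (a c) _) , inn lt)))
      (λ {p} g≤p → ind-no (i + p , j + p) λ s → <⇒≱ (out {p} s) g≤p)
          (≤-trans (m∸n≤m (b c) (a c)) (m≤n⇒m≤1+n (Steps.d≤M (depth-steps bla) c)))
    where
    spec : ∀ {p} → c + (i + p) ≡ M + (j + p)
    spec {p} = trans (sym (+-assoc c i p)) (trans (cong (_+ p) eq) (+-assoc M j p))
    inn : ∀ {p} → p < gap c → i + p ≤ b c
    inn {p} lt = ≤-trans (≤-reflexive (sym (+-suc (a c) p)))
        (≤-trans (+-monoʳ-≤ (a c) lt) (≤-reflexive (m+[n∸m]≡n (depth-⊆ bmu bla sub c))))
    out : ∀ {p} → InSkew la mu (i + p , j + p) → p < gap c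
    out {p} s = m+n≤o⇒m≤o∸n (suc p) (≤-trans (≤-reflexive (cong suc (+-comm p (a c))))
        (proj₂ (InSkew⇒S′ {i + p} {j + p} (spec {p}) s)))

  -- The squares of a snake alternate between the diagonals of contents `k + 1` and `k`, each of
  -- which is traversed from its lowest row.
  hSnake : ∀ {k i x} → k + i ≡ M + x → i ≡ b k → i ≡ b (suc k) → hSnakeSize la mu i (suc x) ≡ gap (suc k) + gap k
  hSnake {k} {i} {x} eq e e′ = trans (sum-upTo _ (suc (i + suc x))) (trans (sumTo-+ (suc (i + suc x)) _ _)
    (cong₂ _+_ (diagonal-up (suc (i + suc x)) (trans (cong suc eq) (sym (+-suc M x))) e′ i≤)
        (diagonal-up (suc (i + suc x)) eq e i≤)))
    where
    i≤ : i ≤ suc (i + suc x)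
    i≤ = m≤n⇒m≤1+n (m≤m+n i (suc x))

  vSnake : ∀ {k i j} → k + suc i ≡ M + j → suc i ≡ b k → i ≡ b (suc k) → vSnakeSize la mu (suc i) j ≡ gap k + gap
      (suc k)
  vSnake {k} {i} {j} eq e e′ = trans (sum-upTo _ (suc (suc i + j))) (trans (sumTo-+ (suc (suc i + j)) _ _)
    (cong₂ _+_ (diagonal-up (suc (suc i + j)) eq e (m≤n⇒m≤1+n (m≤m+n (suc i) j)))
               (diagonal-up (suc (suc i + j)) (trans (sym (+-suc k i)) eq) e′ (m≤n⇒m≤1+n (m≤n⇒m≤1+n (m≤m+n i j))))))

  down-spec : ∀ {α} → InBox M C α → ∀ {k} → depth α k ≡ suc (depth α (suc k)) → k + depth α k ≡ M + row α (depth α k)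
  down-spec {α} bα {k} eq = ≤-antisym (≤-trans (≤depth⇒ bα 1≤i ≤-refl) (≤-reflexive (+-comm _ M)))
    (≤-trans (≤-reflexive (+-comm M _)) (≤-pred
        (≰⇒> λ le → 1+n≰n (≤-trans (≤-reflexive (sym eq)) (≤depth⇐ bα 1≤i (≤depth⇒≤M bα {c = k} ≤-refl) le)))))
    where
    1≤i : 1 ≤ depth α k
    1≤i = subst (1 ≤_) (sym eq) (s≤s z≤n)

  flat-spec : ∀ {i x} → 1 ≤ i → HStep la i x → ∃ λ k → k + i ≡ M + x × i ≡ b k × i ≡ b (suc k)
  flat-spec {i} {x} 1≤i (inj₁ refl , _) = ⊥-elim (<⇒≱ 1≤i z≤n)
  flat-spec {i} {x} 1≤i (inj₂ x<r , r≤x) = k , eq , ≤-antisym (≤-trans i≤b′ fall) b≤i , ≤-antisym i≤b′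
      (≤-trans fall b≤i)
    where
    i≤M : i ≤ M
    i≤M = ≮⇒≥ λ M<i → <⇒≱ x<r (≤-trans (≤-reflexive (InBox.height bla M<i)) z≤n)
    k = content (i , x)
    eq : k + i ≡ M + x
    eq = content-spec i≤M
    fall = Steps.fall (depth-steps bla) k
    i≤b′ : i ≤ b (suc k)
    i≤b′ = ≤row⇒≤depth bla 1≤i i≤M (trans (cong suc eq) (sym (+-suc M x))) x<r
    b≤i : b k ≤ i
    b≤i = ≮⇒≥ λ i<b → <⇒≱ (≤depth⇒≤row bla (s≤s z≤n)
        (trans (+-suc k i) (trans (cong suc eq) (sym (+-suc M x)))) i<b) r≤x

  left⇒IsL : ∀ {k} → IsLeft k → IsL la mu (ι M k)
  left⇒IsL {k} l@(p , q) = i , x , (inj₂ x<r , r≤x) , ι-content M eq , ¬mu , subst EvenSnake (sym snake-size)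
      (EvenSnake-odd (gap k))
    where
    i = b k
    x = k + i ∸ M
    eq : k + i ≡ M + x
    eq = sym (m+[n∸m]≡n (Steps.M≤c+d (depth-steps bla) k))
    eq′ : suc k + i ≡ M + suc x
    eq′ = trans (cong suc eq) (sym (+-suc M x))
    1≤i : 1 ≤ i
    1≤i = ≤-trans (subst (1 ≤_) (sym q) (s≤s z≤n)) (depth-⊆ bmu bla sub k)
    i≤M : i ≤ M
    i≤M = Steps.d≤M (depth-steps bla) k
    x<r : x < row la i
    x<r = ≤depth⇒≤row bla 1≤i eq′ (≤-reflexive p)
    r≤x : row la (suc i) ≤ x
    r≤x = ≮⇒≥ λ x<r → 1+n≰n (≤row⇒≤depth bla (s≤s z≤n)
        (≮⇒≥ λ M<i → <⇒≱ x<r (≤-trans (≤-reflexive (InBox.height bla M<i)) z≤n))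
            (trans (+-suc k i) eq′) x<r)
    ¬mu : ¬ HStep mu i x
    ¬mu (inj₁ e , _) = <⇒≢ 1≤i (sym e)
    ¬mu (inj₂ x<r , _) = <⇒≱ (≤-trans (≤-reflexive (sym q)) (depth-⊆ bmu bla sub k)) (≤row⇒≤depth bmu 1≤i i≤M eq′ x<r)
    snake-size : hSnakeSize la mu i (suc x) ≡ suc (gap k) + gap k
    snake-size = trans (hSnake eq refl p) (cong (_+ gap k) (gap-left l))

  IsL⇒left : ∀ {z} → IsL la mu z → ∃ λ k → z ≡ ι M k × IsLeft k
  -- A horizontal step at height 0 starts at or beyond the first row of `la`, hence also of `mu`,
  -- and is common to both paths.
  IsL⇒left (zero , x , (_ , r≤x) , _ , ¬mu , _) = ⊥-elim (¬mu (inj₁ refl , ≤-trans (sub 1) r≤x))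
  IsL⇒left (suc i , x , h , z-eq , _ , even) with flat-spec (s≤s z≤n) h
  ... | k , eq , e , e′ with letter k
  ...   | left l = k , trans (sym z-eq) (ι-content M eq) , l
  ...   | right (p , _) = ⊥-elim (1+n≢n (trans (sym p) (trans (sym e) e′)))
  ...   | vv p _ = ⊥-elim (1+n≢n (trans (sym p) (trans (sym e) e′)))
  -- Equal numbers of squares on the two diagonals make the size even, while an even length means an
  -- odd size.
  ...   | hh p q = ⊥-elim (¬EvenSnake-double (gap k)
      (subst EvenSnake (trans (hSnake eq e e′) (cong (_+ gap k) (sym (cong₂ _∸_ p q)))) even))

  right⇒IsR : ∀ {k} → IsRight k → IsR la mu (ι M k)
  right⇒IsR {k} r@(p , q) = b k , 1≤i , ι-content M eq , mu≢la ,
      subst EvenSnake (sym snake-size) (EvenSnake-odd (gap (suc k)))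
    where
    1≤i : 1 ≤ b k
    1≤i = subst (1 ≤_) (sym p) (s≤s z≤n)
    i≤M : b k ≤ M
    i≤M = Steps.d≤M (depth-steps bla) k
    eq : k + b k ≡ M + row la (b k)
    eq = down-spec bla p
    mu≢la : ¬ (row mu (b k) ≡ row la (b k))
    mu≢la e = 1+n≰n (≤-trans (≤depth⇒ bmu 1≤i
        (≤-trans (≤depth⇐ bmu 1≤i i≤M (≤-reflexive (trans eq′ (+-comm M _)))) (≤-reflexive q)))
        (≤-reflexive (trans (+-comm _ M) (sym eq′))))
      where
      eq′ : k + b k ≡ M + row mu (b k)
      eq′ = trans eq (cong (λ m → M + m) (sym e))
    snake-size : vSnakeSize la mu (b k) (row la (b k)) ≡ suc (gap (suc k)) + gap (suc k)
    snake-size = subst (λ i → vSnakeSize la mu i (row la (b k)) ≡ suc (gap (suc k)) + gap (suc k)) (sym p)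
      (trans (vSnake (trans (cong (λ m → k + m) (sym p)) eq) (sym p) refl) (cong (_+ gap (suc k)) (gap-right r)))

  IsR⇒right : ∀ {z} → IsR la mu z → ∃ λ k → z ≡ ι M k × IsRight k
  IsR⇒right (suc i , _ , z-eq , mu≢la , even) with letter k
    where k = content (suc i , row la (suc i))
  ... | lt = go lt
    where
    k = content (suc i , row la (suc i))
    -- Below the last row of `la` both rows are 0 and the paths share the step.
    i≤M : suc i ≤ M
    i≤M = ≮⇒≥ λ M<i → mu≢la (trans (InBox.height bmu M<i) (sym (InBox.height bla M<i)))
    eq : k + suc i ≡ M + row la (suc i)
    eq = content-spec i≤M
    i≤b : suc i ≤ b k
    i≤b = ≤row⇒≤depth bla (s≤s z≤n) i≤M eq ≤-refl
    b′<i : b (suc k) < suc i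
    b′<i = ≰⇒> λ le → 1+n≰n (≤depth⇒≤row bla (s≤s z≤n) (trans (cong suc eq) (sym (+-suc M _))) le)
    e : suc i ≡ b k
    e = ≤-antisym i≤b (≤-trans (Steps.slow (depth-steps bla) k) b′<i)
    e′ : i ≡ b (suc k)
    e′ = ≤-antisym (≤-pred (≤-trans i≤b (Steps.slow (depth-steps bla) k))) (≤-pred b′<i)
    down : b k ≢ b (suc k)
    down p = <⇒≱ b′<i (≤-trans i≤b (≤-reflexive p))
    go : Letter k → ∃ λ k → _ ≡ ι M k × IsRight k
    go (right r) = k , trans (sym z-eq) (ι-content M eq) , r
    go (left (p , _)) = ⊥-elim (down p)
    go (hh p _) = ⊥-elim (down p)
    go (vv p q) = ⊥-elim (¬EvenSnake-double (gap (suc k)) (subst EvenSnake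
      (trans (vSnake eq e e′) (cong (_+ gap (suc k)) (cong₂ _∸_ p q))) even))

-- Rank

sumTo-single : ∀ n {f j₀} → (∀ {j} → j ≢ j₀ → f j ≡ 0) → (n ≤ j₀ → f j₀ ≡ 0) → sumTo n f ≡ f j₀
sumTo-single zero _ out = sym (out z≤n)
sumTo-single (suc n) {f} {j₀} z out with n ≟ j₀
... | yes refl = cong (_+ f n) (zeros n ≤-refl)
  where
  zeros : ∀ m → m ≤ n → sumTo m f ≡ 0
  zeros zero _ = refl
  zeros (suc m) m<n = cong₂ _+_ (zeros m (<⇒≤ m<n)) (z (<⇒≢ m<n))
... | no n≢ = trans (cong₂ _+_ (sumTo-single n z (λ n≤ → out (≤∧≢⇒< n≤ n≢))) (z n≢)) (+-identityʳ _)

sumTo-filter : {P : ℕ → Set} (P? : ∀ k → Dec (P k)) → ∀ n → sumTo n (λ k → if does (P? k) then 1 else 0) ≡ proj₁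
    (enum-filter P? n)
sumTo-filter P? zero = refl
sumTo-filter P? (suc n) with P? n | sumTo-filter P? n
... | yes _ | ih = trans (+-comm _ 1) (cong suc ih)
... | no _ | ih = trans (+-identityʳ _) ih

sum-concatMap : {A B : Set} (g : B → ℕ) (f : A → List B) (xs : List A) →
  sum (map g (concatMap f xs)) ≡ sum (map (λ x → sum (map g (f x))) xs)
sum-concatMap g f [] = refl
sum-concatMap g f (x ∷ xs) = trans (cong sum (map-++ g (f x) (concatMap f xs)))
  (trans (sum-++ (map g (f x)) _) (cong (λ m → sum (map g (f x)) + m) (sum-concatMap g f xs)))

sum-oneTo : ∀ (f : ℕ → ℕ) n → sum (map f (oneTo n)) ≡ sumTo n (f ∘ suc)
sum-oneTo f n = trans (cong sum (sym (map-∘ (upTo n)))) (sum-upTo (f ∘ suc) n)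

sumTo-telescope : ∀ n {O G F I : ℕ → ℕ} → O 0 ≡ F 0 + I 0 → (∀ i → O (suc i) + G i ≡ F (suc i) + I (suc i)) →
  sumTo (suc n) O + sumTo n G ≡ sumTo (suc n) F + sumTo (suc n) I
sumTo-telescope zero e₀ e = trans (+-identityʳ _) e₀
sumTo-telescope (suc n) {O} {G} {F} {I} e₀ e = begin
  sumTo (suc n) O + O (suc n) + (sumTo n G + G n)   ≡⟨ interchange (sumTo (suc n) O) _ _ _ ⟩
  sumTo (suc n) O + sumTo n G + (O (suc n) + G n)   ≡⟨ cong₂ _+_ (sumTo-telescope n e₀ e) (e n) ⟩
  sumTo (suc n) F + sumTo (suc n) I + (F (suc n) + I (suc n)) ≡⟨ interchange (sumTo (suc n) F) _ _ _ ⟩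
  sumTo (suc n) F + F (suc n) + (sumTo (suc n) I + I (suc n)) ∎
  where open ≡-Reasoning

module Rank {la mu : List ℕ} (pla : IsPartition la) (pmu : IsPartition mu) (bmu : InBox (length la) (row la 1) mu)
    (sub : mu ⊆ₚ la) where

  private
    M = length la
    C = row la 1

  bla : InBox M C la
  bla = inBox pla (row-beyond la) ≤-refl

  open Depth M C
  open Cells M
  open SkewCells M C bla bmu
  open Letters (depth-steps bmu) (depth-steps bla)
  open Counting (depth-⊆ bmu bla sub)
  open Snakes M C bla bmu sub

  private
    cornerSum : ∀ isCorner → cornerDiagSum isCorner la mu ≡
      sumTo M (λ i → sumTo C (λ j → if isCorner (suc i , suc j) then diagLen la mu (suc i , suc j) else 0))
    cornerSum isCorner = trans (sum-concatMap g (λ i → map (λ j → (i , j)) (oneTo C)) (oneTo M))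
      (trans (sum-oneTo (λ i → sum (map g (map (λ j → (i , j)) (oneTo C)))) M)
        (sumTo-cong M λ {i} _ → trans (cong sum (sym (map-∘ (oneTo C)))) (sum-oneTo (λ j → g (suc i , j)) C)))
      where
      g : Cell → ℕ
      g c = if isCorner c then diagLen la mu c else 0

    Outside Inside : Cell → Set
    Outside (i , j) = InSkew la mu (i , j) × ¬ InSkew la mu (i ∸ 1 , j) × ¬ InSkew la mu (i , j ∸ 1)
    Inside (i , j) = InSkew la mu (i , j) × InSkew la mu (i ∸ 1 , j) × InSkew la mu (i , j ∸ 1) × ¬ InSkew la mu
        (i ∸ 1 , j ∸ 1)

    outside? : ∀ c → Dec (Outside c)
    outside? (i , j) = inSkew? la mu (i , j) ×-dec ¬? (inSkew? la mu (i ∸ 1 , j)) ×-dec ¬? (inSkew? la mu (i , j ∸ 1))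

    inside? : ∀ c → Dec (Inside c)
    inside? (i , j) = inSkew? la mu (i , j) ×-dec inSkew? la mu (i ∸ 1 , j) ×-dec inSkew? la mu (i , j ∸ 1) ×-dec ¬?
        (inSkew? la mu (i ∸ 1 , j ∸ 1))

    -- The vertical step of μ in row i + 1 separates the diagonals counted by G i and F i.
    O I F G : ℕ → ℕ
    O i = sumTo C (λ j → if outsideCornerᵇ la mu (suc i , suc j) then diagLen la mu (suc i , suc j) else 0)
    I i = sumTo C (λ j → if insideCornerᵇ la mu (suc i , suc j) then diagLen la mu (suc i , suc j) else 0)
    F i = diagLen la mu (suc i , suc (row mu (suc i)))
    G i = diagLen la mu (suc (suc i) , suc (row mu (suc i)))

    row-la-C : ∀ i → row la (suc i) ≤ C
    row-la-C i = antitone-≤ {row la} (row-antitone pla) ≤-refl (s≤s z≤n)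

    diagLen-0 : ∀ {i j} → row la (suc i) < j → diagLen la mu (suc i , j) ≡ 0
    diagLen-0 {i} {j} lt = trans (sum-upTo _ (suc M)) (sumTo-step (suc M) (λ ())
      (λ {p} _ → ind-no (suc i + p , j + p) λ (_ , le) → <⇒≱ (≤-trans lt (m≤m+n j p))
        (≤-trans le (antitone-≤ {row la} (row-antitone pla) (s≤s z≤n) (m≤m+n (suc i) p)))) z≤n)

    O-corner : ∀ i → O i ≡ (if outsideCornerᵇ la mu (suc i , suc (row mu (suc i))) then F i else 0)
    O-corner i = sumTo-single C
      (λ {j} j≢ → if-no (outside? (suc i , suc j)) λ ((p , q) , _ , ¬l) → j≢
          (≤-antisym (≮⇒≥ λ lt → ¬l (lt , <⇒≤ q)) (≤-pred p)))
      (λ C≤ → if-no (outside? (suc i , suc (row mu (suc i)))) λ ((_ , q) , _) → <⇒≱ q (≤-trans (row-la-C i) C≤))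

    I-corner : ∀ i → I (suc i) ≡ (if insideCornerᵇ la mu (suc (suc i) , suc (row mu (suc i))) then G i else 0)
    I-corner i = sumTo-single C
      (λ {j} j≢ → if-no (inside? (suc (suc i) , suc j)) λ (_ , (p , q) , _ , ¬d) → j≢
          (≤-antisym (≮⇒≥ λ lt → ¬d (lt , <⇒≤ q)) (≤-pred p)))
      (λ C≤ → if-no (inside? (suc (suc i) , suc (row mu (suc i)))) λ ((_ , q) , _) → <⇒≱ q
          (≤-trans (row-la-C (suc i)) C≤))

    -- The only candidate for an outside corner in the row is the first square after `mu`. If that
    -- square is not in the diagram, there is no corner, but then its diagonal is empty too.
    O-descent : ∀ i → (InSkew la mu (suc i , suc (row mu (suc i))) → ¬ InSkew la mu (i , suc (row mu (suc i)))) →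
        O i ≡ F i
    O-descent i ¬up with suc (row mu (suc i)) ≤? row la (suc i)
    ... | yes le = trans (O-corner i) (if-yes (outside? (suc i , suc (row mu (suc i))))
        ((≤-refl , le) , ¬up (≤-refl , le) , λ (p , _) → <-irrefl refl p))
    ... | no ≰ = trans (O-corner i) (trans (if-no (outside? (suc i , suc (row mu (suc i)))) λ ((_ , q) , _) → ≰ q)
        (sym (diagLen-0 (≰⇒> ≰))))

    I-descent : ∀ i → row mu (suc (suc i)) < row mu (suc i) → I (suc i) ≡ G i
    I-descent i lt with suc (row mu (suc i)) ≤? row la (suc (suc i))
    ... | yes le = trans (I-corner i) (if-yes (inside? (suc (suc i) , suc (row mu (suc i))))
      ((m<n⇒m<1+n lt , le) , (≤-refl , ≤-trans le (row-antitone pla (s≤s z≤n))) , (lt , <⇒≤ le) , λ (p , _) →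
          <-irrefl refl p))
    ... | no ≰ = trans (I-corner i) (trans (if-no (inside? (suc (suc i) , suc (row mu (suc i)))) λ ((_ , q) , _) →
        ≰ q) (sym (diagLen-0 (≰⇒> ≰))))

    first-row : O 0 ≡ F 0 + I 0
    first-row = trans (O-descent 0 (λ _ (p , q) → <⇒≱ p q)) (sym (trans (cong (λ m → F 0 + m) I0) (+-identityʳ _)))
      where
      I0 : I 0 ≡ 0
      I0 = trans (sumTo-single C {j₀ = C} (λ {j} _ → no-inside j) (λ _ → no-inside C)) (no-inside C)
        where
        no-inside : ∀ j → (if insideCornerᵇ la mu (1 , suc j) then diagLen la mu (1 , suc j) else 0) ≡ 0
        no-inside j = if-no (inside? (1 , suc j)) λ (_ , (p , q) , _) → <⇒≱ p q

    -- If rows i and i + 1 of μ agree, there is no corner between them and F and G count the same diagonal.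
    next-row : ∀ i → O (suc i) + G i ≡ F (suc i) + I (suc i)
    next-row i with m≤n⇒m<n∨m≡n (row-antitone pmu {suc i} (s≤s z≤n))
    ... | inj₁ lt = cong₂ _+_ (O-descent (suc i) (λ _ (p , _) → <⇒≱ p lt)) (sym (I-descent i lt))
    ... | inj₂ eq = begin
      O (suc i) + G i         ≡⟨ cong (_+ G i) O≡0 ⟩
      G i                     ≡⟨ cong (λ m → diagLen la mu (suc (suc i) , suc m)) (sym eq) ⟩
      F (suc i)               ≡⟨ +-identityʳ (F (suc i)) ⟨
      F (suc i) + 0           ≡⟨ cong (λ m → F (suc i) + m) I≡0 ⟨
      F (suc i) + I (suc i)   ∎
      where
      open ≡-Reasoning
      O≡0 : O (suc i) ≡ 0
      O≡0 = trans (O-corner (suc i)) (if-no (outside? (suc (suc i) , suc (row mu (suc (suc i))))) λ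
          ((p , q) , ¬up , _) →
        ¬up (subst (_< suc (row mu (suc (suc i)))) eq p , ≤-trans q (row-antitone pla (s≤s z≤n))))
      I≡0 : I (suc i) ≡ 0
      I≡0 = trans (I-corner i) (if-no (inside? (suc (suc i) , suc (row mu (suc i)))) λ (_ , _ , (p , _) , _) →
          <-irrefl eq p)

    vstep : ℕ → ℕ
    vstep i = content (suc i , row mu (suc i))

    vstep-spec : ∀ {i} → i < M → vstep i + suc i ≡ M + row mu (suc i)
    vstep-spec i<M = content-spec i<M

    depth-vstep : ∀ {i} → i < M → depth mu (vstep i) ≡ suc i × depth mu (suc (vstep i)) ≡ i
    depth-vstep {i} i<M = ≤-antisym (≤-trans (Steps.slow (depth-steps bmu) (vstep i)) (s≤s hi)) lo , ≤-antisym hi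
        (≤-pred (≤-trans lo (Steps.slow (depth-steps bmu) (vstep i))))
      where
      lo : suc i ≤ depth mu (vstep i)
      lo = ≤row⇒≤depth bmu (s≤s z≤n) i<M (vstep-spec i<M) ≤-refl
      hi : depth mu (suc (vstep i)) ≤ i
      hi = ≮⇒≥ λ le → 1+n≰n (≤depth⇒≤row bmu (s≤s z≤n) (trans (cong suc (vstep-spec i<M)) (sym (+-suc M _))) le)

    F-gap : ∀ {i} → i < M → F i ≡ gap (suc (vstep i))
    F-gap {i} i<M = trans (sum-upTo _ (suc M))
        (diagonal-down (trans (cong suc (vstep-spec i<M)) (sym (+-suc M _)))
        (cong suc (sym (proj₂ (depth-vstep i<M)))))

    G-gap : ∀ {i} → i < M → G i ≡ gap (vstep i)
    G-gap {i} i<M = trans (sum-upTo _ (suc M))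
        (diagonal-down (trans (+-suc (vstep i) (suc i)) (trans (cong suc (vstep-spec i<M)) (sym (+-suc M _))))
        (cong suc (sym (proj₁ (depth-vstep i<M)))))

    isLeftStep? : ∀ i → Dec (IsLeft (vstep i))
    isLeftStep? i = isLeft? (vstep i)

    -- `F` and `G` count the squares of the contents on either side of a vertical step of `mu`;
    -- between them `gap` rises by one if the step is an L and is constant if `la` is vertical too.
    F≡G+left : ∀ {i} → i < M → F i ≡ G i + (if does (isLeftStep? i) then 1 else 0)
    F≡G+left {i} i<M with letter (vstep i) | depth-vstep i<M
    ... | left l | _ = trans (F-gap i<M) (trans (gap-left l)
        (sym (trans (cong₂ _+_ (G-gap i<M) (if-yes (isLeftStep? i) l)) (+-comm _ 1))))
    ... | vv p q | _ = trans (F-gap i<M) (trans (sym (cong₂ _∸_ p q))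
        (sym (trans (cong₂ _+_ (G-gap i<M) (if-no (isLeftStep? i) λ (p′ , _) → 1+n≢n (trans (sym p) p′)))
        (+-identityʳ _))))
    ... | hh _ q | e , e′ = ⊥-elim (1+n≢n (trans (sym e) (trans q e′)))
    ... | right (_ , q) | e , e′ = ⊥-elim (1+n≢n (trans (sym e) (trans q e′)))

    left-steps : sumTo M (λ i → if does (isLeftStep? i) then 1 else 0) ≡ #left
    left-steps = trans (sumTo-filter isLeftStep? M) (enum-size-unique
        (λ { (i , (i<M , l) , refl) → l }) preimage
        (enum-map vstep (λ (i<M , _) (i′<M , _) eq → suc-injective
            (trans (sym (proj₁ (depth-vstep i<M))) (trans (cong (depth mu) eq) (proj₁ (depth-vstep i′<M)))))
          (proj₂ (enum-filter isLeftStep? M))) enum-left)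
      where
      preimage : ∀ {k} → IsLeft k → ∃ λ i → (i < M × IsLeft (vstep i)) × k ≡ vstep i
      preimage {k} l@(_ , q) = i , (i<M , subst IsLeft k≡ l) , k≡
        where
        i = depth mu (suc k)
        i<M : i < M
        i<M = subst (_≤ M) q (Steps.d≤M (depth-steps bmu) k)
        k≡ : k ≡ vstep i
        k≡ = sym (content-unique i<M (subst (λ x → k + x ≡ M + row mu x) q (down-spec bmu q)))

    G-last : ∀ {m} → suc m ≡ M → G m ≡ 0
    G-last {m} eq = trans (G-gap (≤-reflexive eq))
        (m≤n⇒m∸n≡0 (≤-trans (Steps.d≤M (depth-steps bla) _)
        (≤-reflexive (trans (sym eq) (sym (proj₁ (depth-vstep (≤-reflexive eq))))))))

    ΣF : sumTo M F ≡ sumTo M G + #left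
    ΣF = trans (sumTo-cong M F≡G+left) (trans (sumTo-+ M G _) (cong (λ m → sumTo M G + m) left-steps))

    -- The row identities involve `G` only between consecutive rows. The missing last value is 0,
    -- since the path of `mu` is at full depth there, so `F` and `G` can be compared over all rows.
    -- The height is made a variable in order to split off the last row.
    ΣO : sumTo M O ≡ #left + sumTo M I
    ΣO = by-height M refl
      where
      by-height : ∀ m → m ≡ M → sumTo m O ≡ #left + sumTo m I
      by-height zero e = sym (trans (+-identityʳ _)
          (trans (sym left-steps) (cong (λ m → sumTo m (λ i → if does (isLeftStep? i) then 1 else 0)) (sym e))))
      by-height (suc m) e = +-cancelʳ-≡ (sumTo m G) _ _ (begin
        sumTo (suc m) O + sumTo m G                     ≡⟨ sumTo-telescope m first-row next-row ⟩
        sumTo (suc m) F + sumTo (suc m) I               ≡⟨ cong (_+ sumTo (suc m) I)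
            (subst (λ n → sumTo n F ≡ sumTo n G + #left) (sym e) ΣF) ⟩
        sumTo m G + G m + #left + sumTo (suc m) I       ≡⟨ cong (λ g → sumTo m G + g + #left + sumTo (suc m) I)
            (G-last e) ⟩
        sumTo m G + 0 + #left + sumTo (suc m) I         ≡⟨ cong (λ g → g + #left + sumTo (suc m) I)
            (+-identityʳ (sumTo m G)) ⟩
        sumTo m G + #left + sumTo (suc m) I             ≡⟨ +-assoc (sumTo m G) #left _ ⟩
        sumTo m G + (#left + sumTo (suc m) I)           ≡⟨ +-comm (sumTo m G) _ ⟩
        #left + sumTo (suc m) I + sumTo m G             ∎)
        where open ≡-Reasoning

  rank≡#left : rank la mu ≡ + #left
  rank≡#left = begin
    rank la mu                                      ≡⟨ cong₂ (λ x y → + x - + y)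
        (trans (cornerSum (outsideCornerᵇ la mu)) ΣO) (cornerSum (insideCornerᵇ la mu)) ⟩
    + (#left + sumTo M I) - + sumTo M I             ≡⟨ ℤₚ.m-n≡m⊖n (#left + sumTo M I) (sumTo M I) ⟩
    (#left + sumTo M I) ⊖ sumTo M I                 ≡⟨ ℤₚ.⊖-≥ (m≤n+m (sumTo M I) #left) ⟩
    + (#left + sumTo M I ∸ sumTo M I)               ≡⟨ cong +_ (m+n∸n≡m #left (sumTo M I)) ⟩
    + #left                                         ∎
    where open ≡-Reasoning

-- Interval sets with integer entries

All-flatten⁺ : {R : ℤ → Set} → ∀ ps → All (λ p → R (proj₁ p) × R (proj₂ p)) ps → All R (flatten ps)
All-flatten⁺ [] [] = []
All-flatten⁺ (p ∷ ps) ((r , s) ∷ rs) = r ∷ s ∷ All-flatten⁺ ps rs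

All-flatten⁻ : {R : ℤ → Set} → ∀ ps → All R (flatten ps) → All (λ p → R (proj₁ p) × R (proj₂ p)) ps
All-flatten⁻ [] [] = []
All-flatten⁻ (p ∷ ps) (r ∷ s ∷ rs) = (r , s) ∷ All-flatten⁻ ps rs

-- A left end and a right end differ because `P` and `Q` exclude each other, so only entries of the
-- same side remain to be compared.
Unique-flatten⁺ : {P Q : ℤ → Set} → (∀ {z} → P z → ¬ Q z) → ∀ {ps} → All (λ p → P (proj₁ p) × Q (proj₂ p)) ps →
  AllPairs (λ p q → proj₁ p ≢ proj₁ q × proj₂ p ≢ proj₂ q) ps → Unique (flatten ps)
Unique-flatten⁺ dis [] [] = []
Unique-flatten⁺ {P} {Q} dis {p ∷ ps} ((pu , qv) ∷ pqs) (ne ∷ nes) =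
  ((λ e → dis pu (subst Q (sym e) qv)) ∷ All-flatten⁺ ps
      (All.zipWith (λ ((_ , q) , n , _) → n , λ e → dis pu (subst Q (sym e) q)) (pqs , ne))) ∷
  All-flatten⁺ ps (All.zipWith (λ ((p , _) , _ , n) → (λ e → dis p (subst Q e qv)) , n) (pqs , ne)) ∷
  Unique-flatten⁺ dis pqs nes

Unique-flatten⁻ : ∀ {ps} → Unique (flatten ps) → AllPairs (λ p q → proj₁ p ≢ proj₁ q × proj₂ p ≢ proj₂ q) ps
Unique-flatten⁻ {[]} _ = []
Unique-flatten⁻ {p ∷ ps} ((_ ∷ u∉) ∷ v∉ ∷ un) =
  All.zipWith (λ ((n , _) , (_ , m)) → n , m) (All-flatten⁻ ps u∉ , All-flatten⁻ ps v∉) ∷ Unique-flatten⁻ un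

module IntervalSets {la mu : List ℕ} (pla : IsPartition la) (pmu : IsPartition mu)
    (bmu : InBox (length la) (row la 1) mu) (sub : mu ⊆ₚ la) where
  open Rank pla pmu bmu sub
  private
    M = length la
    C = row la 1
  open Depth M C
  open Letters (depth-steps bmu) (depth-steps bla)
  open Counting (depth-⊆ bmu bla sub)
  open Snakes M C bla bmu sub

  private
    ι² : ℕ × ℕ → ℤ × ℤ
    ι² (u , v) = ι M u , ι M v

    ι²-injective : ∀ {p q} → ι² p ≡ ι² q → p ≡ q
    ι²-injective {_ , _} {_ , _} eq = cong₂ _,_ (ι-injective M (cong proj₁ eq)) (ι-injective M (cong proj₂ eq))

    L R : ℤ → Set
    L z = ∃ λ k → z ≡ ι M k × IsLeft k
    R z = ∃ λ k → z ≡ ι M k × IsRight k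

    L⇒¬R : ∀ {z} → L z → ¬ R z
    L⇒¬R (k , refl , l) (k′ , eq , r) = left⇒¬right l (subst IsRight (sym (ι-injective M eq)) r)

    Sorted⇒valid : ∀ {qs} → Sorted 0 qs → ValidIntervalSet la mu (map ι² qs)
    Sorted⇒valid {qs} s =
      AllPairs⇒Linked (AllPairsₚ.map⁺ (AllPairs.map (ι-< M) (Sorted-sorted s))) ,
      Unique-flatten⁺ {L} {R} L⇒¬R (Allₚ.map⁺ (All.map (λ (_ , l , r) → (_ , refl , l) , (_ , refl , r)) good))
        (AllPairsₚ.map⁺ (AllPairs.zipWith (λ (n , m) → n ∘ ι-injective M , m ∘ ι-injective M)
            (AllPairsₚ.map⁻ uniqueˡ , AllPairsₚ.map⁻ uniqueʳ))) ,
      Allₚ.map⁺ (All.map (λ (lt , l , r) → ι-< M lt , left⇒IsL l , right⇒IsR r) good) ,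
      trans (cong +_ (trans (length-map ι² qs) full)) (sym rank≡#left)
      where open Matching (Sorted⇒Matching s)

    lift : ∀ {ps} → All (λ p → (proj₁ p ℤ.< proj₂ p) × IsL la mu (proj₁ p) × IsR la mu (proj₂ p)) ps →
      ∃ λ qs → ps ≡ map ι² qs × All (λ p → proj₁ p < proj₂ p × IsLeft (proj₁ p) × IsRight (proj₂ p)) qs
    lift [] = [] , refl , []
    lift ((lt , l , r) ∷ al) with IsL⇒left l | IsR⇒right r | lift al
    ... | u , refl , lu | v , refl , rv | qs , refl , good = (u , v) ∷ qs , refl , (ι-<⁻¹ M lt , lu , rv) ∷ good

    valid⇒Sorted : ∀ {ps} → ValidIntervalSet la mu ps → ∃ λ qs → Sorted 0 qs × ps ≡ map ι² qs
    valid⇒Sorted (linked , un , al , len) with lift al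
    ... | qs , refl , good with AllPairsₚ.map⁻ (Unique-flatten⁻ un) | AllPairsₚ.map⁻
        (Linked⇒AllPairs ℤₚ.<-trans linked)
    ...   | ne | sorted with Matching-sort (matching good
              (AllPairsₚ.map⁺ (AllPairs.map (λ (n , _) → n ∘ cong (ι M)) ne))
                  (AllPairsₚ.map⁺ (AllPairs.map (λ (_ , n) → n ∘ cong (ι M)) ne))
              (trans (sym (length-map ι² qs)) (ℤₚ.+-injective (trans len rank≡#left))))
    ...     | qs′ , s , perm with sorted-↭⇒≡ <-asym (AllPairs.map (ι-<⁻¹ M) sorted) (Sorted-sorted s) perm
    ...       | refl = qs , s , refl

  enum-intervalSets : Enum (ValidIntervalSet la mu) #sorted
  enum-intervalSets = enum-⇔ (λ { (_ , s , refl) → Sorted⇒valid s }) valid⇒Sorted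
    (enum-map (map ι²) (λ _ _ → map-injective ι²-injective) (enum-Sorted N 0 (+-identityʳ N)))

  intervalSet-↔ : Fin #sorted ↔ IntervalSet la mu
  intervalSet-↔ = enum-inverse (setoid (IntervalSet la mu)) enum-intervalSets (λ x ps → IntervalSet.pairs x ≡ ps)
    (λ { (mkIntervalSet ps v) → ps , recompute
        (DecMembership._∈?_ (≡-dec (×-≡-dec ℤ._≟_ ℤ._≟_)) ps (list enum-intervalSets))
        (complete enum-intervalSets v) , refl })
    (λ ps v → mkIntervalSet ps v , refl)
    (λ { refl _ _ refl refl → refl })
    (λ { {mkIntervalSet _ _} {mkIntervalSet _ _} _ refl refl → refl })

theorem4p5 : (la mu : Partition) → parts mu ⊆ₚ parts la →
    (r : ℕ) → rank (parts la) (parts mu) ≡ + r →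
    ∃ λ n → (Fin n ↔ IntervalSet (parts la) (parts mu))
    × Inverse (setoid (Fin (n * n))) (MinDecompositionSetoid (parts la) (parts mu))
    × (Fin ((r !) * n) ↔ MinTableau (parts la) (parts mu))
theorem4p5 la mu sub r rank≡r = #sorted , intervalSet-↔ ,
    CountDecompositions.minDecomposition-inverse M C bla bmu sub ,
    subst (λ r → Fin ((r !) * #sorted) ↔ MinTableau (parts la) (parts mu))
        (ℤₚ.+-injective (trans (sym rank≡#left) rank≡r))
      (Tableaux.minTableau-↔ M C bla bmu sub)
  where
  M = length (parts la)
  C = row (parts la) 1
  bmu : InBox M C (parts mu)
  bmu = Tableaux.⊆⇒inBox M C (inBox (isPart la) (row-beyond (parts la)) ≤-refl) (isPart mu) sub
  open Rank (isPart la) (isPart mu) bmu sub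
  open IntervalSets (isPart la) (isPart mu) bmu sub
  open Depth M C
  open Letters (depth-steps bmu) (depth-steps bla)
  open Counting (depth-⊆ bmu bla sub)
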